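{- There exist absolute constants $K,K'>0$ such that the following holds. Let $n\ge1$, $\epsilon\ge0$, $\delta>0$ with $\delta\ge K\sqrt{\epsilon}$, and let $f\colon S_n\to\{0,1\}$ satisfy $\mathbb{E}[(f-\ell)^2]\le\epsilon$ for some linear $\ell\colon S_n\to\mathbb{R}$ and $\delta\le\mathbb{E}[f]\le1-\delta$. Then there is a dictator $g$ with $\Pr[f\neq g]\le K'\epsilon/\delta$.
   Context: $S_n$ is the symmetric group on $[n]$; expectations and probabilities are over uniformly random $\pi\in S_n$. $x_{i,j}(\pi)=1$ if $\pi(i)=j$ and $0$ otherwise; a function is linear if it equals $\sum_{i,j}c_{i,j}x_{i,j}$ for reals $c_{i,j}$. A dictator is a function of the form $\sum_{(i,j)\in\mathcal{C}}x_{i,j}$ where all elements of $\mathcal{C}\subseteq[n]^2$ share the same first coordinate or all share the same second coordinate.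
   Formalization: The constants K, K', the parameters ε and δ, and the coefficients of the linear function ℓ are rational numbers rather than real numbers. -}

module Defs where

open import Data.Bool using (Bool; true; false; not; _∧_; T; if_then_else_)
open import Data.Nat using (ℕ; zero; suc)
open import Data.Nat using (_!)
open import Data.Nat.Properties using (_!≢0)
open import Data.Fin using (Fin; _≟_)
open import Data.Vec using (Vec; []; _∷_; lookup)
open import Data.List using (List; []; _∷_; concatMap; map; foldr; any; mapMaybe)
open import Data.Maybe using (Maybe; just; nothing)
open import Data.List using (allFin)
open import Data.Integer using (ℤ; +_)
open import Data.Rational using (ℚ; 0ℚ; 1ℚ; _+_; _*_; _-_; _/_) renaming (_≟_ to _ℚ≟_)
open import Data.Product using (Σ)
open import Data.Sum using (_⊎_)
open import Relation.Binary.PropositionalEquality using (_≡_)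
open import Relation.Nullary.Decidable using (⌊_⌋; yes; no)
open import Relation.Nullary.Decidable using (T?)

distinct : ∀ {n m} → Vec (Fin n) m → Bool
distinct []       = true
distinct (x ∷ xs) = not (anyV xs) ∧ distinct xs
  where
  anyV : ∀ {k} → Vec (Fin _) k → Bool
  anyV []       = false
  anyV (y ∷ ys) = ⌊ x ≟ y ⌋ Data.Bool.∨ anyV ys

record Perm (n : ℕ) : Set where
  constructor perm
  field
    img      : Vec (Fin n) n
    distinct-img : T (distinct img)

app : ∀ {n} → Perm n → Fin n → Fin n
app π i = lookup (Perm.img π) i

allVecs : (n m : ℕ) → List (Vec (Fin n) m)
allVecs n zero    = [] ∷ []
allVecs n (suc m) = concatMap (λ i → map (i ∷_) (allVecs n m)) (allFin n)

toPerm : ∀ {n} → Vec (Fin n) n → Maybe (Perm n)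
toPerm v with T? (distinct v)
... | yes d = just (perm v d)
... | no  _ = nothing

allPerms : (n : ℕ) → List (Perm n)
allPerms n = mapMaybe toPerm (allVecs n n)

sumℚ : ∀ {A : Set} → (A → ℚ) → List A → ℚ
sumℚ h = foldr (λ a s → h a + s) 0ℚ

𝔼 : (n : ℕ) → (Perm n → ℚ) → ℚ
𝔼 n h = sumℚ h (allPerms n) * ((+ 1) / (n !))
  where instance _ = n !≢0

Pr : (n : ℕ) → (Perm n → Bool) → ℚ
Pr n P = 𝔼 n (λ π → if P π then 1ℚ else 0ℚ)

x : ∀ {n} → Fin n → Fin n → Perm n → ℚ
x i j π = if ⌊ app π i ≟ j ⌋ then 1ℚ else 0ℚ

sumFin : ∀ n → (Fin n → ℚ) → ℚ
sumFin n h = sumℚ h (allFin n)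

linear : ∀ {n} → (Fin n → Fin n → ℚ) → Perm n → ℚ
linear {n} c π = sumFin n (λ i → sumFin n (λ j → c i j * x i j π))

sumOver : ∀ {n} → (Fin n → Fin n → Bool) → Perm n → ℚ
sumOver {n} 𝒞 π =
  sumFin n (λ i → sumFin n (λ j → if 𝒞 i j then x i j π else 0ℚ))

toℚ : Bool → ℚ
toℚ b = if b then 1ℚ else 0ℚ

IsDictatorSet : ∀ {n} → (Fin n → Fin n → Bool) → Set
IsDictatorSet {n} 𝒞 =
  (Σ (Fin n) λ i₀ → ∀ i j → T (𝒞 i j) → i ≡ i₀)
  ⊎ (Σ (Fin n) λ j₀ → ∀ i j → T (𝒞 i j) → j ≡ j₀)

PrNeq : ∀ n → (Perm n → ℚ) → (Perm n → ℚ) → ℚ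
PrNeq n f g = Pr n (λ π → not ⌊ f π ℚ≟ g π ⌋)

{-# OPTIONS --safe #-}

-- For rows i, k and columns a, b let D(i,k;a,b) = c(i,a) + c(k,b) - c(i,b) - c(k,a): this is the change of ℓ when a
-- permutation with i ↦ a and k ↦ b is composed with the transposition of i and k. Let σ and υ have disjoint supports.
-- Since f is Boolean and ℓ is additive on the square π, πσ, πυ, πσυ, it cannot change by at least ½ along υ and
-- noticeably along σ unless it is far from f at a corner. Averaging over all σ supported on a block of rows, and
-- computing the variance of a linear function over such σ from the squares of the D's (a Poincaré identity with
-- equality), this controls the total D² of the rectangles disjoint from a rectangle, or a block, along which ℓ varies.
--
-- If some row i carries almost all the weight, in that Σ D² over the rectangles avoiding row i is O(n³ε/δ), then ℓ is
-- close to a function of π(i), and rounding that function gives the dictator; columns follow by inverting permutations.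
-- There are three regimes.
-- nδ ≥ 3072: splitting the rows at random into halves bounds Σ D²D'² over disjoint pairs of rectangles by O(n⁶ε), which
-- is much less than (Σ D²)² ≥ n⁶δ²/16. Hence some line meets a constant fraction of the weight, and then the weight
-- avoiding it is O(n³ε/δ).
-- nδ ≤ 3072 and n ≥ 192: now n²ε is tiny, so each D is almost 0 or at least ½ in absolute value. In the latter case one
-- of the four corners of the rectangle is heavy (a positive fraction of the rectangles with this corner is large), and
-- heavy corners lie on a common line.
-- n ≤ 192: ℓ is uniformly close to f. The transpositions changing f at π form a star with some centre i, and f is
-- constant on the permutations agreeing with π at i; the cells (i, π(i)) obtained in this way determine a dictator.

module Submission where

open import Defs
open import Data.Bool using (Bool; true; false; not; _∧_; _∨_; T; if_then_else_)
open import Data.Bool.Properties using (T-irrelevant)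
import Data.Bool.Properties as Boolₚ
open import Data.Empty using (⊥; ⊥-elim)
open import Data.Fin using (Fin; zero; suc; toℕ; punchOut; _≟_)
open import Data.Fin.Properties using (any?; all?; punchOut-injective; injective⇒≤; suc-injective)
open import Data.Fin.Permutation.Components using (transpose; transpose-inverse)
open import Data.Integer using (+_)
import Data.Integer as ℤ
import Data.Integer.Properties as ℤₚ
open import Data.List using (List; []; _∷_; concatMap; mapMaybe; allFin)
import Data.List as List
open import Data.Maybe using (Maybe; just; nothing; maybe′)
open import Data.Nat using (ℕ; zero; suc; z≤n; s≤s; _!) renaming (_≥_ to _≥ℕ_)
import Data.Nat as ℕ
import Data.Nat.Properties as ℕₚ
import Data.Nat.DivMod as ℕ-DivMod
open import Data.Product using (Σ; ∃; _×_; _,_; proj₁; proj₂)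
open import Data.Rational using (ℚ; 0ℚ; 1ℚ; ½; _<_; _≤_; _+_; _*_; _-_; -_; _/_; _≤?_; _<?_; nonNegative; positive) renaming (_≟_ to _ℚ≟_)
import Data.Rational as ℚ
import Data.Rational.Properties as ℚₚ
open import Data.Rational.Solver using (module +-*-Solver)
open +-*-Solver using (Polynomial; solve; con; _:=_; _:+_; _:*_; _:-_; :-_)
import Data.Rational.Unnormalised as ℚᵘ
import Data.Rational.Unnormalised.Properties as ℚᵘₚ
open import Data.Sum using (_⊎_; inj₁; inj₂)
import Data.Sum as Sum
open import Data.Unit using (tt)
open import Data.Vec using (Vec; []; _∷_; lookup; tabulate)
import Data.Vec as Vec
import Data.Vec.Properties as Vecₚ
open import Function using (_∘_; id)
open import Relation.Binary.Definitions using (DecidableEquality)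
open import Relation.Binary.PropositionalEquality using (_≡_; _≢_; refl; sym; trans; cong; cong₂; subst; subst₂; module ≡-Reasoning)
open import Relation.Nullary using (¬_; Dec; yes; no; contradiction)
open import Relation.Nullary.Decidable using (⌊_⌋; T?; map′; toWitness; _×-dec_; _→-dec_; ¬?)

-- Rational arithmetic

-- The loss ε/δ comes from using the square inequality a second time. Once row i carries weight of
-- order n³δ, some n³δ/256 of the rectangles on row i have |D| ≥ ½. Each of them controls the weight
-- disjoint from it, so the weight avoiding row i, multiplied by n³δ, is O(n⁶ε). The obstacle is
-- that the square inequality says nothing about two rectangles with a common line. A given
-- rectangle avoiding row i shares a line with up to 6n² of the rectangles on row i, which is
-- harmless against n³δ/256 when nδ ≥ 3072. When nδ is bounded, δ ≥ K√ε makes ε much smaller than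
-- n⁻², the order of the probability of prescribing two images, so each single D is controlled.
-- Counting pairs of rectangles at two given corners still loses 6n³ out of n⁴/16, whence n ≥ 192.
-- For smaller n the crude bound n!·ε of the pointwise error suffices, and it is the origin of the
-- factor 192! in K.

# : ℕ → ℚ
# k = + k / 1

infix 9 :#_ _:²

:#_ : ∀ {n} → ℕ → Polynomial n
:# k = con (# k)

_:² : ∀ {n} → Polynomial n → Polynomial n
p :² = p :* p

to0 : ∀ {a b} → a ≤ b → 0ℚ ≤ b - a
to0 {a} {b} a≤b = subst (_≤ b - a) (ℚₚ.+-inverseʳ a) (ℚₚ.+-monoˡ-≤ (- a) a≤b)

from0 : ∀ {a b} → 0ℚ ≤ b - a → a ≤ b
from0 {a} {b} 0≤d = subst₂ _≤_ (ℚₚ.+-identityˡ a) (lem a b) (ℚₚ.+-monoˡ-≤ a 0≤d)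
  where
  lem = solve 2 (λ a b → (b :- a) :+ a := b) refl

-- Inequalities are proved by exhibiting the difference of their sides as a visibly nonnegative expression.
by-difference : ∀ {a b s} → 0ℚ ≤ s → b - a ≡ s → a ≤ b
by-difference 0≤s eq = from0 (subst (0ℚ ≤_) (sym eq) 0≤s)

infixl 6 _⊕_
infixl 7 _⊛_

_⊕_ : ∀ {a b} → 0ℚ ≤ a → 0ℚ ≤ b → 0ℚ ≤ a + b
_⊕_ {a} {b} p q = subst (_≤ a + b) (ℚₚ.+-identityˡ 0ℚ) (ℚₚ.+-mono-≤ p q)

_⊛_ : ∀ {a b} → 0ℚ ≤ a → 0ℚ ≤ b → 0ℚ ≤ a * b
_⊛_ {a} {b} p q = ℚₚ.nonNegative⁻¹ (a * b)
  {{ℚₚ.nonNeg*nonNeg⇒nonNeg a {{nonNegative p}} b {{nonNegative q}}}}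

sq : ℚ → ℚ
sq a = a * a

0≤sq : ∀ a → 0ℚ ≤ sq a
0≤sq a with ℚₚ.≤-total 0ℚ a
... | inj₁ p = p ⊛ p
... | inj₂ p = subst (0ℚ ≤_) (lem a) (q ⊛ q)
  where
  lem = solve 1 (λ a → (:# 0 :- a) :² := a :²) refl
  q : 0ℚ ≤ 0ℚ - a
  q = to0 p

0≤# : ∀ k → 0ℚ ≤ # k
0≤# k = ℚₚ.nonNegative⁻¹ (# k) {{ℚₚ.normalize-nonNeg k 1}}

0≤1 : 0ℚ ≤ 1ℚ
0≤1 = 0≤# 1

toℚᵘ-# : ∀ k → ℚ.toℚᵘ (# k) ℚᵘ.≃ ℚᵘ.mkℚᵘ (+ k) 0
toℚᵘ-# k = ℚₚ.toℚᵘ-fromℚᵘ (ℚᵘ.mkℚᵘ (+ k) 0)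

#-+ : ∀ a b → # (a ℕ.+ b) ≡ # a + # b
#-+ a b = ℚₚ.toℚᵘ-injective (begin
  ℚ.toℚᵘ (# (a ℕ.+ b))                        ≈⟨ toℚᵘ-# (a ℕ.+ b) ⟩
  ℚᵘ.mkℚᵘ (+ (a ℕ.+ b)) 0                     ≈⟨ ℚᵘ.*≡* eq ⟩
  ℚᵘ.mkℚᵘ (+ a) 0 ℚᵘ.+ ℚᵘ.mkℚᵘ (+ b) 0        ≈⟨ ℚᵘₚ.+-cong (toℚᵘ-# a) (toℚᵘ-# b) ⟨
  ℚ.toℚᵘ (# a) ℚᵘ.+ ℚ.toℚᵘ (# b)              ≈⟨ ℚₚ.toℚᵘ-homo-+ (# a) (# b) ⟨
  ℚ.toℚᵘ (# a + # b)                          ∎)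
  where
  open ℚᵘₚ.≃-Reasoning
  eq : + (a ℕ.+ b) ℤ.* + 1 ≡ (+ a ℤ.* + 1 ℤ.+ + b ℤ.* + 1) ℤ.* + 1
  eq = cong (ℤ._* + 1) (sym (cong₂ ℤ._+_ (ℤₚ.*-identityʳ (+ a)) (ℤₚ.*-identityʳ (+ b))))

#-* : ∀ a b → # (a ℕ.* b) ≡ # a * # b
#-* a b = ℚₚ.toℚᵘ-injective (begin
  ℚ.toℚᵘ (# (a ℕ.* b))                        ≈⟨ toℚᵘ-# (a ℕ.* b) ⟩
  ℚᵘ.mkℚᵘ (+ (a ℕ.* b)) 0                     ≈⟨ ℚᵘ.*≡* (cong (ℤ._* + 1) (ℤₚ.pos-* a b)) ⟩
  ℚᵘ.mkℚᵘ (+ a) 0 ℚᵘ.* ℚᵘ.mkℚᵘ (+ b) 0        ≈⟨ ℚᵘₚ.*-cong (toℚᵘ-# a) (toℚᵘ-# b) ⟨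
  ℚ.toℚᵘ (# a) ℚᵘ.* ℚ.toℚᵘ (# b)              ≈⟨ ℚₚ.toℚᵘ-homo-* (# a) (# b) ⟨
  ℚ.toℚᵘ (# a * # b)                          ∎)
  where open ℚᵘₚ.≃-Reasoning

#-suc : ∀ k → # (suc k) ≡ 1ℚ + # k
#-suc k = #-+ 1 k

#-mono : ∀ {a b} → a ℕ.≤ b → # a ≤ # b
#-mono {a} {b} a≤b = by-difference (0≤# (b ℕ.∸ a))
  (trans (cong (λ m → # m - # a) (sym (ℕₚ.m+[n∸m]≡n a≤b)))
    (trans (cong (_- # a) (#-+ a (b ℕ.∸ a))) (lem (# a) (# (b ℕ.∸ a)))))
  where
  lem = solve 2 (λ p q → (p :+ q) :- p := q) refl

0<#suc : ∀ k → 0ℚ < # (suc k)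
0<#suc k = ℚₚ.positive⁻¹ (# (suc k)) {{ℚₚ.normalize-pos (suc k) 1}}

*-cancelˡ : ∀ r {p q} → 0ℚ < r → r * p ≤ r * q → p ≤ q
*-cancelˡ r 0<r = ℚₚ.*-cancelˡ-≤-pos r {{positive 0<r}}

*-cancelˡ-≡ : ∀ r {p q} → 0ℚ < r → r * p ≡ r * q → p ≡ q
*-cancelˡ-≡ r 0<r eq = ℚₚ.≤-antisym (*-cancelˡ r 0<r (ℚₚ.≤-reflexive eq)) (*-cancelˡ r 0<r (ℚₚ.≤-reflexive (sym eq)))

0<* : ∀ {a b} → 0ℚ < a → 0ℚ < b → 0ℚ < a * b
0<* {a} {b} p q = ℚₚ.positive⁻¹ (a * b) {{ℚₚ.pos*pos⇒pos a {{positive p}} b {{positive q}}}}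

*-monoˡ : ∀ {r p q} → 0ℚ ≤ r → p ≤ q → r * p ≤ r * q
*-monoˡ {r} 0≤r = ℚₚ.*-monoˡ-≤-nonNeg r {{nonNegative 0≤r}}

*-mono : ∀ {p q r s} → 0ℚ ≤ p → 0ℚ ≤ s → p ≤ q → r ≤ s → p * r ≤ q * s
*-mono {p} {q} {r} {s} 0≤p 0≤s p≤q r≤s = by-difference (0≤p ⊛ to0 r≤s ⊕ to0 p≤q ⊛ 0≤s) (lem p q r s)
  where
  lem = solve 4 (λ p q r s → q :* s :- p :* r := p :* (s :- r) :+ (q :- p) :* s) refl

≤⇒¬< : ∀ {a b} → a ≤ b → ¬ (b < a)
≤⇒¬< a≤b b<a = ℚₚ.<-irrefl refl (ℚₚ.<-≤-trans b<a a≤b)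

≰⇒≥ : ∀ {a b} → ¬ (a ≤ b) → b ≤ a
≰⇒≥ a≰b = ℚₚ.<⇒≤ (ℚₚ.≰⇒> a≰b)

-- Finite sums

variable
  X Y : Set

-- Abstract so that summands can be inferred by unification.
abstract
  sum : (X → ℚ) → List X → ℚ
  sum = sumℚ

  sum≡sumℚ : ∀ (F : X → ℚ) L → sum F L ≡ sumℚ F L
  sum≡sumℚ F L = refl

  sum-[] : ∀ (F : X → ℚ) → sum F [] ≡ 0ℚ
  sum-[] F = refl

  sum-∷ : ∀ (F : X → ℚ) a L → sum F (a ∷ L) ≡ F a + sum F L
  sum-∷ F a L = refl

  sum-cong : ∀ {F G : X → ℚ} L → (∀ a → F a ≡ G a) → sum F L ≡ sum G L
  sum-cong []      eq = refl
  sum-cong (a ∷ L) eq = cong₂ _+_ (eq a) (sum-cong L eq)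

  sum-0 : ∀ (L : List X) → sum (λ _ → 0ℚ) L ≡ 0ℚ
  sum-0 []      = refl
  sum-0 (a ∷ L) = trans (ℚₚ.+-identityˡ _) (sum-0 L)

  sum-+ : ∀ (F G : X → ℚ) L → sum (λ a → F a + G a) L ≡ sum F L + sum G L
  sum-+ F G []      = refl
  sum-+ F G (a ∷ L) = trans (cong (_+_ (F a + G a)) (sum-+ F G L)) 
    (solve 4 (λ a b c d → (a :+ b) :+ (c :+ d) := (a :+ c) :+ (b :+ d)) refl (F a) (G a) (sum F L) (sum G L))

  sum-*ˡ : ∀ k (F : X → ℚ) L → sum (λ a → k * F a) L ≡ k * sum F L
  sum-*ˡ k F []      = sym (ℚₚ.*-zeroʳ k)
  sum-*ˡ k F (a ∷ L) = trans (cong (_+_ (k * F a)) (sum-*ˡ k F L)) (sym (ℚₚ.*-distribˡ-+ k (F a) (sum F L)))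

  sum-*ʳ : ∀ k (F : X → ℚ) L → sum (λ a → F a * k) L ≡ sum F L * k
  sum-*ʳ k F L = trans (sum-cong L (λ a → ℚₚ.*-comm (F a) k)) (trans (sum-*ˡ k F L) (ℚₚ.*-comm k (sum F L)))

  sum-- : ∀ (F G : X → ℚ) L → sum (λ a → F a - G a) L ≡ sum F L - sum G L
  sum-- F G []      = refl
  sum-- F G (a ∷ L) = trans (cong (_+_ (F a - G a)) (sum-- F G L)) 
    (solve 4 (λ a b c d → (a :- b) :+ (c :- d) := (a :+ c) :- (b :+ d)) refl (F a) (G a) (sum F L) (sum G L))

  sum-nonneg : ∀ {F : X → ℚ} L → (∀ a → 0ℚ ≤ F a) → 0ℚ ≤ sum F L
  sum-nonneg []      p = ℚₚ.≤-refl
  sum-nonneg (a ∷ L) p = p a ⊕ sum-nonneg L p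

  sum-mono : ∀ {F G : X → ℚ} L → (∀ a → F a ≤ G a) → sum F L ≤ sum G L
  sum-mono []      p = ℚₚ.≤-refl
  sum-mono (a ∷ L) p = ℚₚ.+-mono-≤ (p a) (sum-mono L p)

  sum-++ : ∀ (F : X → ℚ) L M → sum F (L List.++ M) ≡ sum F L + sum F M
  sum-++ F []      M = sym (ℚₚ.+-identityˡ _)
  sum-++ F (a ∷ L) M = trans (cong (_+_ (F a)) (sum-++ F L M)) (sym (ℚₚ.+-assoc (F a) (sum F L) (sum F M)))

  sum-map : ∀ (F : Y → ℚ) (g : X → Y) L → sum F (List.map g L) ≡ sum (F ∘ g) L
  sum-map F g []      = refl
  sum-map F g (a ∷ L) = cong (_+_ (F (g a))) (sum-map F g L)

  sum-concatMap : ∀ (F : Y → ℚ) (g : X → List Y) L → sum F (concatMap g L) ≡ sum (λ a → sum F (g a)) L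
  sum-concatMap F g []      = refl
  sum-concatMap F g (a ∷ L) = trans (sum-++ F (g a) (concatMap g L)) (cong (_+_ (sum F (g a))) (sum-concatMap F g L))

  sum-mapMaybe : ∀ (F : Y → ℚ) (p : X → Maybe Y) L → sum F (mapMaybe p L) ≡ sum (λ a → maybe′ F 0ℚ (p a)) L
  sum-mapMaybe F p []      = refl
  sum-mapMaybe F p (a ∷ L) with p a
  ... | just b  = cong (_+_ (F b)) (sum-mapMaybe F p L)
  ... | nothing = trans (sum-mapMaybe F p L) (sym (ℚₚ.+-identityˡ _))

  sum-swap : ∀ (F : X → Y → ℚ) L M → sum (λ a → sum (F a) M) L ≡ sum (λ b → sum (λ a → F a b) L) M
  sum-swap F []      M = sym (sum-0 M)
  sum-swap F (a ∷ L) M = trans (cong (_+_ (sum (F a) M)) (sum-swap F L M)) (sym (sum-+ (F a) (λ b → sum (λ a → F a b) L) M))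

⟦_⟧ : ∀ {P : Set} → Dec P → ℚ
⟦ d ⟧ = toℚ ⌊ d ⌋

module _ {P : Set} where

  ⟦⟧-yes : (d : Dec P) → P → ⟦ d ⟧ ≡ 1ℚ
  ⟦⟧-yes (yes _) p = refl
  ⟦⟧-yes (no ¬p) p = contradiction p ¬p

  ⟦⟧-no : (d : Dec P) → ¬ P → ⟦ d ⟧ ≡ 0ℚ
  ⟦⟧-no (yes p) ¬p = contradiction p ¬p
  ⟦⟧-no (no _)  ¬p = refl

  0≤⟦⟧ : (d : Dec P) → 0ℚ ≤ ⟦ d ⟧
  0≤⟦⟧ (yes _) = 0≤1
  0≤⟦⟧ (no _)  = ℚₚ.≤-refl

  ⟦⟧≤1 : (d : Dec P) → ⟦ d ⟧ ≤ 1ℚ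
  ⟦⟧≤1 (yes _) = ℚₚ.≤-refl
  ⟦⟧≤1 (no _)  = 0≤1

⟦⟧-⇔ : ∀ {P Q : Set} (d : Dec P) (e : Dec Q) → (P → Q) → (Q → P) → ⟦ d ⟧ ≡ ⟦ e ⟧
⟦⟧-⇔ d (yes q) f g = ⟦⟧-yes d (g q)
⟦⟧-⇔ d (no ¬q) f g = ⟦⟧-no d (¬q ∘ f)

⟦⟧-× : ∀ {P Q R : Set} (d : Dec P) (e : Dec Q) (r : Dec R) → (P → Q × R) → (Q → R → P) → ⟦ d ⟧ ≡ ⟦ e ⟧ * ⟦ r ⟧
⟦⟧-× d (yes q) (yes r) f g = ⟦⟧-yes d (g q r)
⟦⟧-× d (yes q) (no ¬r) f g = ⟦⟧-no d (¬r ∘ proj₂ ∘ f)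
⟦⟧-× d (no ¬q) r       f g = trans (⟦⟧-no d (¬q ∘ proj₁ ∘ f)) (sym (ℚₚ.*-zeroˡ ⟦ r ⟧))

-- Completeness without repetition is stated as a sum of Kronecker deltas. Reindexing along a
-- bijection is then an exchange of two sums, and no rearrangement of lists occurs.
module Enumeration {A : Set} (_≈?_ : DecidableEquality A) (L : List A)
  (once : ∀ a → sum (λ b → ⟦ a ≈? b ⟧) L ≡ 1ℚ) where

  ⟦≈⟧-subst : ∀ (F : A → ℚ) a b → ⟦ a ≈? b ⟧ * F b ≡ ⟦ a ≈? b ⟧ * F a
  ⟦≈⟧-subst F a b with a ≈? b
  ... | yes refl = refl
  ... | no _     = trans (ℚₚ.*-zeroˡ (F b)) (sym (ℚₚ.*-zeroˡ (F a)))

  sum-point : ∀ (F : A → ℚ) a → sum (λ b → ⟦ a ≈? b ⟧ * F b) L ≡ F a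
  sum-point F a = trans (sum-cong L (⟦≈⟧-subst F a)) (trans (sum-*ʳ (F a) _ L)
    (trans (cong (_* F a) (once a)) (ℚₚ.*-identityˡ (F a))))

  sum-reindex : ∀ (F : A → ℚ) (φ ψ : A → A) → (∀ a → ψ (φ a) ≡ a) → (∀ a → φ (ψ a) ≡ a) →
                sum (λ a → F (φ a)) L ≡ sum F L
  sum-reindex F φ ψ ψφ φψ = begin
    sum (λ a → F (φ a)) L
      ≡⟨ sum-cong L (λ a → sum-point F (φ a)) ⟨
    sum (λ a → sum (λ b → ⟦ φ a ≈? b ⟧ * F b) L) L
      ≡⟨ sum-swap (λ a b → ⟦ φ a ≈? b ⟧ * F b) L L ⟩
    sum (λ b → sum (λ a → ⟦ φ a ≈? b ⟧ * F b) L) L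
      ≡⟨ sum-cong L (λ b → trans (sum-*ʳ (F b) (λ a → ⟦ φ a ≈? b ⟧) L)
           (trans (cong (_* F b) (trans (sum-cong L (flip b)) (once (ψ b)))) (ℚₚ.*-identityˡ (F b)))) ⟩
    sum F L ∎
    where
    open ≡-Reasoning
    flip : ∀ b a → ⟦ φ a ≈? b ⟧ ≡ ⟦ ψ b ≈? a ⟧
    flip b a = ⟦⟧-⇔ (φ a ≈? b) (ψ b ≈? a) (λ eq → trans (cong ψ (sym eq)) (ψφ a)) (λ eq → trans (cong φ (sym eq)) (φψ b))

  single≤sum : ∀ (F : A → ℚ) → (∀ a → 0ℚ ≤ F a) → ∀ a → F a ≤ sum F L
  single≤sum F 0≤F a = subst (_≤ sum F L) (sum-point F a) (sum-mono L (λ b →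
    by-difference (to0 (⟦⟧≤1 (a ≈? b)) ⊛ 0≤F b) (lem ⟦ a ≈? b ⟧ (F b))))
    where
    lem = solve 2 (λ p q → q :- p :* q := (:# 1 :- p) :* q) refl

∑ : ∀ {n} → (Fin n → ℚ) → ℚ
∑ {n} F = sum F (allFin n)

∑-cong : ∀ {n} {F G : Fin n → ℚ} → (∀ i → F i ≡ G i) → ∑ F ≡ ∑ G
∑-cong {n} = sum-cong (allFin n)

∑-mono : ∀ {n} {F G : Fin n → ℚ} → (∀ i → F i ≤ G i) → ∑ F ≤ ∑ G
∑-mono {n} = sum-mono (allFin n)

∑-nonneg : ∀ {n} {F : Fin n → ℚ} → (∀ i → 0ℚ ≤ F i) → 0ℚ ≤ ∑ F
∑-nonneg {n} = sum-nonneg (allFin n)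

sum-tabulate : ∀ {n} (F : X → ℚ) (g : Fin n → X) → sum F (List.tabulate g) ≡ ∑ (λ i → F (g i))
sum-tabulate {n = zero}  F g = trans (sum-[] F) (sym (sum-[] (λ i → F (g i))))
sum-tabulate {n = suc n} F g = trans (sum-∷ F (g zero) (List.tabulate (g ∘ suc)))
  (trans (cong (_+_ (F (g zero))) (trans (sum-tabulate F (g ∘ suc)) (sym (sum-tabulate (F ∘ g) suc))))
    (sym (sum-∷ (F ∘ g) zero (List.tabulate suc))))

∑-suc : ∀ {n} (F : Fin (suc n) → ℚ) → ∑ F ≡ F zero + ∑ (λ i → F (suc i))
∑-suc F = trans (sum-∷ F zero (List.tabulate suc)) (cong (_+_ (F zero)) (sum-tabulate F suc))

∑-const : ∀ n k → ∑ {n} (λ _ → k) ≡ # n * k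
∑-const zero    k = trans (sum-[] {X = Fin 0} (λ _ → k)) (sym (ℚₚ.*-zeroˡ k))
∑-const (suc n) k = trans (∑-suc {n} (λ _ → k)) (trans (cong (_+_ k) (∑-const n k))
  (trans (lem k (# n)) (cong (_* k) (sym (#-suc n)))))
  where
  lem = solve 2 (λ k m → k :+ m :* k := (:# 1 :+ m) :* k) refl

∑-once : ∀ {n} (i : Fin n) → ∑ (λ j → ⟦ i ≟ j ⟧) ≡ 1ℚ
∑-once {suc n} zero    = trans (∑-suc (λ j → ⟦ zero ≟ j ⟧))
  (trans (cong (_+_ 1ℚ) (trans (∑-cong (λ j → ⟦⟧-no (zero ≟ suc j) (λ ()))) (sum-0 (allFin n)))) (ℚₚ.+-identityʳ 1ℚ))
∑-once {suc n} (suc i) = trans (∑-suc (λ j → ⟦ suc i ≟ j ⟧))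
  (trans (ℚₚ.+-identityˡ _) (trans (∑-cong (λ j → ⟦⟧-⇔ (suc i ≟ suc j) (i ≟ j) suc-injective (cong suc))) (∑-once i)))

module ∑-Enum {n} = Enumeration (_≟_ {n}) (allFin n) ∑-once

∑-single : ∀ {n} (F : Fin n → ℚ) i → ∑ (λ j → ⟦ i ≟ j ⟧ * F j) ≡ F i
∑-single = ∑-Enum.sum-point

-- Permutations

T-∧ˡ : ∀ a {b} → T (a ∧ b) → T a
T-∧ˡ true _ = tt

T-∧ʳ : ∀ a {b} → T (a ∧ b) → T b
T-∧ʳ true p = p

T-not : ∀ {b} → T b → ¬ T (not b)
T-not {true} _ ()

T-∧ : ∀ {a b} → T a → T b → T (a ∧ b)
T-∧ {true} _ q = q

Distinct : ∀ {n m} → Vec (Fin n) m → Set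
Distinct v = T (distinct v)

_∉ᵥ_ : ∀ {n m} → Fin n → Vec (Fin n) m → Set
y ∉ᵥ v = ∀ t → y ≢ lookup v t

-- The auxiliary function of distinct ignores the vector it closes over, which lets both unfoldings share the Boolean b.
distinct-step : ∀ {n m} (y z : Fin n) (v : Vec (Fin n) m) →
  Σ Bool λ b → (distinct (y ∷ z ∷ v) ≡ not (⌊ y ≟ z ⌋ ∨ b) ∧ distinct (z ∷ v)) × (distinct (y ∷ v) ≡ not b ∧ distinct v)
distinct-step y z v = _ , refl , refl

distinct-tail : ∀ {n m} (y : Fin n) (v : Vec (Fin n) m) → Distinct (y ∷ v) → Distinct v
distinct-tail y []      p = tt
distinct-tail y (z ∷ v) p with distinct-step y z v
... | b , eq , _ = T-∧ʳ (not (⌊ y ≟ z ⌋ ∨ b)) (subst T eq p)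

distinct-head : ∀ {n m} (y : Fin n) (v : Vec (Fin n) m) → Distinct (y ∷ v) → y ∉ᵥ v
distinct-head y (z ∷ v) p t with y ≟ z | distinct-step y z v
distinct-head y (z ∷ v) p t       | yes _  | b , eq , _  = ⊥-elim (subst T eq p)
distinct-head y (z ∷ v) p zero    | no y≢z | _           = y≢z
distinct-head y (z ∷ v) p (suc t) | no _   | b , eq , eq′ =
  distinct-head y v (subst T (sym eq′) (T-∧ {not b} (T-∧ˡ _ (subst T eq p)) (distinct-tail z v (T-∧ʳ (not b) (subst T eq p))))) t

distinct-∷ : ∀ {n m} (y : Fin n) (v : Vec (Fin n) m) → y ∉ᵥ v → Distinct v → Distinct (y ∷ v)
distinct-∷ y []      y∉v d = tt
distinct-∷ y (z ∷ v) y∉v d with y ≟ z | distinct-step y z v | distinct-∷ y v (y∉v ∘ suc) (distinct-tail z v d)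
... | yes y≡z | _            | _ = contradiction y≡z (y∉v zero)
... | no _    | b , eq , eq′ | p = subst T (sym eq) (T-∧ {not b} (T-∧ˡ _ (subst T eq′ p)) d)

distinct⇒injective : ∀ {n m} (v : Vec (Fin n) m) → Distinct v → ∀ {s t} → lookup v s ≡ lookup v t → s ≡ t
distinct⇒injective (y ∷ v) d {zero}  {zero}  eq = refl
distinct⇒injective (y ∷ v) d {zero}  {suc t} eq = contradiction eq (distinct-head y v d t)
distinct⇒injective (y ∷ v) d {suc s} {zero}  eq = contradiction (sym eq) (distinct-head y v d s)
distinct⇒injective (y ∷ v) d {suc s} {suc t} eq = cong suc (distinct⇒injective v (distinct-tail y v d) eq)

injective⇒distinct : ∀ {n m} (v : Vec (Fin n) m) → (∀ {s t} → lookup v s ≡ lookup v t → s ≡ t) → Distinct v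
injective⇒distinct []      inj = tt
injective⇒distinct (y ∷ v) inj = distinct-∷ y v (λ t eq → 0≢suc (inj {zero} {suc t} eq))
  (injective⇒distinct v (λ eq → suc-injective (inj eq)))
  where
  0≢suc : ∀ {m} {t : Fin m} → zero ≢ suc t
  0≢suc ()

module _ {n : ℕ} where

  app-injective : ∀ (π : Perm n) {i j} → app π i ≡ app π j → i ≡ j
  app-injective (perm v d) = distinct⇒injective v d

  perm-≡ : ∀ {v w : Vec (Fin n) n} {d e} → v ≡ w → perm v d ≡ perm w e
  perm-≡ {v} {d = d} {e} refl = cong (perm v) (T-irrelevant d e)

  perm-ext : ∀ {π ρ : Perm n} → (∀ i → app π i ≡ app ρ i) → π ≡ ρ
  perm-ext {perm v d} {perm w e} eq = perm-≡
    (trans (sym (Vecₚ.tabulate∘lookup v)) (trans (Vecₚ.tabulate-cong eq) (Vecₚ.tabulate∘lookup w)))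

  mkPerm : (g : Fin n → Fin n) → (∀ {i j} → g i ≡ g j → i ≡ j) → Perm n
  mkPerm g inj = perm (tabulate g) (injective⇒distinct (tabulate g) λ {s} {t} eq →
    inj (trans (sym (Vecₚ.lookup∘tabulate g s)) (trans eq (Vecₚ.lookup∘tabulate g t))))

  app-mkPerm : ∀ g (inj : ∀ {i j} → g i ≡ g j → i ≡ j) i → app (mkPerm g inj) i ≡ g i
  app-mkPerm g inj i = Vecₚ.lookup∘tabulate g i

  infixl 8 _∙_

  abstract
    _∙_ : Perm n → Perm n → Perm n
    π ∙ σ = mkPerm (λ i → app π (app σ i)) (app-injective σ ∘ app-injective π)

    app-∙ : ∀ π σ i → app (π ∙ σ) i ≡ app π (app σ i)
    app-∙ π σ i = app-mkPerm _ (app-injective σ ∘ app-injective π) i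

    idₚ : Perm n
    idₚ = mkPerm id id

    app-id : ∀ i → app idₚ i ≡ i
    app-id i = app-mkPerm id id i

-- Pigeonhole: a missed value j could be punched out, leaving an injection of `Fin (suc n)` into
-- `Fin n`.
injective⇒preimage : ∀ {n} (g : Fin n → Fin n) → (∀ {i j} → g i ≡ g j → i ≡ j) → ∀ j → ∃ λ i → g i ≡ j
injective⇒preimage {suc n} g inj j with any? (λ i → g i ≟ j)
... | yes p = p
... | no ¬p = contradiction (injective⇒≤ {f = λ i → punchOut (j≢g i)} (λ {s} {t} eq → inj (punchOut-injective (j≢g s) (j≢g t) eq))) ℕₚ.1+n≰n
  where
  j≢g : ∀ i → j ≢ g i
  j≢g i eq = ¬p (i , sym eq)

module _ {n : ℕ} where

  abstract
    _⁻¹ : Perm n → Perm n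
    π ⁻¹ = mkPerm inv (λ {i} {j} eq → trans (sym (proj₂ (pre i))) (trans (cong (app π) eq) (proj₂ (pre j))))
      where
      pre : ∀ j → ∃ λ i → app π i ≡ j
      pre = injective⇒preimage (app π) (app-injective π)
      inv : Fin n → Fin n
      inv j = proj₁ (pre j)

    app-⁻¹ʳ : ∀ π j → app π (app (π ⁻¹) j) ≡ j
    app-⁻¹ʳ π j = trans (cong (app π) (Vecₚ.lookup∘tabulate _ j)) (proj₂ (injective⇒preimage (app π) (app-injective π) j))

  app-⁻¹ˡ : ∀ π i → app (π ⁻¹) (app π i) ≡ i
  app-⁻¹ˡ π i = app-injective π (app-⁻¹ʳ π (app π i))

  ∙-assoc : ∀ (π ρ σ : Perm n) → π ∙ ρ ∙ σ ≡ π ∙ (ρ ∙ σ)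
  ∙-assoc π ρ σ = perm-ext λ i → begin
    app (π ∙ ρ ∙ σ) i             ≡⟨ app-∙ (π ∙ ρ) σ i ⟩
    app (π ∙ ρ) (app σ i)         ≡⟨ app-∙ π ρ (app σ i) ⟩
    app π (app ρ (app σ i))       ≡⟨ cong (app π) (app-∙ ρ σ i) ⟨
    app π (app (ρ ∙ σ) i)         ≡⟨ app-∙ π (ρ ∙ σ) i ⟨
    app (π ∙ (ρ ∙ σ)) i           ∎
    where open ≡-Reasoning

  ∙-⁻¹-cancel : ∀ (π σ : Perm n) → π ∙ σ ∙ σ ⁻¹ ≡ π
  ∙-⁻¹-cancel π σ = perm-ext λ i → trans (app-∙ (π ∙ σ) (σ ⁻¹) i) (trans (app-∙ π σ _) (cong (app π) (app-⁻¹ʳ σ i)))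

  ⁻¹-∙-cancel : ∀ (π σ : Perm n) → π ∙ σ ⁻¹ ∙ σ ≡ π
  ⁻¹-∙-cancel π σ = perm-ext λ i → trans (app-∙ (π ∙ σ ⁻¹) σ i) (trans (app-∙ π (σ ⁻¹) _) (cong (app π) (app-⁻¹ˡ σ i)))

  ⁻¹-involutive : ∀ (π : Perm n) → π ⁻¹ ⁻¹ ≡ π
  ⁻¹-involutive π = perm-ext λ i → app-injective (π ⁻¹) (trans (app-⁻¹ʳ (π ⁻¹) i) (sym (app-⁻¹ˡ π i)))

  abstract
    τ : Fin n → Fin n → Perm n
    τ i k = mkPerm (transpose i k) (λ {s} {t} eq → trans (sym (transpose-inverse k i)) (trans (cong (transpose k i) eq) (transpose-inverse k i)))

    τ-app : ∀ i k t → app (τ i k) t ≡ transpose i k t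
    τ-app i k t = Vecₚ.lookup∘tabulate (transpose i k) t

  τ-first : ∀ i k → app (τ i k) i ≡ k
  τ-first i k rewrite τ-app i k i with i ≟ i
  ... | yes _  = refl
  ... | no i≢i = contradiction refl i≢i

  τ-second : ∀ i k → app (τ i k) k ≡ i
  τ-second i k rewrite τ-app i k k with k ≟ i
  ... | yes k≡i = k≡i
  ... | no _ with k ≟ k
  ...   | yes _  = refl
  ...   | no k≢k = contradiction refl k≢k

  τ-other : ∀ i k t → t ≢ i → t ≢ k → app (τ i k) t ≡ t
  τ-other i k t t≢i t≢k rewrite τ-app i k t with t ≟ i
  ... | yes t≡i = contradiction t≡i t≢i
  ... | no _ with t ≟ k
  ...   | yes t≡k = contradiction t≡k t≢k
  ...   | no _    = refl

  τ-self : ∀ i t → app (τ i i) t ≡ t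
  τ-self i t with t ≟ i
  ... | yes refl = τ-first i i
  ... | no t≢i   = τ-other i i t t≢i t≢i

  _≟ₚ_ : DecidableEquality (Perm n)
  π ≟ₚ ρ = map′ perm-≡ (cong Perm.img) (Vecₚ.≡-dec _≟_ (Perm.img π) (Perm.img ρ))

-- Expectation over the symmetric group

_≟ᵥ_ : ∀ {n k} → DecidableEquality (Vec (Fin n) k)
_≟ᵥ_ = Vecₚ.≡-dec _≟_

sum-allVecs-suc : ∀ {n k} (F : Vec (Fin n) (suc k) → ℚ) →
  sum F (allVecs n (suc k)) ≡ ∑ (λ i → sum (λ v → F (i ∷ v)) (allVecs n k))
sum-allVecs-suc {n} {k} F = trans (sum-concatMap F (λ i → List.map (i ∷_) (allVecs n k)) (allFin n))
  (∑-cong (λ i → sum-map F (i ∷_) (allVecs n k)))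

sum-allVecs-zero : ∀ {n} (F : Vec (Fin n) 0 → ℚ) → sum F (allVecs n 0) ≡ F []
sum-allVecs-zero F = trans (sum-∷ F [] []) (trans (cong (_+_ (F [])) (sum-[] F)) (ℚₚ.+-identityʳ (F [])))

allVecs-once : ∀ n k (v : Vec (Fin n) k) → sum (λ w → ⟦ v ≟ᵥ w ⟧) (allVecs n k) ≡ 1ℚ
allVecs-once n zero    []      = sum-allVecs-zero (λ w → ⟦ [] ≟ᵥ w ⟧)
allVecs-once n (suc k) (i ∷ v) = begin
  sum (λ w → ⟦ (i ∷ v) ≟ᵥ w ⟧) (allVecs n (suc k))
    ≡⟨ sum-allVecs-suc (λ w → ⟦ (i ∷ v) ≟ᵥ w ⟧) ⟩
  ∑ (λ j → sum (λ w → ⟦ (i ∷ v) ≟ᵥ (j ∷ w) ⟧) (allVecs n k))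
    ≡⟨ ∑-cong (λ j → trans (sum-cong (allVecs n k) (λ w →
         ⟦⟧-× ((i ∷ v) ≟ᵥ (j ∷ w)) (i ≟ j) (v ≟ᵥ w) Vecₚ.∷-injective (cong₂ _∷_)))
         (trans (sum-*ˡ ⟦ i ≟ j ⟧ (λ w → ⟦ v ≟ᵥ w ⟧) (allVecs n k)) (cong (⟦ i ≟ j ⟧ *_) (allVecs-once n k v)))) ⟩
  ∑ (λ j → ⟦ i ≟ j ⟧ * 1ℚ)
    ≡⟨ ∑-single (λ _ → 1ℚ) i ⟩
  1ℚ ∎
  where open ≡-Reasoning

module Vec-Enum {n k} = Enumeration (_≟ᵥ_ {n} {k}) (allVecs n k) (allVecs-once n k)

allPerms-once : ∀ {n} (π : Perm n) → sum (λ ρ → ⟦ π ≟ₚ ρ ⟧) (allPerms n) ≡ 1ℚ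
allPerms-once {n} π = trans (sum-mapMaybe (λ ρ → ⟦ π ≟ₚ ρ ⟧) toPerm (allVecs n n))
  (trans (sum-cong (allVecs n n) at) (allVecs-once n n (Perm.img π)))
  where
  at : ∀ v → maybe′ (λ ρ → ⟦ π ≟ₚ ρ ⟧) 0ℚ (toPerm v) ≡ ⟦ Perm.img π ≟ᵥ v ⟧
  at v with T? (distinct v)
  ... | yes d = ⟦⟧-⇔ (π ≟ₚ perm v d) (Perm.img π ≟ᵥ v) (cong Perm.img) perm-≡
  ... | no ¬d = sym (⟦⟧-no (Perm.img π ≟ᵥ v) (λ eq → ¬d (subst Distinct eq (Perm.distinct-img π))))

module Perm-Enum {n} = Enumeration (_≟ₚ_ {n}) (allPerms n) allPerms-once

⟦_distinct⟧ : ∀ {n k} → Vec (Fin n) k → ℚ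
⟦ v distinct⟧ = ⟦ T? (distinct v) ⟧

falling : ∀ n k → ℚ
falling n k = sum (λ v → ⟦ v distinct⟧) (allVecs n k)

∑-lookup : ∀ {n k} (i : Fin n) (v : Vec (Fin n) k) → Distinct (i ∷ v) → ∑ (λ t → ⟦ i ≟ lookup v t ⟧) ≡ 0ℚ
∑-lookup {k = k} i v d = trans (∑-cong (λ t → ⟦⟧-no (i ≟ lookup v t) (distinct-head i v d t))) (sum-0 (allFin k))

-- When v is distinct at most one of its entries equals i, so the sum of deltas is the 0-1 indicator
-- of i occurring in v. The result is linear in these deltas, and summing over i in `falling-suc`
-- gives n - k.
distinct-∷-indicator : ∀ {n k} (v : Vec (Fin n) k) (i : Fin n) →
  ⟦ (i ∷ v) distinct⟧ ≡ ⟦ v distinct⟧ * (1ℚ - ∑ (λ t → ⟦ i ≟ lookup v t ⟧))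
distinct-∷-indicator {k = k} v i with T? (distinct v) | T? (distinct (i ∷ v))
... | no ¬d | yes d′ = contradiction (distinct-tail i v d′) ¬d
... | no ¬d | no _   = sym (ℚₚ.*-zeroˡ (1ℚ - ∑ (λ t → ⟦ i ≟ lookup v t ⟧)))
... | yes d | yes d′ rewrite ∑-lookup i v d′ = refl
... | yes d | no ¬d′ with any? (λ t → i ≟ lookup v t)
...   | no ¬p = contradiction (distinct-∷ i v (λ t eq → ¬p (t , eq)) d) ¬d′
...   | yes (t , eq) = sym (trans (ℚₚ.*-identityˡ _) (trans (cong (_-_ 1ℚ)
          (trans (∑-cong (λ s → ⟦⟧-⇔ (i ≟ lookup v s) (t ≟ s)
              (λ eq′ → distinct⇒injective v d (trans (sym eq) eq′)) (λ { refl → eq })))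
            (∑-once t))) (ℚₚ.+-inverseʳ 1ℚ)))

falling-suc : ∀ n k → falling n (suc k) ≡ (# n - # k) * falling n k
falling-suc n k = begin
  sum (λ v → ⟦ v distinct⟧) (allVecs n (suc k))
    ≡⟨ sum-allVecs-suc (λ v → ⟦ v distinct⟧) ⟩
  ∑ (λ i → sum (λ v → ⟦ (i ∷ v) distinct⟧) (allVecs n k))
    ≡⟨ sum-swap (λ i v → ⟦ (i ∷ v) distinct⟧) (allFin n) (allVecs n k) ⟩
  sum (λ v → ∑ (λ i → ⟦ (i ∷ v) distinct⟧)) (allVecs n k)
    ≡⟨ sum-cong (allVecs n k) inner ⟩
  sum (λ v → (# n - # k) * ⟦ v distinct⟧) (allVecs n k)
    ≡⟨ sum-*ˡ (# n - # k) (λ v → ⟦ v distinct⟧) (allVecs n k) ⟩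
  (# n - # k) * falling n k ∎
  where
  open ≡-Reasoning
  meet : Vec (Fin n) k → Fin n → ℚ
  meet v i = ∑ (λ t → ⟦ i ≟ lookup v t ⟧)
  ∑-meet : ∀ v → ∑ (meet v) ≡ # k
  ∑-meet v = trans (sum-swap (λ i t → ⟦ i ≟ lookup v t ⟧) (allFin n) (allFin k))
    (trans (∑-cong (λ t → trans (∑-cong (λ i →
        ⟦⟧-⇔ (i ≟ lookup v t) (lookup v t ≟ i) sym sym)) (∑-once (lookup v t))))
      (trans (∑-const k 1ℚ) (ℚₚ.*-identityʳ (# k))))
  inner : ∀ v → ∑ (λ i → ⟦ (i ∷ v) distinct⟧) ≡ (# n - # k) * ⟦ v distinct⟧
  inner v = trans (∑-cong (distinct-∷-indicator v))
    (trans (sum-*ˡ ⟦ v distinct⟧ (λ i → 1ℚ - meet v i) (allFin n))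
      (trans (cong (⟦ v distinct⟧ *_) (trans (sum-- (λ _ → 1ℚ) (meet v) (allFin n))
          (cong₂ _-_ (trans (∑-const n 1ℚ) (ℚₚ.*-identityʳ (# n))) (∑-meet v))))
        (ℚₚ.*-comm ⟦ v distinct⟧ (# n - # k))))

falling-0 : ∀ n → falling n 0 ≡ 1ℚ
falling-0 n = sum-allVecs-zero {n} (λ v → ⟦ v distinct⟧)

falling-complement : ∀ n k j → n ≡ j ℕ.+ k → falling n k * # (j !) ≡ # (n !)
falling-complement n zero j eq = begin
  falling n 0 * # (j !) ≡⟨ cong₂ _*_ (falling-0 n) (cong (λ m → # (m !)) (sym (trans eq (ℕₚ.+-identityʳ j)))) ⟩
  1ℚ * # (n !)          ≡⟨ ℚₚ.*-identityˡ (# (n !)) ⟩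
  # (n !)               ∎
  where open ≡-Reasoning
falling-complement n (suc k) j eq = begin
  falling n (suc k) * # (j !)            ≡⟨ cong (_* # (j !)) (falling-suc n k) ⟩
  (# n - # k) * falling n k * # (j !)    ≡⟨ cong (λ m → m * falling n k * # (j !)) n-k ⟩
  # (suc j) * falling n k * # (j !)      ≡⟨ lem (# (suc j)) (falling n k) (# (j !)) ⟩
  falling n k * (# (suc j) * # (j !))    ≡⟨ cong (falling n k *_) (#-* (suc j) (j !)) ⟨
  falling n k * # (suc j !)              ≡⟨ falling-complement n k (suc j) (trans eq (ℕₚ.+-suc j k)) ⟩
  # (n !)                                ∎
  where
  open ≡-Reasoning
  lem = solve 3 (λ a b c → a :* b :* c := b :* (a :* c)) refl
  cancel = solve 2 (λ a b → (a :+ b) :- b := a) refl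
  n-k : # n - # k ≡ # (suc j)
  n-k = trans (cong (λ m → # m - # k) (trans eq (ℕₚ.+-suc j k)))
    (trans (cong (_- # k) (#-+ (suc j) k)) (cancel (# (suc j)) (# k)))

-- `𝔼` divides by n! a sum over vectors filtered for distinctness; this count makes it a probability
-- average.
count-allPerms : ∀ n → sum (λ _ → 1ℚ) (allPerms n) ≡ # (n !)
count-allPerms n = trans (sum-mapMaybe (λ _ → 1ℚ) toPerm (allVecs n n))
  (trans (sum-cong (allVecs n n) at) (trans (sym (ℚₚ.*-identityʳ (falling n n))) (falling-complement n n 0 refl)))
  where
  at : ∀ v → maybe′ (λ _ → 1ℚ) 0ℚ (toPerm v) ≡ ⟦ v distinct⟧
  at v with T? (distinct v)
  ... | yes d = refl
  ... | no ¬d = refl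

#-inverse : ∀ m .{{_ : ℕ.NonZero m}} → # m * (+ 1 / m) ≡ 1ℚ
#-inverse (suc m) = ℚₚ.toℚᵘ-injective (begin
  ℚ.toℚᵘ (# (suc m) * (+ 1 / suc m))              ≈⟨ ℚₚ.toℚᵘ-homo-* (# (suc m)) (+ 1 / suc m) ⟩
  ℚ.toℚᵘ (# (suc m)) ℚᵘ.* ℚ.toℚᵘ (+ 1 / suc m)    ≈⟨ ℚᵘₚ.*-cong (toℚᵘ-# (suc m)) (ℚₚ.toℚᵘ-fromℚᵘ (ℚᵘ.mkℚᵘ (+ 1) m)) ⟩
  ℚᵘ.mkℚᵘ (+ suc m) 0 ℚᵘ.* ℚᵘ.mkℚᵘ (+ 1) m        ≈⟨ ℚᵘ.*≡* (cong +_ eq) ⟩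
  ℚᵘ.mkℚᵘ (+ 1) 0                                 ∎)
  where
  open ℚᵘₚ.≃-Reasoning
  eq : suc m ℕ.* 1 ℕ.* 1 ≡ 1 ℕ.* (suc (m ℕ.+ 0))
  eq = trans (ℕₚ.*-identityʳ (suc m ℕ.* 1)) (trans (ℕₚ.*-identityʳ (suc m))
    (trans (sym (ℕₚ.+-identityʳ (suc m))) (sym (ℕₚ.*-identityˡ (suc (m ℕ.+ 0))))))

abstract
  E : ∀ {n} → (Perm n → ℚ) → ℚ
  E {n} F = 𝔼 n F

  E≡𝔼 : ∀ {n} (F : Perm n → ℚ) → E F ≡ 𝔼 n F
  E≡𝔼 F = refl

  1/! : ℕ → ℚ
  1/! n = _/_ (+ 1) (n !) {{n ℕₚ.!≢0}}

  !-inverse : ∀ n → # (n !) * 1/! n ≡ 1ℚ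
  !-inverse n = #-inverse (n !) {{n ℕₚ.!≢0}}

  0≤1/! : ∀ n → 0ℚ ≤ 1/! n
  0≤1/! n = ℚₚ.nonNegative⁻¹ (1/! n) {{ℚₚ.normalize-nonNeg 1 (n !) {{n ℕₚ.!≢0}}}}

  E-def : ∀ {n} (F : Perm n → ℚ) → E F ≡ sum F (allPerms n) * 1/! n
  E-def {n} F = cong (_* 1/! n) (sym (sum≡sumℚ F (allPerms n)))

module _ {n : ℕ} where

  private
    P : List (Perm n)
    P = allPerms n

  E-cong : ∀ {F G : Perm n → ℚ} → (∀ π → F π ≡ G π) → E F ≡ E G
  E-cong {F} {G} eq = trans (E-def F) (trans (cong (_* 1/! n) (sum-cong P eq)) (sym (E-def G)))

  E-+ : ∀ (F G : Perm n → ℚ) → E (λ π → F π + G π) ≡ E F + E G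
  E-+ F G = trans (E-def _) (trans (cong (_* 1/! n) (sum-+ F G P)) (trans (ℚₚ.*-distribʳ-+ (1/! n) (sum F P) (sum G P))
    (sym (cong₂ _+_ (E-def F) (E-def G)))))

  E-*ˡ : ∀ k (F : Perm n → ℚ) → E (λ π → k * F π) ≡ k * E F
  E-*ˡ k F = trans (E-def _) (trans (cong (_* 1/! n) (sum-*ˡ k F P)) (trans (ℚₚ.*-assoc k (sum F P) (1/! n))
    (cong (k *_) (sym (E-def F)))))

  E-- : ∀ (F G : Perm n → ℚ) → E (λ π → F π - G π) ≡ E F - E G
  E-- F G = trans (E-def _) (trans (cong (_* 1/! n) (sum-- F G P)) (trans (lem (sum F P) (sum G P) (1/! n))
    (sym (cong₂ _-_ (E-def F) (E-def G)))))
    where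
    lem = solve 3 (λ a b c → (a :- b) :* c := a :* c :- b :* c) refl

  E-nonneg : ∀ {F : Perm n → ℚ} → (∀ π → 0ℚ ≤ F π) → 0ℚ ≤ E F
  E-nonneg {F} p = subst (0ℚ ≤_) (sym (E-def F)) (sum-nonneg P p ⊛ 0≤1/! n)

  E-mono : ∀ {F G : Perm n → ℚ} → (∀ π → F π ≤ G π) → E F ≤ E G
  E-mono {F} {G} p = from0 (subst (0ℚ ≤_) (E-- G F) (E-nonneg (λ π → to0 (p π))))

  E-const : ∀ k → E {n} (λ _ → k) ≡ k
  E-const k = trans (E-cong (λ _ → sym (ℚₚ.*-identityʳ k))) (trans (E-*ˡ k (λ _ → 1ℚ))
    (trans (cong (k *_) (trans (E-def (λ _ → 1ℚ)) (trans (cong (_* 1/! n) (count-allPerms n)) (!-inverse n)))) (ℚₚ.*-identityʳ k)))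

  E-sum : ∀ (F : X → Perm n → ℚ) L → E (λ π → sum (λ a → F a π) L) ≡ sum (λ a → E (F a)) L
  E-sum F L = trans (E-def _) (trans (cong (_* 1/! n) (sum-swap (λ π a → F a π) P L))
    (trans (sym (sum-*ʳ (1/! n) (λ a → sum (F a) P) L)) (sum-cong L (λ a → sym (E-def (F a))))))

  E-reindex : ∀ (F : Perm n → ℚ) (φ ψ : Perm n → Perm n) → (∀ π → ψ (φ π) ≡ π) → (∀ π → φ (ψ π) ≡ π) →
              E (λ π → F (φ π)) ≡ E F
  E-reindex F φ ψ p q = trans (E-def _) (trans (cong (_* 1/! n) (Perm-Enum.sum-reindex F φ ψ p q)) (sym (E-def F)))

  E-translate : ∀ (F : Perm n → ℚ) σ → E (λ π → F (π ∙ σ)) ≡ E F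
  E-translate F σ = E-reindex F (_∙ σ) (_∙ σ ⁻¹) (λ π → ∙-⁻¹-cancel π σ) (λ π → ⁻¹-∙-cancel π σ)

  E-inverse : ∀ (F : Perm n → ℚ) → E (λ π → F (π ⁻¹)) ≡ E F
  E-inverse F = E-reindex F _⁻¹ _⁻¹ ⁻¹-involutive ⁻¹-involutive

  -- A single permutation has mass 1/n!. The loss is affordable for bounded n, and harmless when the
  -- mean is 0.
  pointwise≤E : ∀ (F : Perm n → ℚ) → (∀ π → 0ℚ ≤ F π) → ∀ π → F π ≤ # (n !) * E F
  pointwise≤E F 0≤F π = subst (F π ≤_) (sym eq) (Perm-Enum.single≤sum F 0≤F π)
    where
    lem = solve 3 (λ a b c → a :* (b :* c) := (a :* c) :* b) refl
    eq : # (n !) * E F ≡ sum F P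
    eq = trans (cong (# (n !) *_) (E-def F)) (trans (lem (# (n !)) (sum F P) (1/! n))
      (trans (cong (_* sum F P) (!-inverse n)) (ℚₚ.*-identityˡ (sum F P))))

  ∑-permute : ∀ (π : Perm n) (F : Fin n → ℚ) → ∑ (λ i → F (app π i)) ≡ ∑ F
  ∑-permute π F = ∑-Enum.sum-reindex F (app π) (app (π ⁻¹)) (app-⁻¹ˡ π) (app-⁻¹ʳ π)

  -- Joint law of the images of distinct points

  mapₚ : ∀ {k} → Perm n → Vec (Fin n) k → Vec (Fin n) k
  mapₚ π v = Vec.map (app π) v

  lookup-ext : ∀ {k} {v w : Vec (Fin n) k} → (∀ t → lookup v t ≡ lookup w t) → v ≡ w
  lookup-ext {v = v} {w} eq = trans (sym (Vecₚ.tabulate∘lookup v)) (trans (Vecₚ.tabulate-cong eq) (Vecₚ.tabulate∘lookup w))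

  map-preserves-distinct : ∀ {k} π (v : Vec (Fin n) k) → Distinct v → Distinct (mapₚ π v)
  map-preserves-distinct π v d = injective⇒distinct (mapₚ π v) λ {s} {t} eq → distinct⇒injective v d
    (app-injective π (trans (sym (Vecₚ.lookup-map s (app π) v)) (trans eq (Vecₚ.lookup-map t (app π) v))))

  map-reflects-distinct : ∀ {k} π (v : Vec (Fin n) k) → Distinct (mapₚ π v) → Distinct v
  map-reflects-distinct π v d = injective⇒distinct v λ {s} {t} eq → distinct⇒injective (mapₚ π v) d
    (trans (Vecₚ.lookup-map s (app π) v) (trans (cong (app π) eq) (sym (Vecₚ.lookup-map t (app π) v))))

  -- Built point by point: once the later points are placed, composing with one transposition
  -- corrects the first, and by distinctness it moves none of the images already placed.
  transitive : ∀ {k} (r s : Vec (Fin n) k) → Distinct r → Distinct s → ∃ λ σ → ∀ t → app σ (lookup r t) ≡ lookup s t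
  transitive []      []      _  _  = idₚ , λ ()
  transitive (i ∷ r) (j ∷ s) dr ds with transitive r s (distinct-tail i r dr) (distinct-tail j s ds)
  ... | σ , eq = τ (app σ i) j ∙ σ , λ
    { zero    → trans (app-∙ _ σ i) (τ-first (app σ i) j)
    ; (suc t) → trans (app-∙ _ σ (lookup r t)) (trans (τ-other (app σ i) j (app σ (lookup r t))
        (λ e → distinct-head i r dr t (sym (app-injective σ e)))
        (λ e → distinct-head j s ds t (trans (sym e) (eq t)))) (eq t)) }

  E-transitive : ∀ {k} (G : Vec (Fin n) k → ℚ) r s → Distinct r → Distinct s → E (λ π → G (mapₚ π r)) ≡ E (λ π → G (mapₚ π s))
  E-transitive G r s dr ds with transitive r s dr ds
  ... | σ , eq = trans (sym (E-translate (λ π → G (mapₚ π r)) σ)) (E-cong (λ π → cong G (lookup-ext (at π))))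
    where
    at : ∀ π t → lookup (mapₚ (π ∙ σ) r) t ≡ lookup (mapₚ π s) t
    at π t = trans (Vecₚ.lookup-map t (app (π ∙ σ)) r) (trans (app-∙ π σ (lookup r t))
      (trans (cong (app π) (eq t)) (sym (Vecₚ.lookup-map t (app π) s))))

  sum-mapₚ : ∀ {k} π (F : Vec (Fin n) k → ℚ) → sum (λ v → F (mapₚ π v)) (allVecs n k) ≡ sum F (allVecs n k)
  sum-mapₚ π F = Vec-Enum.sum-reindex F (mapₚ π) (mapₚ (π ⁻¹)) (inv π (π ⁻¹) (app-⁻¹ˡ π)) (inv (π ⁻¹) π (app-⁻¹ʳ π))
    where
    inv : ∀ ρ σ → (∀ i → app σ (app ρ i) ≡ i) → ∀ v → mapₚ σ (mapₚ ρ v) ≡ v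
    inv ρ σ eq v = trans (sym (Vecₚ.map-∘ (app σ) (app ρ) v)) (trans (Vecₚ.map-cong eq v) (Vecₚ.map-id v))

  -- By transitivity the mean is the same for every distinct tuple s in place of r. Summing it over
  -- all s and exchanging sum and mean leaves, for each π, a sum over all distinct tuples, which π
  -- merely permutes. No coset has to be counted.
  E-marginal : ∀ {k} (G : Vec (Fin n) k → ℚ) r → Distinct r →
               falling n k * E (λ π → G (mapₚ π r)) ≡ sum (λ v → ⟦ v distinct⟧ * G v) (allVecs n k)
  E-marginal {k} G r dr = begin
    falling n k * E (λ π → G (mapₚ π r))
      ≡⟨ sum-*ʳ (E (λ π → G (mapₚ π r))) (λ s → ⟦ s distinct⟧) V ⟨
    sum (λ s → ⟦ s distinct⟧ * E (λ π → G (mapₚ π r))) V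
      ≡⟨ sum-cong V move ⟩
    sum (λ s → E (λ π → ⟦ mapₚ π s distinct⟧ * G (mapₚ π s))) V
      ≡⟨ E-sum (λ s π → ⟦ mapₚ π s distinct⟧ * G (mapₚ π s)) V ⟨
    E (λ π → sum (λ s → ⟦ mapₚ π s distinct⟧ * G (mapₚ π s)) V)
      ≡⟨ E-cong (λ π → sum-mapₚ π (λ v → ⟦ v distinct⟧ * G v)) ⟩
    E {n} (λ _ → sum (λ v → ⟦ v distinct⟧ * G v) V)
      ≡⟨ E-const (sum (λ v → ⟦ v distinct⟧ * G v) V) ⟩
    sum (λ v → ⟦ v distinct⟧ * G v) V ∎
    where
    open ≡-Reasoning
    V : List (Vec (Fin n) k)
    V = allVecs n k
    E-zero : ∀ (F H : Perm n → ℚ) → (∀ π → F π ≡ 0ℚ) → 0ℚ ≡ E (λ π → F π * H π)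
    E-zero F H p = sym (trans (E-cong (λ π → trans (cong (_* H π) (p π)) (ℚₚ.*-zeroˡ (H π)))) (E-const 0ℚ))
    move : ∀ s → ⟦ s distinct⟧ * E (λ π → G (mapₚ π r)) ≡ E (λ π → ⟦ mapₚ π s distinct⟧ * G (mapₚ π s))
    move s with T? (distinct s)
    ... | yes ds = trans (ℚₚ.*-identityˡ _) (trans (E-transitive G r s dr ds) (E-cong (λ π →
            sym (trans (cong (_* G (mapₚ π s)) (⟦⟧-yes (T? (distinct (mapₚ π s))) (map-preserves-distinct π s ds))) (ℚₚ.*-identityˡ _)))))
    ... | no ¬ds = trans (ℚₚ.*-zeroˡ (E (λ π → G (mapₚ π r)))) (E-zero (λ π → ⟦ mapₚ π s distinct⟧) (λ π → G (mapₚ π s))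
            (λ π → ⟦⟧-no (T? (distinct (mapₚ π s))) (¬ds ∘ map-reflects-distinct π s)))

#[_]² : ℕ → ℚ
#[ n ]² = # n * # n

falling-nonneg : ∀ n k → 0ℚ ≤ falling n k
falling-nonneg n k = sum-nonneg (allVecs n k) (λ v → 0≤⟦⟧ (T? (distinct v)))

falling-suc≤ : ∀ n k → falling n (suc k) ≤ # n * falling n k
falling-suc≤ n k = subst (_≤ # n * falling n k) (sym (falling-suc n k))
  (by-difference (0≤# k ⊛ falling-nonneg n k) (lem (# n) (# k) (falling n k)))
  where
  lem = solve 3 (λ a b c → a :* c :- (a :- b) :* c := b :* c) refl

falling2 : ∀ n → falling n 2 ≡ # n * (# n - 1ℚ)
falling2 n = trans (falling-suc n 1) (trans (cong ((# n - 1ℚ) *_) (trans (falling-suc n 0) (cong ((# n - 0ℚ) *_) (falling-0 n)))) (lem (# n)))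
  where
  lem = solve 1 (λ a → (a :- :# 1) :* ((a :- :# 0) :* :# 1) := a :* (a :- :# 1)) refl

falling4≤ : ∀ n → falling n 4 ≤ #[ n ]² * #[ n ]²
falling4≤ n = begin
  falling n 4                              ≤⟨ falling-suc≤ n 3 ⟩
  # n * falling n 3                        ≤⟨ *-monoˡ (0≤# n) (falling-suc≤ n 2) ⟩
  # n * (# n * falling n 2)                ≤⟨ *-monoˡ (0≤# n) (*-monoˡ (0≤# n) (falling-suc≤ n 1)) ⟩
  # n * (# n * (# n * falling n 1))        ≤⟨ *-monoˡ (0≤# n) (*-monoˡ (0≤# n) (*-monoˡ (0≤# n) (falling-suc≤ n 0))) ⟩
  # n * (# n * (# n * (# n * falling n 0))) ≡⟨ trans (cong (λ z → # n * (# n * (# n * (# n * z)))) (falling-0 n)) (lem (# n)) ⟩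
  #[ n ]² * #[ n ]² ∎
  where
  open ℚₚ.≤-Reasoning
  lem = solve 1 (λ a → a :* (a :* (a :* (a :* :# 1))) := (a :²) :²) refl

ne : ∀ {n} → Fin n → Fin n → ℚ
ne a b = 1ℚ - ⟦ a ≟ b ⟧

ne-yes : ∀ {n} {a b : Fin n} → a ≢ b → ne a b ≡ 1ℚ
ne-yes {a = a} {b} a≢b = cong (_-_ 1ℚ) (⟦⟧-no (a ≟ b) a≢b)

ne-refl : ∀ {n} (a : Fin n) → ne a a ≡ 0ℚ
ne-refl a = cong (_-_ 1ℚ) (⟦⟧-yes (a ≟ a) refl)

0≤ne : ∀ {n} (a b : Fin n) → 0ℚ ≤ ne a b
0≤ne a b = to0 (⟦⟧≤1 (a ≟ b))

-- Indicator that the pairs a, b and c, d are disjoint. The cases a = b and c = d are left in, since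
-- the rectangle functions multiplied by it vanish there.
χ : ∀ {n} → Fin n → Fin n → Fin n → Fin n → ℚ
χ a b c d = ne a c * ne a d * (ne b c * ne b d)

0≤χ : ∀ {n} (a b c d : Fin n) → 0ℚ ≤ χ a b c d
0≤χ a b c d = 0≤ne a c ⊛ 0≤ne a d ⊛ (0≤ne b c ⊛ 0≤ne b d)

χ-yes : ∀ {n} {a b c d : Fin n} → a ≢ c → a ≢ d → b ≢ c → b ≢ d → χ a b c d ≡ 1ℚ
χ-yes p q r s = cong₂ _*_ (cong₂ _*_ (ne-yes p) (ne-yes q)) (cong₂ _*_ (ne-yes r) (ne-yes s))

distinct₂ : ∀ {n} {a b : Fin n} → a ≢ b → Distinct (a ∷ b ∷ [])
distinct₂ {a = a} {b} p = distinct-∷ a (b ∷ []) (λ { zero → p }) tt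

distinct₄ : ∀ {n} {a b c d : Fin n} → a ≢ b → a ≢ c → a ≢ d → b ≢ c → b ≢ d → c ≢ d → Distinct (a ∷ b ∷ c ∷ d ∷ [])
distinct₄ {a = a} {b} {c} {d} p q r s t u = distinct-∷ a (b ∷ c ∷ d ∷ []) (λ { zero → p ; (suc zero) → q ; (suc (suc zero)) → r })
  (distinct-∷ b (c ∷ d ∷ []) (λ { zero → s ; (suc zero) → t }) (distinct₂ u))

∑∑-mono : ∀ {m n} {F G : Fin m → Fin n → ℚ} → (∀ a b → F a b ≤ G a b) → ∑ (λ a → ∑ (λ b → F a b)) ≤ ∑ (λ a → ∑ (λ b → G a b))
∑∑-mono {m} {n} p = ∑-mono (λ a → ∑-mono (p a))

∑∑-cong : ∀ {m n} {F G : Fin m → Fin n → ℚ} → (∀ a b → F a b ≡ G a b) → ∑ (λ a → ∑ (λ b → F a b)) ≡ ∑ (λ a → ∑ (λ b → G a b))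
∑∑-cong {m} {n} p = ∑-cong (λ a → ∑-cong (p a))

∑∑-*ˡ : ∀ {m n} k (F : Fin m → Fin n → ℚ) → ∑ (λ a → ∑ (λ b → k * F a b)) ≡ k * ∑ (λ a → ∑ (λ b → F a b))
∑∑-*ˡ {m} {n} k F = trans (∑-cong (λ a → sum-*ˡ k (F a) (allFin n))) (sum-*ˡ k _ (allFin m))

∑∑-nonneg : ∀ {m n} {F : Fin m → Fin n → ℚ} → (∀ a b → 0ℚ ≤ F a b) → 0ℚ ≤ ∑ (λ a → ∑ (λ b → F a b))
∑∑-nonneg {m} {n} p = ∑-nonneg (λ a → ∑-nonneg (p a))

∑∑-zero : ∀ {m n} {F : Fin m → Fin n → ℚ} → (∀ a b → F a b ≡ 0ℚ) → ∑ (λ a → ∑ (λ b → F a b)) ≡ 0ℚ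
∑∑-zero {m} {n} p = trans (∑∑-cong p) (trans (∑-cong (λ _ → sum-0 (allFin n))) (sum-0 (allFin m)))

module _ {n : ℕ} where

  E-∑∑ : ∀ (F : Fin n → Fin n → Perm n → ℚ) → E (λ π → ∑ (λ a → ∑ (λ b → F a b π))) ≡ ∑ (λ a → ∑ (λ b → E (F a b)))
  E-∑∑ F = trans (E-sum (λ a π → ∑ (λ b → F a b π)) (allFin n)) (∑-cong (λ a → E-sum (F a) (allFin n)))

  E-pair : ∀ (G : Fin n → Fin n → ℚ) → (∀ a → G a a ≡ 0ℚ) → ∀ {i k} → i ≢ k →
           # n * (# n - 1ℚ) * E (λ π → G (app π i) (app π k)) ≡ ∑ (λ a → ∑ (λ b → G a b))
  E-pair G G-diag {i} {k} i≢k = begin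
    # n * (# n - 1ℚ) * E (λ π → G (app π i) (app π k))
      ≡⟨ cong (_* E (λ π → G (app π i) (app π k))) (falling2 n) ⟨
    falling n 2 * E (λ π → G (app π i) (app π k))
      ≡⟨ E-marginal (λ v → G (lookup v zero) (lookup v (suc zero))) (i ∷ k ∷ []) (distinct₂ i≢k) ⟩
    sum (λ v → ⟦ v distinct⟧ * G (lookup v zero) (lookup v (suc zero))) (allVecs n 2)
      ≡⟨ sum-allVecs-suc _ ⟩
    ∑ (λ a → sum (λ v → ⟦ (a ∷ v) distinct⟧ * G a (lookup v zero)) (allVecs n 1))
      ≡⟨ ∑-cong (λ a → trans (sum-allVecs-suc _) (∑-cong (λ b → trans (sum-allVecs-zero _) (at a b)))) ⟩
    ∑ (λ a → ∑ (λ b → G a b)) ∎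
    where
    open ≡-Reasoning
    at : ∀ a b → ⟦ (a ∷ b ∷ []) distinct⟧ * G a b ≡ G a b
    at a b = go (a ≟ b)
      where
      go : Dec (a ≡ b) → ⟦ (a ∷ b ∷ []) distinct⟧ * G a b ≡ G a b
      go (yes refl) = trans (cong (⟦ (a ∷ a ∷ []) distinct⟧ *_) (G-diag a)) (trans (ℚₚ.*-zeroʳ ⟦ (a ∷ a ∷ []) distinct⟧) (sym (G-diag a)))
      go (no a≢b)   = trans (cong (_* G a b) (⟦⟧-yes (T? (distinct (a ∷ b ∷ []))) (distinct₂ a≢b))) (ℚₚ.*-identityˡ (G a b))

  quadruple-indicator : ∀ (B C : Fin n → Fin n → ℚ) → (∀ a → B a a ≡ 0ℚ) → (∀ c → C c c ≡ 0ℚ) → ∀ a b c d →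
    ⟦ (a ∷ b ∷ c ∷ d ∷ []) distinct⟧ * (B a b * C c d) ≡ χ a b c d * (B a b * C c d)
  quadruple-indicator B C B-diag C-diag a b c d = go (a ≟ b) (c ≟ d) (a ≟ c) (a ≟ d) (b ≟ c) (b ≟ d)
    where
    δ g : ℚ
    δ = ⟦ (a ∷ b ∷ c ∷ d ∷ []) distinct⟧
    g = B a b * C c d
    Goal : Set
    Goal = δ * g ≡ χ a b c d * g
    degenerate : g ≡ 0ℚ → Goal
    degenerate eq = trans (trans (cong (δ *_) eq) (ℚₚ.*-zeroʳ δ)) (sym (trans (cong (χ a b c d *_) eq) (ℚₚ.*-zeroʳ (χ a b c d))))
    meeting : (Distinct (a ∷ b ∷ c ∷ d ∷ []) → ⊥) → χ a b c d ≡ 0ℚ → Goal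
    meeting ¬d eq = cong (_* g) (trans (⟦⟧-no (T? (distinct (a ∷ b ∷ c ∷ d ∷ []))) ¬d) (sym eq))
    repeated : ∀ s t → s ≢ t → lookup (a ∷ b ∷ c ∷ d ∷ []) s ≡ lookup (a ∷ b ∷ c ∷ d ∷ []) t → Distinct (a ∷ b ∷ c ∷ d ∷ []) → ⊥
    repeated s t s≢t eq d₄ = s≢t (distinct⇒injective (a ∷ b ∷ c ∷ d ∷ []) d₄ eq)
    zero₁ = solve 3 (λ p q r → :# 0 :* p :* (q :* r) := :# 0) refl
    zero₂ = solve 3 (λ p q r → p :* :# 0 :* (q :* r) := :# 0) refl
    zero₃ = solve 3 (λ p q r → p :* q :* (:# 0 :* r) := :# 0) refl
    zero₄ = solve 3 (λ p q r → p :* q :* (r :* :# 0) := :# 0) refl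
    go : Dec (a ≡ b) → Dec (c ≡ d) → Dec (a ≡ c) → Dec (a ≡ d) → Dec (b ≡ c) → Dec (b ≡ d) → Goal
    go (yes refl) _ _ _ _ _ = degenerate (trans (cong (_* C c d) (B-diag a)) (ℚₚ.*-zeroˡ (C c d)))
    go _ (yes refl) _ _ _ _ = degenerate (trans (cong (B a b *_) (C-diag c)) (ℚₚ.*-zeroʳ (B a b)))
    go _ _ (yes a≡c) _ _ _ = meeting (repeated zero (suc (suc zero)) (λ ()) a≡c)
      (trans (cong (λ z → z * ne a d * (ne b c * ne b d)) (trans (cong (λ z → ne z c) a≡c) (ne-refl c))) (zero₁ (ne a d) (ne b c) (ne b d)))
    go _ _ _ (yes a≡d) _ _ = meeting (repeated zero (suc (suc (suc zero))) (λ ()) a≡d)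
      (trans (cong (λ z → ne a c * z * (ne b c * ne b d)) (trans (cong (λ z → ne z d) a≡d) (ne-refl d))) (zero₂ (ne a c) (ne b c) (ne b d)))
    go _ _ _ _ (yes b≡c) _ = meeting (repeated (suc zero) (suc (suc zero)) (λ ()) b≡c)
      (trans (cong (λ z → ne a c * ne a d * (z * ne b d)) (trans (cong (λ z → ne z c) b≡c) (ne-refl c))) (zero₃ (ne a c) (ne a d) (ne b d)))
    go _ _ _ _ _ (yes b≡d) = meeting (repeated (suc zero) (suc (suc (suc zero))) (λ ()) b≡d)
      (trans (cong (λ z → ne a c * ne a d * (ne b c * z)) (trans (cong (λ z → ne z d) b≡d) (ne-refl d))) (zero₄ (ne a c) (ne a d) (ne b c)))
    go (no p) (no u) (no q) (no r) (no s) (no t) = cong (_* g) (trans (⟦⟧-yes (T? (distinct (a ∷ b ∷ c ∷ d ∷ []))) (distinct₄ p q r s t u))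
      (sym (χ-yes q r s t)))

  ∑⁴ : (Fin n → Fin n → Fin n → Fin n → ℚ) → ℚ
  ∑⁴ F = ∑ (λ a → ∑ (λ b → ∑ (λ c → ∑ (λ d → F a b c d))))

  E-quadruple : ∀ (B C : Fin n → Fin n → ℚ) → (∀ a → B a a ≡ 0ℚ) → (∀ c → C c c ≡ 0ℚ) → ∀ {i m k l} → Distinct (i ∷ m ∷ k ∷ l ∷ []) →
    falling n 4 * E (λ π → B (app π i) (app π m) * C (app π k) (app π l)) ≡ ∑⁴ (λ a b c d → χ a b c d * (B a b * C c d))
  E-quadruple B C B-diag C-diag {i} {m} {k} {l} d₄ = trans
    (E-marginal (λ v → B (lookup v zero) (lookup v (suc zero)) * C (lookup v (suc (suc zero))) (lookup v (suc (suc (suc zero)))))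
      (i ∷ m ∷ k ∷ l ∷ []) d₄)
    (trans (sum-allVecs-suc _) (∑-cong (λ a →
      trans (sum-allVecs-suc _) (∑-cong (λ b →
        trans (sum-allVecs-suc _) (∑-cong (λ c →
          trans (sum-allVecs-suc _) (∑-cong (λ d →
            trans (sum-allVecs-zero _) (quadruple-indicator B C B-diag C-diag a b c d))))))))))

  ∑⁴-mono : ∀ {F G : Fin n → Fin n → Fin n → Fin n → ℚ} → (∀ a b c d → F a b c d ≤ G a b c d) → ∑⁴ F ≤ ∑⁴ G
  ∑⁴-mono p = ∑∑-mono (λ a b → ∑∑-mono (p a b))

  ∑⁴-cong : ∀ {F G : Fin n → Fin n → Fin n → Fin n → ℚ} → (∀ a b c d → F a b c d ≡ G a b c d) → ∑⁴ F ≡ ∑⁴ G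
  ∑⁴-cong p = ∑∑-cong (λ a b → ∑∑-cong (p a b))

  ∑⁴-zero : ∀ {F : Fin n → Fin n → Fin n → Fin n → ℚ} → (∀ a b c d → F a b c d ≡ 0ℚ) → ∑⁴ F ≡ 0ℚ
  ∑⁴-zero p = ∑∑-zero (λ a b → ∑∑-zero (p a b))

-- The four-point inequality

¼ : ℚ
¼ = + 1 / 4

-- Indicator of |t| ≥ ½, with squares in place of absolute values. Half of the gap between 0 and 1
-- separates a change of f from an error of approximation.
β : ℚ → ℚ
β t = ⟦ ¼ ≤? sq t ⟧

0≤β : ∀ t → 0ℚ ≤ β t
0≤β t = 0≤⟦⟧ (¼ ≤? sq t)

β≤1 : ∀ t → β t ≤ 1ℚ
β≤1 t = ⟦⟧≤1 (¼ ≤? sq t)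

sq-neg : ∀ t → sq (- t) ≡ sq t
sq-neg = lem
  where
  lem = solve 1 (λ t → (:- t) :² := t :²) refl

β≤4sq : ∀ t → β t ≤ # 4 * sq t
β≤4sq t with ¼ ≤? sq t
... | yes p = *-monoˡ (0≤# 4) p
... | no _  = 0≤# 4 ⊛ 0≤sq t

module FourPoint where

  -- Here a, p, q, d are the errors of ℓ at the four corners and w = ±1 is the change of f. The
  -- constant is 27 = 3 + 24, from (w - a + p)² ≤ 3(1 + a² + p²) and 3 ≤ 24(a² + p² + q² + d²).
  wide : ∀ w a p q d → sq w ≡ 1ℚ → 1ℚ ≤ # 8 * (sq a + sq p + sq q + sq d) → sq (w - a + p) ≤ # 27 * (sq a + sq p + sq q + sq d)
  wide w a p q d w²≡1 h = by-difference
    (0≤sq (w + a) ⊕ 0≤sq (w - p) ⊕ 0≤sq (a + p) ⊕ 0≤# 3 ⊛ to0 h ⊕ 0≤# 3 ⊛ (0≤sq q ⊕ 0≤sq d) ⊕ 0≤# 3 ⊛ to0 (ℚₚ.≤-reflexive w²≡1)) (lem w a p q d)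
    where
    lem = solve 5 (λ w a p q d → :# 27 :* (a :² :+ p :² :+ q :² :+ d :²) :- (w :- a :+ p) :² :=
      (w :+ a) :² :+ (w :- p) :² :+ (a :+ p) :² :+ :# 3 :* (:# 8 :* (a :² :+ p :² :+ q :² :+ d :²) :- :# 1)
      :+ :# 3 :* (q :² :+ d :²) :+ :# 3 :* (:# 1 :- w :²)) refl

  narrow : ∀ a p q d → sq (p - a) ≤ # 27 * (sq a + sq p + sq q + sq d)
  narrow a p q d = by-difference (0≤sq (a + p) ⊕ 0≤# 25 ⊛ (0≤sq a ⊕ 0≤sq p) ⊕ 0≤# 27 ⊛ (0≤sq q ⊕ 0≤sq d)) (lem a p q d)
    where
    lem = solve 4 (λ a p q d → :# 27 :* (a :² :+ p :² :+ q :² :+ d :²) :- (p :- a) :² :=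
      (a :+ p) :² :+ :# 25 :* (a :² :+ p :²) :+ :# 27 :* (q :² :+ d :²)) refl

  -- A nonzero mixed difference of f has to be made up by the four errors, since ℓ has none.
  -- Cauchy-Schwarz would give 4 in place of 8; the constant is the one that `far` gives.
  mixed : ∀ a p q d → 1ℚ ≤ sq (a + d - p - q) → 1ℚ ≤ # 8 * (sq a + sq p + sq q + sq d)
  mixed a p q d h = by-difference
    (to0 h ⊕ (0≤sq (a - d) ⊕ 0≤sq (a + p) ⊕ 0≤sq (a + q) ⊕ 0≤sq (d + p) ⊕ 0≤sq (d + q) ⊕ 0≤sq (p - q)) ⊕ 0≤# 4 ⊛ (0≤sq a ⊕ 0≤sq p ⊕ 0≤sq q ⊕ 0≤sq d))
    (lem a p q d)
    where
    lem = solve 4 (λ a p q d → :# 8 :* (a :² :+ p :² :+ q :² :+ d :²) :- :# 1 :=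
      ((a :+ d :- p :- q) :² :- :# 1) :+ ((a :- d) :² :+ (a :+ p) :² :+ (a :+ q) :² :+ (d :+ p) :² :+ (d :+ q) :² :+ (p :- q) :²) :+ :# 4 :* (a :²
      :+ p :² :+ q :² :+ d :²)) refl

  -- The case where f is unchanged along υ although ℓ changes by at least ½: the errors at these two
  -- corners differ by at least ½, hence a² + q² ≥ 1/8.
  far : ∀ a p q d → ¼ ≤ sq (q - a) → 1ℚ ≤ # 8 * (sq a + sq p + sq q + sq d)
  far a p q d h = by-difference (0≤# 4 ⊛ to0 h ⊕ 0≤# 4 ⊛ 0≤sq (a + q) ⊕ 0≤# 8 ⊛ (0≤sq p ⊕ 0≤sq d)) (lem a p q d)
    where
    lem = solve 4 (λ a p q d → :# 8 :* (a :² :+ p :² :+ q :² :+ d :²) :- :# 1 :=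
      :# 4 :* ((q :- a) :² :- con ¼) :+ :# 4 :* ((a :+ q) :²) :+ :# 8 :* (p :² :+ d :²)) refl

  -- Values of ℓ and f at π, πσ, πυ and πσυ for σ and υ with disjoint supports. Additivity forces
  -- the last value of ℓ, so `l₃` is derived.
  record Values : Set where
    field
      l l₁ l₂    : ℚ
      b b₁ b₂ b₃ : Bool
    l₃ : ℚ
    l₃ = l₁ + l₂ - l
    total : ℚ
    total = sq (toℚ b - l) + sq (toℚ b₁ - l₁) + sq (toℚ b₂ - l₂) + sq (toℚ b₃ - l₃)

  eq₁ = solve 3 (λ u l l₁ → l :- l₁ := (u :- l₁) :- (u :- l)) refl

  eq₂ = solve 4 (λ u v l l₁ → l :- l₁ := (u :- v) :- (u :- l) :+ (v :- l₁)) refl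

  eq₃ = solve 7 (λ u v x y l l₁ l₂ → u :+ y :- v :- x := (u :- l) :+ (y :- (l₁ :+ l₂ :- l)) :- (v :- l₁) :- (x :- l₂)) refl

  module _ (V : Values) where
    open Values V

    private
      opposite : ∀ w → toℚ b - toℚ b₁ ≡ w → sq w ≡ 1ℚ → 1ℚ ≤ # 8 * total → sq (l - l₁) ≤ # 27 * total
      opposite w refl w² h = subst (λ t → sq t ≤ # 27 * total) (sym (eq₂ (toℚ b) (toℚ b₁) l l₁))
        (wide w (toℚ b - l) (toℚ b₁ - l₁) (toℚ b₂ - l₂) (toℚ b₃ - l₃) w² h)

      same : b ≡ b₁ → sq (l - l₁) ≤ # 27 * total
      same refl = subst (λ t → sq t ≤ # 27 * total) (sym (eq₁ (toℚ b) l l₁))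
        (narrow (toℚ b - l) (toℚ b₁ - l₁) (toℚ b₂ - l₂) (toℚ b₃ - l₃))

      crossing : 1ℚ ≤ sq (toℚ b + toℚ b₃ - toℚ b₁ - toℚ b₂) → 1ℚ ≤ # 8 * total
      crossing h = mixed (toℚ b - l) (toℚ b₁ - l₁) (toℚ b₂ - l₂) (toℚ b₃ - l₃)
        (subst (λ t → 1ℚ ≤ sq t) (eq₃ (toℚ b) (toℚ b₁) (toℚ b₂) (toℚ b₃) l l₁ l₂) h)

      away : b ≡ b₂ → ¼ ≤ sq (l - l₂) → 1ℚ ≤ # 8 * total
      away refl h = far (toℚ b - l) (toℚ b₁ - l₁) (toℚ b₂ - l₂) (toℚ b₃ - l₃) (subst (λ t → ¼ ≤ sq t) (eq₁ (toℚ b) l l₂) h)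

    1≤4 : 1ℚ ≤ # 4
    1≤4 = #-mono {1} {4} (s≤s z≤n)

    -- A Boolean function on a square whose mixed difference vanishes depends on one coordinate only.
    bound : ¼ ≤ sq (l - l₂) → sq (l - l₁) ≤ # 27 * total
    bound h = go b b₁ b₂ b₃ refl refl refl refl
      where
      go : ∀ x x₁ x₂ x₃ → b ≡ x → b₁ ≡ x₁ → b₂ ≡ x₂ → b₃ ≡ x₃ → sq (l - l₁) ≤ # 27 * total
      go false false _ _ refl refl _ _ = same refl
      go true  true  _ _ refl refl _ _ = same refl
      go true  false false false refl refl refl refl = opposite 1ℚ refl refl (crossing ℚₚ.≤-refl)
      go true  false false true  refl refl refl refl = opposite 1ℚ refl refl (crossing 1≤4)
      go true  false true  false refl refl refl refl = opposite 1ℚ refl refl (away refl h)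
      go true  false true  true  refl refl refl refl = opposite 1ℚ refl refl (crossing ℚₚ.≤-refl)
      go false true  false false refl refl refl refl = opposite (- 1ℚ) refl refl (crossing ℚₚ.≤-refl)
      go false true  false true  refl refl refl refl = opposite (- 1ℚ) refl refl (away refl h)
      go false true  true  false refl refl refl refl = opposite (- 1ℚ) refl refl (crossing 1≤4)
      go false true  true  true  refl refl refl refl = opposite (- 1ℚ) refl refl (crossing ℚₚ.≤-refl)

    β-bound : β (l - l₂) * sq (l - l₁) ≤ # 27 * total
    β-bound with ¼ ≤? sq (l - l₂)
    ... | yes h = subst (_≤ # 27 * total) (sym (ℚₚ.*-identityˡ (sq (l - l₁)))) (bound h)
    ... | no _  = subst (_≤ # 27 * total) (sym (ℚₚ.*-zeroˡ (sq (l - l₁))))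
      (0≤# 27 ⊛ (0≤sq (toℚ b - l) ⊕ 0≤sq (toℚ b₁ - l₁) ⊕ 0≤sq (toℚ b₂ - l₂) ⊕ 0≤sq (toℚ b₃ - l₃)))

toℚ-diff² : ∀ b b′ → sq (toℚ b - toℚ b′) ≤ 1ℚ
toℚ-diff² false false = 0≤1
toℚ-diff² false true  = ℚₚ.≤-refl
toℚ-diff² true  false = ℚₚ.≤-refl
toℚ-diff² true  true  = 0≤1

-- If |l - l′| ≥ ½, split l - l′ into a change of f, at most 1, and a difference of errors. Below ½
-- there are two cases: for b = b′ it is just a difference of errors, and for b ≠ b′ the errors
-- differ by at least ½, hence by at least |l - l′|.
sq-difference-bound : ∀ b b′ l l′ → sq (l - l′) ≤ # 2 * β (l - l′) + # 4 * (sq (toℚ b - l) + sq (toℚ b′ - l′))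
sq-difference-bound b b′ l l′ with ¼ ≤? sq (l - l′)
... | yes _ = by-difference (0≤sq (u - v) ⊕ 0≤# 2 ⊛ to0 (toℚ-diff² b b′) ⊕ 0≤# 2 ⊛ 0≤sq (a + p)) (lem (toℚ b) (toℚ b′) l l′)
  where
  a = toℚ b - l
  p = toℚ b′ - l′
  u = toℚ b - toℚ b′
  v = p - a
  lem = solve 4 (λ x y l l′ → :# 2 :* :# 1 :+ :# 4 :* ((x :- l) :² :+ (y :- l′) :²) :- (l :- l′) :² :=
    (x :- y :- ((y :- l′) :- (x :- l))) :² :+ :# 2 :* (:# 1 :- (x :- y) :²) :+ :# 2 :* ((x :- l :+ (y :- l′)) :²)) refl
... | no ¬h = go b b′
  where
  small : sq (l - l′) ≤ ¼
  small = ≰⇒≥ ¬h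
  same : ∀ x → sq (l - l′) ≤ # 2 * 0ℚ + # 4 * (sq (x - l) + sq (x - l′))
  same x = by-difference (0≤sq (x - l + (x - l′)) ⊕ 0≤# 2 ⊛ (0≤sq (x - l) ⊕ 0≤sq (x - l′))) (lem x l l′)
    where
    lem = solve 3 (λ x l l′ → :# 2 :* :# 0 :+ :# 4 :* ((x :- l) :² :+ (x :- l′) :²) :- (l :- l′) :² :=
      (x :- l :+ (x :- l′)) :² :+ :# 2 :* ((x :- l) :² :+ (x :- l′) :²)) refl
  other : ∀ x y → sq (x - y) ≡ 1ℚ → sq (l - l′) ≤ # 2 * 0ℚ + # 4 * (sq (x - l) + sq (y - l′))
  other x y eq = by-difference (0≤sq ((l - l′) + ((y - l′) - (x - l))) ⊕ 0≤# 4 ⊛ to0 small ⊕ 0≤sq (l - l′) ⊕ 0≤# 2 ⊛ 0≤sq (x - l + (y - l′))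
      ⊕ to0 (ℚₚ.≤-reflexive (sym eq))) (lem x y l l′)
    where
    lem = solve 4 (λ x y l l′ → :# 2 :* :# 0 :+ :# 4 :* ((x :- l) :² :+ (y :- l′) :²) :- (l :- l′) :² :=
      ((l :- l′) :+ ((y :- l′) :- (x :- l))) :² :+ :# 4 :* (con ¼ :- (l :- l′) :²) :+ (l :- l′) :² :+ :# 2 :* (x :- l :+ (y :- l′)) :²
      :+ ((x :- y) :² :- :# 1)) refl
  go : ∀ b b′ → sq (l - l′) ≤ # 2 * 0ℚ + # 4 * (sq (toℚ b - l) + sq (toℚ b′ - l′))
  go false false = same 0ℚ
  go true  true  = same 1ℚ
  go false true  = other 0ℚ 1ℚ refl
  go true  false = other 1ℚ 0ℚ refl

-- Linear functions and the Poincaré identity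

∑∑-+ : ∀ {m n} (F G : Fin m → Fin n → ℚ) → ∑ (λ a → ∑ (λ b → F a b + G a b)) ≡ ∑ (λ a → ∑ (λ b → F a b)) + ∑ (λ a → ∑ (λ b → G a b))
∑∑-+ {m} {n} F G = trans (∑-cong (λ a → sum-+ (F a) (G a) (allFin n))) (sum-+ _ _ (allFin m))

∑∑-- : ∀ {m n} (F G : Fin m → Fin n → ℚ) → ∑ (λ a → ∑ (λ b → F a b - G a b)) ≡ ∑ (λ a → ∑ (λ b → F a b)) - ∑ (λ a → ∑ (λ b → G a b))
∑∑-- {m} {n} F G = trans (∑-cong (λ a → sum-- (F a) (G a) (allFin n))) (sum-- _ _ (allFin m))

∑∑-product : ∀ {m n} (F : Fin m → ℚ) (G : Fin n → ℚ) → ∑ (λ a → ∑ (λ b → F a * G b)) ≡ ∑ F * ∑ G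
∑∑-product {m} {n} F G = trans (∑-cong (λ a → sum-*ˡ (F a) G (allFin n))) (sum-*ʳ (∑ G) F (allFin m))

∑∑-swap : ∀ {m n} (F : Fin m → Fin n → ℚ) → ∑ (λ a → ∑ (λ b → F a b)) ≡ ∑ (λ b → ∑ (λ a → F a b))
∑∑-swap {m} {n} F = sum-swap F (allFin m) (allFin n)

masked : ∀ p q {u v} → (T p → T q → u ≡ v) → toℚ p * toℚ q * u ≡ toℚ p * toℚ q * v
masked true  true          eq = cong (1ℚ * 1ℚ *_) (eq tt tt)
masked true  false {u} {v} _  = trans (ℚₚ.*-zeroˡ u) (sym (ℚₚ.*-zeroˡ v))
masked false q     {u} {v} _  = trans (cong (_* u) (ℚₚ.*-zeroˡ (toℚ q))) (trans (ℚₚ.*-zeroˡ u)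
  (sym (trans (cong (_* v) (ℚₚ.*-zeroˡ (toℚ q))) (ℚₚ.*-zeroˡ v))))

Apart : ∀ {n} → Perm n → Perm n → Set
Apart σ υ = ∀ t → app σ t ≡ t ⊎ app υ t ≡ t

module Linear {n : ℕ} (c : Fin n → Fin n → ℚ) where

  ℓ : Perm n → ℚ
  ℓ π = ∑ (λ i → c i (app π i))

  linear≡ℓ : ∀ π → linear c π ≡ ℓ π
  linear≡ℓ π = trans (sym (sum≡sumℚ _ (allFin n))) (∑-cong λ i →
    trans (sym (sum≡sumℚ (λ j → c i j * x i j π) (allFin n)))
      (trans (∑-cong (λ j → ℚₚ.*-comm (c i j) (x i j π))) (∑-single (c i) (app π i))))

  D : (i k a b : Fin n) → ℚ
  D i k a b = c i a + c k b - c i b - c k a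

  D-row-diag : ∀ i a b → D i i a b ≡ 0ℚ
  D-row-diag i a b = lem (c i a) (c i b)
    where
    lem = solve 2 (λ p q → p :+ q :- q :- p := :# 0) refl

  D-col-diag : ∀ i k a → D i k a a ≡ 0ℚ
  D-col-diag i k a = lem (c i a) (c k a)
    where
    lem = solve 2 (λ p q → p :+ q :- p :- q := :# 0) refl

  D-row-swap : ∀ i k a b → D k i a b ≡ - D i k a b
  D-row-swap i k a b = lem (c i a) (c i b) (c k a) (c k b)
    where
    lem = solve 4 (λ p q r s → r :+ q :- s :- p := :- (p :+ s :- q :- r)) refl

  D-col-swap : ∀ i k a b → D i k b a ≡ - D i k a b
  D-col-swap i k a b = lem (c i a) (c i b) (c k a) (c k b)
    where
    lem = solve 4 (λ p q r s → q :+ r :- p :- s := :- (p :+ s :- q :- r)) refl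

  -- For four distinct rows this is, up to the factor `falling n 4`, the mean of the product of the
  -- squared changes of ℓ along τ i j and τ k l.
  G : (i j k l : Fin n) → ℚ
  G i j k l = ∑⁴ (λ a b c d → χ a b c d * (sq (D i j a b) * sq (D k l c d)))

  ℓ-τ : ∀ i k π → ℓ π - ℓ (π ∙ τ i k) ≡ D i k (app π i) (app π k)
  ℓ-τ i k π = go (i ≟ k)
    where
    lem₀ = solve 1 (λ p → p :- p := :# 0) refl
    go : Dec (i ≡ k) → ℓ π - ℓ (π ∙ τ i k) ≡ D i k (app π i) (app π k)
    go (yes refl) = trans (cong (λ ρ → ℓ π - ℓ ρ) (perm-ext {π = π ∙ τ i i} {π} (λ t → trans (app-∙ π (τ i i) t) (cong (app π) (τ-self i t)))))
      (trans (lem₀ (ℓ π)) (sym (D-col-diag i i (app π i))))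
    go (no i≢k) = begin
      ℓ π - ℓ (π ∙ τ i k)
        ≡⟨ sum-- (λ t → c t (app π t)) (λ t → c t (app (π ∙ τ i k) t)) (allFin n) ⟨
      ∑ (λ t → c t (app π t) - c t (app (π ∙ τ i k) t))
        ≡⟨ ∑-cong (λ t → term t (i ≟ t) (k ≟ t)) ⟩
      ∑ (λ t → ⟦ i ≟ t ⟧ * u + ⟦ k ≟ t ⟧ * w)
        ≡⟨ sum-+ (λ t → ⟦ i ≟ t ⟧ * u) (λ t → ⟦ k ≟ t ⟧ * w) (allFin n) ⟩
      ∑ (λ t → ⟦ i ≟ t ⟧ * u) + ∑ (λ t → ⟦ k ≟ t ⟧ * w)
        ≡⟨ cong₂ _+_ (∑-single (λ _ → u) i) (∑-single (λ _ → w) k) ⟩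
      u + w
        ≡⟨ lem (c i (app π i)) (c i (app π k)) (c k (app π i)) (c k (app π k)) ⟩
      D i k (app π i) (app π k) ∎
      where
      open ≡-Reasoning
      u w : ℚ
      u = c i (app π i) - c i (app π k)
      w = c k (app π k) - c k (app π i)
      lem = solve 4 (λ p q r s → (p :- q) :+ (s :- r) := p :+ s :- q :- r) refl
      lem₁ = solve 2 (λ u w → u := :# 1 :* u :+ :# 0 :* w) refl
      lem₂ = solve 2 (λ u w → w := :# 0 :* u :+ :# 1 :* w) refl
      lem₃ = solve 2 (λ u w → :# 0 := :# 0 :* u :+ :# 0 :* w) refl
      at : ∀ t j → app (τ i k) t ≡ j → c t (app π t) - c t (app (π ∙ τ i k) t) ≡ c t (app π t) - c t (app π j)
      at t j eq = cong (λ z → c t (app π t) - c t z) (trans (app-∙ π (τ i k) t) (cong (app π) eq))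
      term : ∀ t (d : Dec (i ≡ t)) (e : Dec (k ≡ t)) → c t (app π t) - c t (app (π ∙ τ i k) t) ≡ ⟦ d ⟧ * u + ⟦ e ⟧ * w
      term t (yes i≡t)  (yes k≡t)  = contradiction (trans i≡t (sym k≡t)) i≢k
      term t (yes refl) (no _)     = trans (at i k (τ-first i k)) (lem₁ u w)
      term t (no _)     (yes refl) = trans (at k i (τ-second i k)) (lem₂ u w)
      term t (no i≢t)   (no k≢t)   = trans (at t t (τ-other i k t (i≢t ∘ sym) (k≢t ∘ sym))) (trans (lem₀ (c t (app π t))) (lem₃ u w))

  ℓ-apart : ∀ π σ υ → Apart σ υ → ℓ (π ∙ σ ∙ υ) ≡ ℓ (π ∙ σ) + ℓ (π ∙ υ) - ℓ π
  ℓ-apart π σ υ apart = begin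
    ∑ (λ t → c t (app (π ∙ σ ∙ υ) t))
      ≡⟨ ∑-cong term ⟩
    ∑ (λ t → c t (app (π ∙ σ) t) + c t (app (π ∙ υ) t) - c t (app π t))
      ≡⟨ sum-- (λ t → c t (app (π ∙ σ) t) + c t (app (π ∙ υ) t)) (λ t → c t (app π t)) (allFin n) ⟩
    ∑ (λ t → c t (app (π ∙ σ) t) + c t (app (π ∙ υ) t)) - ℓ π
      ≡⟨ cong (_- ℓ π) (sum-+ (λ t → c t (app (π ∙ σ) t)) (λ t → c t (app (π ∙ υ) t)) (allFin n)) ⟩
    ℓ (π ∙ σ) + ℓ (π ∙ υ) - ℓ π ∎
    where
    open ≡-Reasoning
    lem₁ = solve 2 (λ p q → q := p :+ q :- p) refl
    lem₂ = solve 2 (λ p q → q := q :+ p :- p) refl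
    -- If υ moves t then it also moves υ t, which σ must therefore fix.
    fixed : ∀ t → app σ t ≡ t → app σ (app υ t) ≡ app υ t
    fixed t σt≡t with apart (app υ t)
    ... | inj₁ eq = eq
    ... | inj₂ eq = trans (cong (app σ) υt≡t) (trans σt≡t (sym υt≡t))
      where
      υt≡t : app υ t ≡ t
      υt≡t = app-injective υ eq
    app-∙∙ : ∀ t → app (π ∙ σ ∙ υ) t ≡ app π (app σ (app υ t))
    app-∙∙ t = trans (app-∙ (π ∙ σ) υ t) (app-∙ π σ (app υ t))
    value : ∀ t {a b d} → app (π ∙ σ ∙ υ) t ≡ a → app (π ∙ σ) t ≡ b → app (π ∙ υ) t ≡ d → c t a ≡ c t b + c t d - c t (app π t) →
            c t (app (π ∙ σ ∙ υ) t) ≡ c t (app (π ∙ σ) t) + c t (app (π ∙ υ) t) - c t (app π t)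
    value t refl refl refl eq = eq
    term : ∀ t → c t (app (π ∙ σ ∙ υ) t) ≡ c t (app (π ∙ σ) t) + c t (app (π ∙ υ) t) - c t (app π t)
    term t with apart t
    ... | inj₁ σt≡t = value t (trans (app-∙∙ t) (cong (app π) (fixed t σt≡t))) (trans (app-∙ π σ t) (cong (app π) σt≡t)) (app-∙ π υ t)
                        (lem₁ (c t (app π t)) (c t (app π (app υ t))))
    ... | inj₂ υt≡t = value t (trans (app-∙∙ t) (cong (app π ∘ app σ) υt≡t)) (app-∙ π σ t) (trans (app-∙ π υ t) (cong (app π) υt≡t))
                        (lem₂ (c t (app π t)) (c t (app π (app σ t))))

  module Block (R : Fin n → Bool) where

    -- Right multiplication by this subgroup rearranges the values of π on R and leaves those
    -- outside R alone. Its cosets are the sets on which ℓ is averaged.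
    Supported : Perm n → Set
    Supported σ = ∀ t → T (not (R t)) → app σ t ≡ t

    supported? : ∀ σ → Dec (Supported σ)
    supported? σ = all? (λ t → T? (not (R t)) →-dec (app σ t ≟ t))

    supported-stable : ∀ {σ} → Supported σ → ∀ t → R (app σ t) ≡ R t
    supported-stable {σ} supp t = go (R t) (R (app σ t)) refl refl
      where
      go : ∀ p q → R t ≡ p → R (app σ t) ≡ q → R (app σ t) ≡ R t
      go false q     eq eq′ = cong R (supp t (subst (T ∘ not) (sym eq) tt))
      go true  true  eq eq′ = trans eq′ (sym eq)
      go true  false eq eq′ = cong R (app-injective σ (supp (app σ t) (subst (T ∘ not) (sym eq′) tt)))

    supported-id : Supported idₚ
    supported-id t _ = app-id t

    supported-τ : ∀ {i k} → T (R i) → T (R k) → Supported (τ i k)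
    supported-τ {i} {k} Ri Rk t ¬Rt = τ-other i k t (apart Ri) (apart Rk)
      where
      apart : ∀ {j} → T (R j) → t ≢ j
      apart Rj refl = T-not Rj ¬Rt

    supported-∙ : ∀ {σ υ} → Supported σ → Supported υ → Supported (σ ∙ υ)
    supported-∙ {σ} {υ} p q t ¬Rt = trans (app-∙ σ υ t) (trans (cong (app σ) (q t ¬Rt)) (p t ¬Rt))

    supported-⁻¹ : ∀ {σ} → Supported σ → Supported (σ ⁻¹)
    supported-⁻¹ {σ} p t ¬Rt = app-injective σ (trans (app-⁻¹ʳ σ t) (sym (p t ¬Rt)))

    r : Fin n → ℚ
    r k = toℚ (R k)

    0≤r : ∀ k → 0ℚ ≤ r k
    0≤r k with R k
    ... | true  = 0≤1
    ... | false = ℚₚ.≤-refl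

    r≤1 : ∀ k → r k ≤ 1ℚ
    r≤1 k with R k
    ... | true  = ℚₚ.≤-refl
    ... | false = 0≤1

    N : ℚ
    N = ∑ r

    0≤N : 0ℚ ≤ N
    0≤N = ∑-nonneg 0≤r

    N≤n : N ≤ # n
    N≤n = subst (N ≤_) (trans (∑-const n 1ℚ) (ℚₚ.*-identityʳ (# n))) (∑-mono r≤1)

    private
      S T′ : Perm n → ℚ
      S π = ∑ (λ k → r k * c k (app π k))
      T′ π = ∑ (λ k → ∑ (λ l → r k * r l * c k (app π l)))

    -- N times the deviation of ℓ from its average over permutations of the rows in R.
    ξ : Perm n → ℚ
    ξ π = N * S π - T′ π

    Dπ : Perm n → Fin n → Fin n → ℚ
    Dπ π k l = D k l (app π k) (app π l)

    -- Dirichlet form at π of the transposition walk on the rows in R: by `ℓ-τ`, `Dπ π k l` is the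
    -- change of ℓ along τ k l.
    Q : Perm n → ℚ
    Q π = ∑ (λ k → ∑ (λ l → r k * r l * sq (Dπ π k l)))

    0≤Q : ∀ π → 0ℚ ≤ Q π
    0≤Q π = ∑∑-nonneg (λ k l → 0≤r k ⊛ 0≤r l ⊛ 0≤sq (Dπ π k l))

    -- The reason why the Poincaré inequality becomes an equality: a linear function, centred on the
    -- cosets of a block, is an eigenfunction of the random transposition operator of that block.
    ∑∑-D : ∀ π → ∑ (λ k → ∑ (λ l → r k * r l * Dπ π k l)) ≡ # 2 * ξ π
    ∑∑-D π = begin
      ∑ (λ k → ∑ (λ l → r k * r l * Dπ π k l))
        ≡⟨ ∑∑-cong (λ k l → lem (r k) (r l) (c k (app π k)) (c k (app π l)) (c l (app π k)) (c l (app π l))) ⟩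
      ∑ (λ k → ∑ (λ l → (A k * r l + r k * A l) - (F k l + F l k)))
        ≡⟨ ∑∑-- (λ k l → A k * r l + r k * A l) (λ k l → F k l + F l k) ⟩
      ∑ (λ k → ∑ (λ l → A k * r l + r k * A l)) - ∑ (λ k → ∑ (λ l → F k l + F l k))
        ≡⟨ cong₂ _-_ (trans (∑∑-+ (λ k l → A k * r l) (λ k l → r k * A l)) (cong₂ _+_ (∑∑-product A r) (∑∑-product r A)))
             (trans (∑∑-+ F (λ k l → F l k)) (cong (_+_ (T′ π)) (sym (∑∑-swap F)))) ⟩
      (S π * N + N * S π) - (T′ π + T′ π)
        ≡⟨ lem₂ (S π) N (T′ π) ⟩
      # 2 * ξ π ∎
      where
      open ≡-Reasoning
      A : Fin n → ℚ
      A k = r k * c k (app π k)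
      F : Fin n → Fin n → ℚ
      F k l = r k * r l * c k (app π l)
      lem = solve 6 (λ p q u v w z → p :* q :* (u :+ z :- v :- w) := ((p :* u) :* q :+ p :* (q :* z)) :- (p :* q :* v :+ q :* p :* w)) refl
      lem₂ = solve 3 (λ s m t → (s :* m :+ m :* s) :- (t :+ t) := :# 2 :* (m :* s :- t)) refl

    -- The averaged part `T′` sees the columns π(R) as a set only, and σ preserves this set.
    ξ-difference : ∀ {σ} → Supported σ → ∀ π → ξ π - ξ (π ∙ σ) ≡ N * (ℓ π - ℓ (π ∙ σ))
    ξ-difference {σ} supp π = begin
      (N * S π - T′ π) - (N * S (π ∙ σ) - T′ (π ∙ σ))
        ≡⟨ cong (λ t → (N * S π - T′ π) - (N * S (π ∙ σ) - t)) T-eq ⟩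
      (N * S π - T′ π) - (N * S (π ∙ σ) - T′ π)
        ≡⟨ lem N (S π) (S (π ∙ σ)) (T′ π) ⟩
      N * (S π - S (π ∙ σ))
        ≡⟨ cong (N *_) S-eq ⟩
      N * (ℓ π - ℓ (π ∙ σ)) ∎
      where
      open ≡-Reasoning
      lem = solve 4 (λ m s s′ t → (m :* s :- t) :- (m :* s′ :- t) := m :* (s :- s′)) refl
      T-eq : T′ (π ∙ σ) ≡ T′ π
      T-eq = ∑-cong (λ k → trans
        (∑-cong (λ l → cong₂ (λ p j → r k * toℚ p * c k j) (sym (supported-stable {σ} supp l)) (app-∙ π σ l)))
        (∑-permute σ (λ l → r k * r l * c k (app π l))))
      lem₁ = solve 2 (λ u v → :# 1 :* u :- :# 1 :* v := u :- v) refl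
      lem₀ = solve 1 (λ u → :# 0 :* u :- :# 0 :* u := u :- u) refl
      term : ∀ k → r k * c k (app π k) - r k * c k (app (π ∙ σ) k) ≡ c k (app π k) - c k (app (π ∙ σ) k)
      term k with R k | supp k
      ... | true  | _ = lem₁ (c k (app π k)) (c k (app (π ∙ σ) k))
      ... | false | p = subst (λ j → 0ℚ * c k (app π k) - 0ℚ * c k j ≡ c k (app π k) - c k j)
                          (sym (trans (app-∙ π σ k) (cong (app π) (p tt)))) (lem₀ (c k (app π k)))
      S-eq : S π - S (π ∙ σ) ≡ ℓ π - ℓ (π ∙ σ)
      S-eq = trans (sym (sum-- (λ k → r k * c k (app π k)) (λ k → r k * c k (app (π ∙ σ) k)) (allFin n)))
        (trans (∑-cong term) (sum-- (λ k → c k (app π k)) (λ k → c k (app (π ∙ σ) k)) (allFin n)))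

    module _ (0<N : 0ℚ < N) (B : Perm n → ℚ) (B-invariant : ∀ {σ} → Supported σ → ∀ π → B (π ∙ σ) ≡ B π) where

      -- Reversibility of the step π ↦ π ∙ σ. Since (u - v)² = 2u(u - v) - (u² - v²), it remains
      -- that ξ² and its translate by σ have the same mean against the invariant weight B.
      dirichlet : ∀ {σ} → Supported σ → N * E (λ π → B π * sq (ℓ π - ℓ (π ∙ σ))) ≡ # 2 * E (λ π → B π * ξ π * (ℓ π - ℓ (π ∙ σ)))
      dirichlet {σ} supp = *-cancelˡ-≡ N 0<N (begin
        N * (N * E (λ π → B π * sq (d π)))
          ≡⟨ trans (cong (N *_) (sym (E-*ˡ N _))) (sym (E-*ˡ N _)) ⟩
        E (λ π → N * (N * (B π * sq (d π))))
          ≡⟨ E-cong (λ π → trans (lem₁ N (B π) (d π)) (trans (cong (λ t → B π * sq t) (sym (ξ-difference supp π)))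
               (lem₂ (B π) (ξ π) (ξ (π ∙ σ))))) ⟩
        E (λ π → # 2 * (B π * ξ π * (ξ π - ξ (π ∙ σ))) - (B π * sq (ξ π) - B π * sq (ξ (π ∙ σ))))
          ≡⟨ E-- (λ π → # 2 * (B π * ξ π * (ξ π - ξ (π ∙ σ)))) (λ π → B π * sq (ξ π) - B π * sq (ξ (π ∙ σ))) ⟩
        E (λ π → # 2 * (B π * ξ π * (ξ π - ξ (π ∙ σ)))) - E (λ π → B π * sq (ξ π) - B π * sq (ξ (π ∙ σ)))
          ≡⟨ cong₂ _-_ (E-cong (λ π → trans (cong (λ t → # 2 * (B π * ξ π * t)) (ξ-difference supp π)) (lem₃ (B π * ξ π) N (d π)))) vanish ⟩
        E (λ π → N * (# 2 * (B π * ξ π * d π))) - 0ℚ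
          ≡⟨ trans (ℚₚ.+-identityʳ _) (trans (E-*ˡ N (λ π → # 2 * (B π * ξ π * d π))) (cong (N *_) (E-*ˡ (# 2) (λ π → B π * ξ π * d π)))) ⟩
        N * (# 2 * E (λ π → B π * ξ π * d π)) ∎)
        where
        open ≡-Reasoning
        d : Perm n → ℚ
        d π = ℓ π - ℓ (π ∙ σ)
        lem₁ = solve 3 (λ m b d → m :* (m :* (b :* (d :²))) := b :* ((m :* d) :²)) refl
        lem₂ = solve 3 (λ b u v → b :* ((u :- v) :²) := :# 2 :* (b :* u :* (u :- v)) :- (b :* (u :²) :- b :* (v :²))) refl
        lem₃ = solve 3 (λ b m d → :# 2 :* (b :* (m :* d)) := m :* (:# 2 :* (b :* d))) refl
        vanish : E (λ π → B π * sq (ξ π) - B π * sq (ξ (π ∙ σ))) ≡ 0ℚ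
        vanish = trans (E-- (λ π → B π * sq (ξ π)) (λ π → B π * sq (ξ (π ∙ σ))))
          (trans (cong (_-_ (E (λ π → B π * sq (ξ π)))) (trans (E-cong (λ π → cong (_* sq (ξ (π ∙ σ))) (sym (B-invariant supp π))))
            (E-translate (λ π → B π * sq (ξ π)) σ))) (ℚₚ.+-inverseʳ (E (λ π → B π * sq (ξ π)))))

      -- The right sides of `dirichlet` for the transpositions of R are linear in D, and their sum
      -- becomes ξ again by `∑∑-D`. The weight B, constant on cosets, will be an indicator or an
      -- energy determined by the complementary rows.
      poincaré-identity : N * E (λ π → B π * Q π) ≡ # 4 * E (λ π → B π * sq (ξ π))
      poincaré-identity = begin
        N * E (λ π → B π * Q π)
          ≡⟨ cong (N *_) (trans (E-cong (λ π → trans (sym (∑∑-*ˡ (B π) (λ k l → r k * r l * sq (Dπ π k l))))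
               (∑∑-cong (λ k l → lem₁ (B π) (r k) (r l) (sq (Dπ π k l)))))) (E-∑∑ (λ k l π → r k * r l * (B π * sq (Dπ π k l))))) ⟩
        N * ∑ (λ k → ∑ (λ l → E (λ π → r k * r l * (B π * sq (Dπ π k l)))))
          ≡⟨ trans (sym (∑∑-*ˡ N (λ k l → E (λ π → r k * r l * (B π * sq (Dπ π k l)))))) (∑∑-cong term) ⟩
        ∑ (λ k → ∑ (λ l → E (λ π → # 2 * (B π * ξ π) * (r k * r l * Dπ π k l))))
          ≡⟨ E-∑∑ (λ k l π → # 2 * (B π * ξ π) * (r k * r l * Dπ π k l)) ⟨
        E (λ π → ∑ (λ k → ∑ (λ l → # 2 * (B π * ξ π) * (r k * r l * Dπ π k l))))
          ≡⟨ E-cong (λ π → trans (∑∑-*ˡ (# 2 * (B π * ξ π)) (λ k l → r k * r l * Dπ π k l))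
               (trans (cong (# 2 * (B π * ξ π) *_) (∑∑-D π)) (lem₂ (B π) (ξ π)))) ⟩
        E (λ π → # 4 * (B π * sq (ξ π)))
          ≡⟨ E-*ˡ (# 4) (λ π → B π * sq (ξ π)) ⟩
        # 4 * E (λ π → B π * sq (ξ π)) ∎
        where
        open ≡-Reasoning
        lem₁ = solve 4 (λ b p q s → b :* (p :* q :* s) := p :* q :* (b :* s)) refl
        lem₂ = solve 2 (λ b u → :# 2 :* (b :* u) :* (:# 2 :* u) := :# 4 :* (b :* (u :²))) refl
        lem₃ = solve 5 (λ b u p q d → p :* q :* (:# 2 :* (b :* u :* d)) := :# 2 :* (b :* u) :* (p :* q :* d)) refl
        lem₄ = solve 4 (λ m p q e → m :* (p :* q :* e) := p :* q :* (m :* e)) refl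
        core : ∀ {k l} → T (R k) → T (R l) → N * E (λ π → B π * sq (Dπ π k l)) ≡ # 2 * E (λ π → B π * ξ π * Dπ π k l)
        core {k} {l} Rk Rl = trans (cong (N *_) (E-cong (λ π → cong (λ t → B π * sq t) (sym (ℓ-τ k l π)))))
          (trans (dirichlet (supported-τ Rk Rl)) (cong (# 2 *_) (E-cong (λ π → cong (B π * ξ π *_) (ℓ-τ k l π)))))
        mult : ∀ k l → r k * r l * (N * E (λ π → B π * sq (Dπ π k l))) ≡ r k * r l * (# 2 * E (λ π → B π * ξ π * Dπ π k l))
        mult k l = masked (R k) (R l) core
        term : ∀ k l → N * E (λ π → r k * r l * (B π * sq (Dπ π k l))) ≡ E (λ π → # 2 * (B π * ξ π) * (r k * r l * Dπ π k l))
        term k l = trans (cong (N *_) (E-*ˡ (r k * r l) (λ π → B π * sq (Dπ π k l))))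
          (trans (lem₄ N (r k) (r l) (E (λ π → B π * sq (Dπ π k l)))) (trans (mult k l)
            (trans (cong (r k * r l *_) (sym (E-*ˡ (# 2) (λ π → B π * ξ π * Dπ π k l))))
              (trans (sym (E-*ˡ (r k * r l) (λ π → # 2 * (B π * ξ π * Dπ π k l))))
                (E-cong (λ π → lem₃ (B π) (ξ π) (r k) (r l) (Dπ π k l)))))))

-- Averaging over all permutations of a block

module Smoothing {n : ℕ} (c : Fin n → Fin n → ℚ) (R : Fin n → Bool) where

  open Linear c
  open Block R

  private
    P : List (Perm n)
    P = allPerms n

  s : Perm n → ℚ
  s σ = ⟦ supported? σ ⟧

  0≤s : ∀ σ → 0ℚ ≤ s σ
  0≤s σ = 0≤⟦⟧ (supported? σ)

  Z : ℚ
  Z = sum s P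

  0<Z : 0ℚ < Z
  0<Z = ℚₚ.<-≤-trans (0<#suc 0) (subst (_≤ Z) (⟦⟧-yes (supported? idₚ) supported-id) (Perm-Enum.single≤sum s 0≤s idₚ))

  masked-s : ∀ σ {u v} → (Supported σ → u ≡ v) → s σ * u ≡ s σ * v
  masked-s σ {u} {v} eq = go (supported? σ)
    where
    go : (d : Dec (Supported σ)) → ⟦ d ⟧ * u ≡ ⟦ d ⟧ * v
    go (yes p) = cong (1ℚ *_) (eq p)
    go (no _)  = trans (ℚₚ.*-zeroˡ u) (sym (ℚₚ.*-zeroˡ v))

  s-∙τ : ∀ {k l} → T (R k) → T (R l) → ∀ σ → s (σ ∙ τ k l) ≡ s σ
  s-∙τ {k} {l} Rk Rl σ = ⟦⟧-⇔ (supported? (σ ∙ τ k l)) (supported? σ)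
    (λ p → subst Supported (∙-⁻¹-cancel σ (τ k l)) (supported-∙ p (supported-⁻¹ (supported-τ Rk Rl))))
    (λ p → supported-∙ p (supported-τ Rk Rl))

  sum-D : ∀ π {k l} → T (R k) → T (R l) → sum (λ σ → s σ * Dπ (π ∙ σ) k l) P ≡ 0ℚ
  sum-D π {k} {l} Rk Rl = begin
    sum (λ σ → s σ * Dπ (π ∙ σ) k l) P
      ≡⟨ sum-cong P (λ σ → trans (cong (s σ *_) (sym (ℓ-τ k l (π ∙ σ)))) (lem (s σ) (ℓ (π ∙ σ)) (ℓ (π ∙ σ ∙ τ k l)))) ⟩
    sum (λ σ → s σ * ℓ (π ∙ σ) - s σ * ℓ (π ∙ σ ∙ τ k l)) P
      ≡⟨ sum-- (λ σ → s σ * ℓ (π ∙ σ)) (λ σ → s σ * ℓ (π ∙ σ ∙ τ k l)) P ⟩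
    sum (λ σ → s σ * ℓ (π ∙ σ)) P - sum (λ σ → s σ * ℓ (π ∙ σ ∙ τ k l)) P
      ≡⟨ cong (_-_ (sum (λ σ → s σ * ℓ (π ∙ σ)) P)) shift ⟩
    sum (λ σ → s σ * ℓ (π ∙ σ)) P - sum (λ σ → s σ * ℓ (π ∙ σ)) P
      ≡⟨ ℚₚ.+-inverseʳ (sum (λ σ → s σ * ℓ (π ∙ σ)) P) ⟩
    0ℚ ∎
    where
    open ≡-Reasoning
    lem = solve 3 (λ p q r → p :* (q :- r) := p :* q :- p :* r) refl
    shift : sum (λ σ → s σ * ℓ (π ∙ σ ∙ τ k l)) P ≡ sum (λ σ → s σ * ℓ (π ∙ σ)) P
    shift = trans (sum-cong P (λ σ → cong₂ (λ p ρ → p * ℓ ρ) (sym (s-∙τ Rk Rl σ)) (∙-assoc π σ (τ k l))))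
      (Perm-Enum.sum-reindex (λ σ → s σ * ℓ (π ∙ σ)) (_∙ τ k l) (_∙ (τ k l) ⁻¹) (λ σ → ∙-⁻¹-cancel σ (τ k l)) (λ σ → ⁻¹-∙-cancel σ (τ k l)))

  -- Twice ξ is a sum of changes of ℓ along transpositions of R, and each of them averages to 0 over
  -- a coset because σ ↦ σ ∙ τ k l permutes the supported σ.
  sum-ξ : ∀ π → sum (λ σ → s σ * ξ (π ∙ σ)) P ≡ 0ℚ
  sum-ξ π = *-cancelˡ-≡ (# 2) (0<#suc 1) (begin
    # 2 * sum (λ σ → s σ * ξ (π ∙ σ)) P
      ≡⟨ sum-*ˡ (# 2) (λ σ → s σ * ξ (π ∙ σ)) P ⟨
    sum (λ σ → # 2 * (s σ * ξ (π ∙ σ))) P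
      ≡⟨ sum-cong P (λ σ → trans (lem₁ (# 2) (s σ) (ξ (π ∙ σ))) (trans (cong (s σ *_) (sym (∑∑-D (π ∙ σ))))
           (trans (sym (∑∑-*ˡ (s σ) (λ k l → r k * r l * Dπ (π ∙ σ) k l))) (∑∑-cong (λ k l → lem₁ (s σ) (r k * r l) (Dπ (π ∙ σ) k l)))))) ⟩
    sum (λ σ → ∑ (λ k → ∑ (λ l → r k * r l * (s σ * Dπ (π ∙ σ) k l)))) P
      ≡⟨ trans (sum-swap (λ σ k → ∑ (λ l → r k * r l * (s σ * Dπ (π ∙ σ) k l))) P (allFin n))
           (∑-cong (λ k → sum-swap (λ σ l → r k * r l * (s σ * Dπ (π ∙ σ) k l)) P (allFin n))) ⟩
    ∑ (λ k → ∑ (λ l → sum (λ σ → r k * r l * (s σ * Dπ (π ∙ σ) k l)) P))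
      ≡⟨ ∑∑-cong (λ k l → trans (sum-*ˡ (r k * r l) (λ σ → s σ * Dπ (π ∙ σ) k l) P)
           (trans (masked (R k) (R l) (sum-D π)) (ℚₚ.*-zeroʳ (r k * r l)))) ⟩
    ∑ {n} (λ k → ∑ {n} (λ l → 0ℚ))
      ≡⟨ ∑∑-zero (λ _ _ → refl) ⟩
    0ℚ
      ≡⟨ ℚₚ.*-zeroʳ (# 2) ⟨
    # 2 * 0ℚ ∎)
    where
    open ≡-Reasoning
    lem₁ = solve 3 (λ p q t → p :* (q :* t) := q :* (p :* t)) refl

  -- Since the translates of ξ have mean zero, ξ(π)² is at most the mean of (ξ(π) - ξ(πσ))².
  ξ²≤ : ∀ π → Z * sq (ξ π) ≤ sum (λ σ → s σ * (N * N * sq (ℓ π - ℓ (π ∙ σ)))) P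
  ξ²≤ π = begin
    Z * sq (ξ π)
      ≡⟨ trans (lem₁ (Z * sq (ξ π)) (# 2 * ξ π)) (cong (λ t → Z * sq (ξ π) - # 2 * ξ π * t) (sym (sum-ξ π))) ⟩
    Z * sq (ξ π) - # 2 * ξ π * sum (λ σ → s σ * ξ (π ∙ σ)) P
      ≡⟨ trans (sum-- (λ σ → s σ * sq (ξ π)) (λ σ → # 2 * ξ π * (s σ * ξ (π ∙ σ))) P)
           (cong₂ _-_ (sum-*ʳ (sq (ξ π)) s P) (sum-*ˡ (# 2 * ξ π) (λ σ → s σ * ξ (π ∙ σ)) P)) ⟨
    sum (λ σ → s σ * sq (ξ π) - # 2 * ξ π * (s σ * ξ (π ∙ σ))) P
      ≤⟨ sum-mono P (λ σ → by-difference (0≤s σ ⊛ 0≤sq (ξ (π ∙ σ))) (lem₂ (s σ) (ξ π) (ξ (π ∙ σ)))) ⟩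
    sum (λ σ → s σ * sq (ξ π - ξ (π ∙ σ))) P
      ≡⟨ sum-cong P (λ σ → masked-s σ (λ p → trans (cong sq (ξ-difference p π)) (lem₃ N (ℓ π - ℓ (π ∙ σ))))) ⟩
    sum (λ σ → s σ * (N * N * sq (ℓ π - ℓ (π ∙ σ)))) P ∎
    where
    open ℚₚ.≤-Reasoning
    lem₁ = solve 2 (λ a b → a := a :- b :* :# 0) refl
    lem₂ = solve 3 (λ s u v → s :* ((u :- v) :²) :- (s :* (u :²) :- :# 2 :* u :* (s :* v)) := s :* (v :²)) refl
    lem₃ = solve 2 (λ m d → (m :* d) :² := m :² :* (d :²)) refl

  module _ (0<N : 0ℚ < N) (B : Perm n → ℚ) (0≤B : ∀ π → 0ℚ ≤ B π) (B-invariant : ∀ {σ} → Supported σ → ∀ π → B (π ∙ σ) ≡ B π)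
           (κ : ℚ) (bound : ∀ {σ} → Supported σ → E (λ π → B π * sq (ℓ π - ℓ (π ∙ σ))) ≤ κ) where

    E-ξ²≤ : E (λ π → B π * sq (ξ π)) ≤ N * N * κ
    E-ξ²≤ = *-cancelˡ Z 0<Z (begin
      Z * E (λ π → B π * sq (ξ π))
        ≡⟨ trans (sym (E-*ˡ Z (λ π → B π * sq (ξ π)))) (E-cong (λ π → lem₁ Z (B π) (sq (ξ π)))) ⟩
      E (λ π → B π * (Z * sq (ξ π)))
        ≤⟨ E-mono (λ π → *-monoˡ (0≤B π) (ξ²≤ π)) ⟩
      E (λ π → B π * sum (λ σ → s σ * (N * N * sq (ℓ π - ℓ (π ∙ σ)))) P)
        ≡⟨ E-cong (λ π → trans (sym (sum-*ˡ (B π) (λ σ → s σ * (N * N * sq (ℓ π - ℓ (π ∙ σ)))) P))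
             (sum-cong P (λ σ → lem₂ (B π) (s σ) (N * N) (sq (ℓ π - ℓ (π ∙ σ)))))) ⟩
      E (λ π → sum (λ σ → s σ * (N * N) * (B π * sq (ℓ π - ℓ (π ∙ σ)))) P)
        ≡⟨ trans (E-sum (λ σ π → s σ * (N * N) * (B π * sq (ℓ π - ℓ (π ∙ σ)))) P)
             (sum-cong P (λ σ → E-*ˡ (s σ * (N * N)) (λ π → B π * sq (ℓ π - ℓ (π ∙ σ))))) ⟩
      sum (λ σ → s σ * (N * N) * E (λ π → B π * sq (ℓ π - ℓ (π ∙ σ)))) P
        ≤⟨ sum-mono P term ⟩
      sum (λ σ → s σ * (N * N * κ)) P
        ≡⟨ sum-*ʳ (N * N * κ) s P ⟩
      Z * (N * N * κ) ∎)
      where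
      open ℚₚ.≤-Reasoning
      lem₁ = solve 3 (λ z b x → z :* (b :* x) := b :* (z :* x)) refl
      lem₂ = solve 4 (λ b s m x → b :* (s :* (m :* x)) := s :* m :* (b :* x)) refl
      term : ∀ σ → s σ * (N * N) * E (λ π → B π * sq (ℓ π - ℓ (π ∙ σ))) ≤ s σ * (N * N * κ)
      term σ = subst (_≤ s σ * (N * N * κ)) (sym (ℚₚ.*-assoc (s σ) (N * N) (E (λ π → B π * sq (ℓ π - ℓ (π ∙ σ)))))) (go (supported? σ))
        where
        go : (d : Dec (Supported σ)) → ⟦ d ⟧ * (N * N * E (λ π → B π * sq (ℓ π - ℓ (π ∙ σ)))) ≤ ⟦ d ⟧ * (N * N * κ)
        go (yes p) = *-monoˡ 0≤1 (*-monoˡ (0≤N ⊛ 0≤N) (bound p))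
        go (no _)  = ℚₚ.≤-reflexive (trans (ℚₚ.*-zeroˡ (N * N * E (λ π → B π * sq (ℓ π - ℓ (π ∙ σ))))) (sym (ℚₚ.*-zeroˡ (N * N * κ))))

    -- The gain of the method. Applying the hypothesis to each of the N² transpositions would give
    -- N²κ; bounding the variance through all σ at once and converting it by `poincaré-identity`
    -- gives 4Nκ.
    E-Q≤ : E (λ π → B π * Q π) ≤ # 4 * N * κ
    E-Q≤ = *-cancelˡ N 0<N (begin
      N * E (λ π → B π * Q π)          ≡⟨ poincaré-identity 0<N B B-invariant ⟩
      # 4 * E (λ π → B π * sq (ξ π))   ≤⟨ *-monoˡ (0≤# 4) E-ξ²≤ ⟩
      # 4 * (N * N * κ)                ≡⟨ lem N κ ⟩
      N * (# 4 * N * κ) ∎)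
      where
      open ℚₚ.≤-Reasoning
      lem = solve 2 (λ m k → :# 4 :* (m :² :* k) := m :* (:# 4 :* m :* k)) refl

-- Squares of permutations and the approximation error

module Approximation {n : ℕ} (c : Fin n → Fin n → ℚ) (f : Perm n → Bool) (ε : ℚ)
  (close : E (λ π → sq (toℚ (f π) - Linear.ℓ c π)) ≤ ε) where

  open Linear c public

  e : Perm n → ℚ
  e π = sq (toℚ (f π) - ℓ π)

  0≤e : ∀ π → 0ℚ ≤ e π
  0≤e π = 0≤sq (toℚ (f π) - ℓ π)

  E-e : ∀ σ → E (λ π → e (π ∙ σ)) ≤ ε
  E-e σ = subst (_≤ ε) (sym (E-translate e σ)) close

  0≤ε : 0ℚ ≤ ε
  0≤ε = ℚₚ.≤-trans (E-nonneg 0≤e) close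

  square : ∀ σ υ → Apart σ υ → ∀ π →
    β (ℓ π - ℓ (π ∙ υ)) * sq (ℓ π - ℓ (π ∙ σ)) ≤ # 27 * (e π + e (π ∙ σ) + e (π ∙ υ) + e (π ∙ σ ∙ υ))
  square σ υ apart π = subst (λ t → β (ℓ π - ℓ (π ∙ υ)) * sq (ℓ π - ℓ (π ∙ σ)) ≤ # 27 * (e π + e (π ∙ σ) + e (π ∙ υ) + sq (toℚ (f (π ∙ σ ∙ υ)) - t)))
    (sym (ℓ-apart π σ υ apart))
    (FourPoint.β-bound (record { l = ℓ π ; l₁ = ℓ (π ∙ σ) ; l₂ = ℓ (π ∙ υ) ; b = f π ; b₁ = f (π ∙ σ) ; b₂ = f (π ∙ υ) ; b₃ = f (π ∙ σ ∙ υ) }))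

  E-square : ∀ σ υ → Apart σ υ → E (λ π → β (ℓ π - ℓ (π ∙ υ)) * sq (ℓ π - ℓ (π ∙ σ))) ≤ # 108 * ε
  E-square σ υ apart = begin
    E (λ π → β (ℓ π - ℓ (π ∙ υ)) * sq (ℓ π - ℓ (π ∙ σ)))
      ≤⟨ E-mono (square σ υ apart) ⟩
    E (λ π → # 27 * (e π + e (π ∙ σ) + e (π ∙ υ) + e (π ∙ σ ∙ υ)))
      ≡⟨ trans (E-*ˡ (# 27) _) (cong (# 27 *_) (trans (E-+ _ _) (cong (_+ E (λ π → e (π ∙ σ ∙ υ)))
           (trans (E-+ _ _) (cong (_+ E (λ π → e (π ∙ υ))) (E-+ _ _)))))) ⟩
    # 27 * (E e + E (λ π → e (π ∙ σ)) + E (λ π → e (π ∙ υ)) + E (λ π → e (π ∙ σ ∙ υ)))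
      ≤⟨ *-monoˡ (0≤# 27) (ℚₚ.+-mono-≤ (ℚₚ.+-mono-≤ (ℚₚ.+-mono-≤ close (E-e σ)) (E-e υ))
           (subst (_≤ ε) (trans (sym (E-translate (λ π → e (π ∙ υ)) σ)) refl) (E-e υ))) ⟩
    # 27 * (ε + ε + ε + ε)
      ≡⟨ lem ε ⟩
    # 108 * ε ∎
    where
    open ℚₚ.≤-Reasoning
    lem = solve 1 (λ x → :# 27 :* (x :+ x :+ x :+ x) := :# 108 :* x) refl

  Fixes : (Fin n → Bool) → Perm n → Set
  Fixes R υ = ∀ t → T (R t) → app υ t ≡ t

  module _ (R : Fin n → Bool) where

    open Block R

    fixes⇒apart : ∀ {σ υ} → Supported σ → Fixes R υ → Apart σ υ
    fixes⇒apart p q t = go (R t) refl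
      where
      go : ∀ b → R t ≡ b → _
      go true  eq = inj₂ (q t (subst T (sym eq) tt))
      go false eq = inj₁ (p t (subst (T ∘ not) (sym eq) tt))

    -- What makes β of the change along υ an admissible weight for the block R: that change depends
    -- only on the rows moved by υ, and these lie outside R.
    difference-invariant : ∀ {υ} → Fixes R υ → ∀ {σ} → Supported σ → ∀ π → ℓ (π ∙ σ) - ℓ (π ∙ σ ∙ υ) ≡ ℓ π - ℓ (π ∙ υ)
    difference-invariant {υ} q {σ} p π = trans (cong (_-_ (ℓ (π ∙ σ))) (ℓ-apart π σ υ (fixes⇒apart {σ} {υ} p q))) (lem (ℓ (π ∙ σ)) (ℓ (π ∙ υ)) (ℓ π))
      where
      lem = solve 3 (λ a b d → a :- (a :+ b :- d) := d :- b) refl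

    E-β-Q≤ : 0ℚ < N → ∀ {υ} → Fixes R υ → E (λ π → β (ℓ π - ℓ (π ∙ υ)) * Q π) ≤ # 4 * N * (# 108 * ε)
    E-β-Q≤ 0<N {υ} q = Smoothing.E-Q≤ c R 0<N (λ π → β (ℓ π - ℓ (π ∙ υ))) (λ π → 0≤β (ℓ π - ℓ (π ∙ υ)))
      (λ p π → cong β (difference-invariant q p π)) (# 108 * ε) (λ {σ} p → E-square σ υ (fixes⇒apart {σ} {υ} p q))

-- Pairs of disjoint rectangles

∑∑-∑∑-swap : ∀ {n} (F : Fin n → Fin n → Fin n → Fin n → ℚ) →
  ∑⁴ F ≡ ∑ (λ c → ∑ (λ d → ∑ (λ a → ∑ (λ b → F a b c d))))
∑∑-∑∑-swap {n} F = begin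
  ∑ (λ a → ∑ (λ b → ∑ (λ c → ∑ (λ d → F a b c d))))
    ≡⟨ ∑-cong (λ a → ∑∑-swap (λ b c → ∑ (λ d → F a b c d))) ⟩
  ∑ (λ a → ∑ (λ c → ∑ (λ b → ∑ (λ d → F a b c d))))
    ≡⟨ ∑∑-swap (λ a c → ∑ (λ b → ∑ (λ d → F a b c d))) ⟩
  ∑ (λ c → ∑ (λ a → ∑ (λ b → ∑ (λ d → F a b c d))))
    ≡⟨ ∑-cong (λ c → trans (∑-cong (λ a → ∑∑-swap (λ b d → F a b c d))) (∑∑-swap (λ a d → ∑ (λ b → F a b c d)))) ⟩
  ∑ (λ c → ∑ (λ d → ∑ (λ a → ∑ (λ b → F a b c d)))) ∎
  where open ≡-Reasoning

∑-∑⁴-swap : ∀ {n} (F : Fin n → Fin n → Fin n → Fin n → Fin n → ℚ) →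
  ∑ (λ m → ∑⁴ (F m)) ≡ ∑⁴ (λ a b c d → ∑ (λ m → F m a b c d))
∑-∑⁴-swap {n} F = trans (∑∑-swap (λ m a → ∑ (λ b → ∑ (λ c → ∑ (λ d → F m a b c d))))) (∑-cong λ a →
  trans (∑∑-swap (λ m b → ∑ (λ c → ∑ (λ d → F m a b c d)))) (∑-cong λ b →
    trans (∑∑-swap (λ m c → ∑ (λ d → F m a b c d))) (∑-cong λ c → ∑∑-swap (λ m d → F m a b c d))))

∑⁴-*ˡ : ∀ {n} k (F : Fin n → Fin n → Fin n → Fin n → ℚ) → ∑⁴ (λ a b c d → k * F a b c d) ≡ k * ∑⁴ F
∑⁴-*ˡ k F = trans (∑∑-cong (λ a b → ∑∑-*ˡ k (F a b))) (∑∑-*ˡ k (λ a b → ∑ (λ c → ∑ (λ d → F a b c d))))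

∑⁴-nonneg : ∀ {n} {F : Fin n → Fin n → Fin n → Fin n → ℚ} → (∀ a b c d → 0ℚ ≤ F a b c d) → 0ℚ ≤ ∑⁴ F
∑⁴-nonneg p = ∑∑-nonneg (λ a b → ∑∑-nonneg (p a b))

-- The block complementary to the rows of τ i m. The case i = m occurs too, in the rounding step,
-- and removes a single row.
others : ∀ {n} → Fin n → Fin n → Fin n → Bool
others i m t = not ⌊ t ≟ i ⌋ ∧ not ⌊ t ≟ m ⌋

others-indicator : ∀ {n} (i m t : Fin n) → toℚ (others i m t) ≡ ne t i * ne t m
others-indicator i m t with t ≟ i | t ≟ m
... | yes _ | yes _ = refl
... | yes _ | no _  = refl
... | no _  | yes _ = refl
... | no _  | no _  = refl

others⇒≢ˡ : ∀ {n} {i m t : Fin n} → T (others i m t) → t ≢ i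
others⇒≢ˡ {i = i} {m} {t} p with t ≟ i
others⇒≢ˡ () | yes _
... | no t≢i = t≢i

others⇒≢ʳ : ∀ {n} {i m t : Fin n} → T (others i m t) → t ≢ m
others⇒≢ʳ {i = i} {m} {t} p with t ≟ i | t ≟ m
others⇒≢ʳ () | yes _ | _
others⇒≢ʳ () | no _ | yes _
... | no _ | no t≢m = t≢m

module RowInequality {n : ℕ} (c : Fin n → Fin n → ℚ) (f : Perm n → Bool) (ε : ℚ)
  (close : E (λ π → sq (toℚ (f π) - Linear.ℓ c π)) ≤ ε) (2<n : # 2 < # n) where

  open Approximation c f ε close public

  0<n : 0ℚ < # n
  0<n = ℚₚ.<-trans (0<#suc 1) 2<n

  module _ (i m : Fin n) where

    open Block (others i m)

    n-2≤N : # n - # 2 ≤ N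
    n-2≤N = begin
      # n - # 2
        ≡⟨ eq ⟨
      ∑ (λ t → 1ℚ - (⟦ i ≟ t ⟧ + ⟦ m ≟ t ⟧))
        ≤⟨ ∑-mono (λ t → subst (1ℚ - (⟦ i ≟ t ⟧ + ⟦ m ≟ t ⟧) ≤_) (sym (others-indicator i m t)) (term t)) ⟩
      N ∎
      where
      open ℚₚ.≤-Reasoning
      eq : ∑ (λ t → 1ℚ - (⟦ i ≟ t ⟧ + ⟦ m ≟ t ⟧)) ≡ # n - # 2
      eq = trans (sum-- (λ _ → 1ℚ) (λ t → ⟦ i ≟ t ⟧ + ⟦ m ≟ t ⟧) (allFin n)) (cong₂ _-_ (trans (∑-const n 1ℚ) (ℚₚ.*-identityʳ (# n)))
        (trans (sum-+ (λ t → ⟦ i ≟ t ⟧) (λ t → ⟦ m ≟ t ⟧) (allFin n)) (cong₂ _+_ (∑-once i) (∑-once m))))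
      lem = solve 2 (λ p q → (:# 1 :- p) :* (:# 1 :- q) :- (:# 1 :- (p :+ q)) := p :* q) refl
      term : ∀ t → 1ℚ - (⟦ i ≟ t ⟧ + ⟦ m ≟ t ⟧) ≤ ne t i * ne t m
      term t = subst₂ (λ p q → 1ℚ - (p + q) ≤ ne t i * ne t m) (⟦⟧-⇔ (t ≟ i) (i ≟ t) sym sym) (⟦⟧-⇔ (t ≟ m) (m ≟ t) sym sym)
        (by-difference (0≤⟦⟧ (t ≟ i) ⊛ 0≤⟦⟧ (t ≟ m)) (lem ⟦ t ≟ i ⟧ ⟦ t ≟ m ⟧))

    0<N : 0ℚ < N
    0<N = ℚₚ.<-≤-trans (subst (_< # n - # 2) (ℚₚ.+-inverseʳ (# 2)) (ℚₚ.+-monoˡ-< (- # 2) 2<n)) n-2≤N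

    β-D : Fin n → Fin n → ℚ
    β-D a b = β (D i m a b)

    fixes-τ : Fixes (others i m) (τ i m)
    fixes-τ t p = τ-other i m t (others⇒≢ˡ {m = m} p) (others⇒≢ʳ {i = i} p)

    E-β-Q-τ≤ : E (λ π → β-D (app π i) (app π m) * Q π) ≤ # 432 * # n * ε
    E-β-Q-τ≤ = begin
      E (λ π → β-D (app π i) (app π m) * Q π)  ≡⟨ E-cong (λ π → cong (λ t → β t * Q π) (ℓ-τ i m π)) ⟨
      E (λ π → β (ℓ π - ℓ (π ∙ τ i m)) * Q π)  ≤⟨ E-β-Q≤ (others i m) 0<N {τ i m} fixes-τ ⟩
      # 4 * N * (# 108 * ε)                    ≡⟨ lem N ε ⟩
      # 432 * N * ε                            ≤⟨ by-difference (0≤# 432 ⊛ to0 N≤n ⊛ 0≤ε) (lem₂ N (# n) ε) ⟩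
      # 432 * # n * ε ∎
      where
      open ℚₚ.≤-Reasoning
      lem = solve 2 (λ m e → :# 4 :* m :* (:# 108 :* e) := :# 432 :* m :* e) refl
      lem₂ = solve 3 (λ m p e → :# 432 :* p :* e :- :# 432 :* m :* e := :# 432 :* (p :- m) :* e) refl

    four : (k l : Fin n) → ℚ
    four k l = ∑⁴ (λ a b c d → χ a b c d * (β-D a b * sq (D k l c d)))

    four≡ : i ≢ m → ∀ {k l} → T (others i m k) → T (others i m l) →
            falling n 4 * E (λ π → β-D (app π i) (app π m) * sq (Dπ π k l)) ≡ four k l
    four≡ i≢m {k} {l} Rk Rl = go (k ≟ l)
      where
      go : Dec (k ≡ l) → falling n 4 * E (λ π → β-D (app π i) (app π m) * sq (Dπ π k l)) ≡ four k l
      go (no k≢l) = E-quadruple β-D (λ c d → sq (D k l c d)) (λ a → cong β (D-col-diag i m a)) (λ c → cong sq (D-col-diag k l c))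
        (distinct₄ i≢m (others⇒≢ˡ {m = m} Rk ∘ sym) (others⇒≢ˡ {m = m} Rl ∘ sym) (others⇒≢ʳ {i = i} Rk ∘ sym) (others⇒≢ʳ {i = i} Rl ∘ sym) k≢l)
      go (yes refl) = trans
        (trans (cong (falling n 4 *_) (trans (E-cong (λ π → trans (cong (λ t → β-D (app π i) (app π m) * sq t) (D-row-diag k (app π k) (app π k)))
          (ℚₚ.*-zeroʳ (β-D (app π i) (app π m))))) (E-const 0ℚ))) (ℚₚ.*-zeroʳ (falling n 4)))
        (sym (∑⁴-zero (λ a b c d → trans (cong (λ t → χ a b c d * (β-D a b * sq t)) (D-row-diag k c d)) (lem (χ a b c d) (β-D a b)))))
        where
        lem = solve 2 (λ p q → p :* (q :* :# 0) := :# 0) refl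

    ∑∑-four≤ : i ≢ m → ∑ (λ k → ∑ (λ l → r k * r l * four k l)) ≤ #[ n ]² * #[ n ]² * (# 432 * # n * ε)
    ∑∑-four≤ i≢m = begin
      ∑ (λ k → ∑ (λ l → r k * r l * four k l))
        ≡⟨ ∑∑-cong (λ k l → sym (masked (others i m k) (others i m l) (four≡ i≢m))) ⟩
      ∑ (λ k → ∑ (λ l → r k * r l * (falling n 4 * E (λ π → β-D (app π i) (app π m) * sq (Dπ π k l)))))
        ≡⟨ ∑∑-cong (λ k l → trans (lem (r k * r l) (falling n 4) (E (λ π → β-D (app π i) (app π m) * sq (Dπ π k l))))
             (cong (falling n 4 *_) (trans (sym (E-*ˡ (r k * r l) _)) (E-cong (λ π → lem (r k * r l) (β-D (app π i) (app π m)) (sq (Dπ π k l))))))) ⟩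
      ∑ (λ k → ∑ (λ l → falling n 4 * E (λ π → β-D (app π i) (app π m) * (r k * r l * sq (Dπ π k l)))))
        ≡⟨ trans (∑∑-*ˡ (falling n 4) _) (cong (falling n 4 *_) (sym (E-∑∑ (λ k l π → β-D (app π i) (app π m) * (r k * r l * sq (Dπ π k l)))))) ⟩
      falling n 4 * E (λ π → ∑ (λ k → ∑ (λ l → β-D (app π i) (app π m) * (r k * r l * sq (Dπ π k l)))))
        ≡⟨ cong (falling n 4 *_) (E-cong (λ π → ∑∑-*ˡ (β-D (app π i) (app π m)) (λ k l → r k * r l * sq (Dπ π k l)))) ⟩
      falling n 4 * E (λ π → β-D (app π i) (app π m) * Q π)
        ≤⟨ *-mono (falling-nonneg n 4) (0≤# 432 ⊛ 0≤# n ⊛ 0≤ε) (falling4≤ n) E-β-Q-τ≤ ⟩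
      #[ n ]² * #[ n ]² * (# 432 * # n * ε) ∎
      where
      open ℚₚ.≤-Reasoning
      lem = solve 3 (λ p q t → p :* (q :* t) := q :* (p :* t)) refl

  module _ (i : Fin n) where

    weight : (k l c d : Fin n) → ℚ
    weight k l c d = ne k i * ne l i * sq (D k l c d)

    0≤weight : ∀ k l c d → 0ℚ ≤ weight k l c d
    0≤weight k l c d = 0≤ne k i ⊛ 0≤ne l i ⊛ 0≤sq (D k l c d)

    -- Tests whether the rectangle on rows i, m and columns a, b has |D| ≥ ½ and shares no line with
    -- (k, l; c, d). That k and l differ from i is left to `weight`.
    cross : (k l c d m a b : Fin n) → ℚ
    cross k l c d m a b = ne k m * ne l m * χ a b c d * β (D i m a b)

    0≤cross : ∀ k l c d m a b → 0ℚ ≤ cross k l c d m a b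
    0≤cross k l c d m a b = 0≤ne k m ⊛ 0≤ne l m ⊛ 0≤χ a b c d ⊛ 0≤β (D i m a b)

    crossings : (k l c d : Fin n) → ℚ
    crossings k l c d = ∑ (λ m → ∑ (λ a → ∑ (λ b → cross k l c d m a b)))

    -- For fixed m take υ = τ i m and the block of all other rows. The powers of n are n for the
    -- choice of m, n⁴ for passing from means to sums over four columns, and n for the block size in
    -- `Smoothing.E-Q≤`; 432 = 4·108.
    row-inequality : ∑⁴ (λ k l c d → weight k l c d * crossings k l c d) ≤ # 432 * (#[ n ]² * #[ n ]² * #[ n ]²) * ε
    row-inequality = begin
      ∑⁴ (λ k l c d → weight k l c d * crossings k l c d)
        ≡⟨ ∑⁴-cong (λ k l c d → trans (sym (sum-*ˡ (weight k l c d) (λ m → ∑ (λ a → ∑ (λ b → cross k l c d m a b))) (allFin n)))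
             (∑-cong (λ m → sym (∑∑-*ˡ (weight k l c d) (cross k l c d m))))) ⟩
      ∑⁴ (λ k l c d → ∑ (λ m → ∑ (λ a → ∑ (λ b → weight k l c d * cross k l c d m a b))))
        ≡⟨ ∑-∑⁴-swap (λ m k l c d → ∑ (λ a → ∑ (λ b → weight k l c d * cross k l c d m a b))) ⟨
      ∑ (λ m → ∑⁴ (λ k l c d → ∑ (λ a → ∑ (λ b → weight k l c d * cross k l c d m a b))))
        ≡⟨ ∑-cong (λ m → ∑∑-cong (λ k l → trans (sym (∑∑-∑∑-swap (λ a b c d → weight k l c d * cross k l c d m a b)))
             (trans (∑⁴-cong (λ a b c d → rearrange m k l a b c d)) (∑⁴-*ˡ (r m k * r m l) (λ a b c d → χ a b c d * (β-D i m a b * sq (D k l c d))))))) ⟩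
      ∑ (λ m → ∑ (λ k → ∑ (λ l → r m k * r m l * four i m k l)))
        ≤⟨ ∑-mono per-row ⟩
      ∑ {n} (λ m → #[ n ]² * #[ n ]² * (# 432 * # n * ε))
        ≡⟨ ∑-const n (#[ n ]² * #[ n ]² * (# 432 * # n * ε)) ⟩
      # n * (#[ n ]² * #[ n ]² * (# 432 * # n * ε))
        ≡⟨ lem (# n) ε ⟩
      # 432 * (#[ n ]² * #[ n ]² * #[ n ]²) * ε ∎
      where
      open ℚₚ.≤-Reasoning
      lem = solve 2 (λ n e → n :* ((n :²) :² :* (:# 432 :* n :* e)) := :# 432 :* ((n :²) :² :* (n :²)) :* e) refl
      r : Fin n → Fin n → ℚ
      r m = Block.r (others i m)
      lem₂ = solve 7 (λ ki li w km lm x b → (ki :* li :* w) :* (km :* lm :* x :* b) := (ki :* km) :* (li :* lm) :* (x :* (b :* w))) refl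
      rearrange : ∀ m k l a b c d → weight k l c d * cross k l c d m a b ≡ r m k * r m l * (χ a b c d * (β-D i m a b * sq (D k l c d)))
      rearrange m k l a b c d = trans (lem₂ (ne k i) (ne l i) (sq (D k l c d)) (ne k m) (ne l m) (χ a b c d) (β (D i m a b)))
        (cong₂ (λ p q → p * q * (χ a b c d * (β-D i m a b * sq (D k l c d)))) (sym (others-indicator i m k)) (sym (others-indicator i m l)))
      zero-row : ∀ k l → ∑⁴ (λ a b c d → χ a b c d * (β-D i i a b * sq (D k l c d))) ≡ 0ℚ
      zero-row k l = ∑⁴-zero (λ a b c d → trans (cong (λ t → χ a b c d * (β t * sq (D k l c d))) (D-row-diag i a b)) (lem₃ (χ a b c d) (sq (D k l c d))))
        where
        lem₃ = solve 2 (λ p q → p :* (:# 0 :* q) := :# 0) refl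
      per-row : ∀ m → ∑ (λ k → ∑ (λ l → r m k * r m l * four i m k l)) ≤ #[ n ]² * #[ n ]² * (# 432 * # n * ε)
      per-row m = go (i ≟ m)
        where
        go : Dec (i ≡ m) → ∑ (λ k → ∑ (λ l → r m k * r m l * four i m k l)) ≤ #[ n ]² * #[ n ]² * (# 432 * # n * ε)
        go (no i≢m)   = ∑∑-four≤ i m i≢m
        go (yes refl) = subst (_≤ #[ n ]² * #[ n ]² * (# 432 * # n * ε))
          (sym (trans (∑∑-cong (λ k l → trans (cong (r i k * r i l *_) (zero-row k l)) (lem₄ (r i k * r i l))))
            (trans (∑∑-*ˡ 0ℚ (λ _ _ → 0ℚ)) (ℚₚ.*-zeroˡ (∑ {n} (λ _ → ∑ {n} (λ _ → 0ℚ)))))))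
          (0≤sq (# n) ⊛ 0≤sq (# n) ⊛ (0≤# 432 ⊛ 0≤# n ⊛ 0≤ε))
          where
          lem₄ = solve 1 (λ p → p :* :# 0 := :# 0) refl

E-bool² : ∀ {n} (f : Perm n → Bool) → E (λ π → sq (toℚ (f π))) ≡ E (λ π → toℚ (f π))
E-bool² f = E-cong (λ π → idem (f π))
  where
  idem : ∀ b → sq (toℚ b) ≡ toℚ b
  idem true  = refl
  idem false = refl

-- Total weight of the rectangles and the variance of ℓ

module Energy {n : ℕ} (c : Fin n → Fin n → ℚ) (f : Perm n → Bool) (ε : ℚ)
  (close : E (λ π → sq (toℚ (f π) - Linear.ℓ c π)) ≤ ε) (2<n : # 2 < # n) where

  open RowInequality c f ε close 2<n public

  0≤n-1 : 0ℚ ≤ # n - 1ℚ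
  0≤n-1 = to0 (ℚₚ.≤-trans (#-mono {1} {2} (s≤s z≤n)) (ℚₚ.<⇒≤ 2<n))

  n≤2n-2 : # n ≤ # 2 * (# n - 1ℚ)
  n≤2n-2 = by-difference (to0 (ℚₚ.<⇒≤ 2<n)) (lem (# n))
    where
    lem = solve 1 (λ n → :# 2 :* (n :- :# 1) :- n := n :- :# 2) refl

  E-D² : ∀ k l → # n * (# n - 1ℚ) * E (λ π → sq (D k l (app π k) (app π l))) ≡ ∑ (λ a → ∑ (λ b → sq (D k l a b)))
  E-D² k l = go (k ≟ l)
    where
    go : Dec (k ≡ l) → # n * (# n - 1ℚ) * E (λ π → sq (D k l (app π k) (app π l))) ≡ ∑ (λ a → ∑ (λ b → sq (D k l a b)))
    go (no k≢l)   = E-pair (λ a b → sq (D k l a b)) (λ a → cong sq (D-col-diag k l a)) k≢l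
    go (yes refl) = trans (trans (cong (# n * (# n - 1ℚ) *_) (trans (E-cong (λ π → cong sq (D-row-diag k (app π k) (app π k)))) (E-const 0ℚ)))
        (ℚₚ.*-zeroʳ (# n * (# n - 1ℚ))))
      (sym (∑∑-zero (λ a b → cong sq (D-row-diag k a b))))

  -- `sq-difference-bound` averaged over π: outside the rectangles with |D| ≥ ½, the weight on two
  -- given rows is paid by the errors at π and π ∙ τ k l.
  D²-total≤ : ∀ k l → ∑ (λ a → ∑ (λ b → sq (D k l a b))) ≤ # 2 * ∑ (λ a → ∑ (λ b → β (D k l a b))) + # 8 * #[ n ]² * ε
  D²-total≤ k l = go (k ≟ l)
    where
    open ℚₚ.≤-Reasoning
    M : ℚ
    M = # n * (# n - 1ℚ)
    0≤M : 0ℚ ≤ M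
    0≤M = 0≤# n ⊛ 0≤n-1
    M≤n² : M ≤ #[ n ]²
    M≤n² = by-difference (0≤# n) (lem (# n))
      where
      lem = solve 1 (λ n → n :² :- n :* (n :- :# 1) := n) refl
    b e² : ℚ
    b = E (λ π → β (D k l (app π k) (app π l)))
    e² = E (λ π → e π + e (π ∙ τ k l))
    pointwise : ∀ π → sq (D k l (app π k) (app π l)) ≤ # 2 * β (D k l (app π k) (app π l)) + # 4 * (e π + e (π ∙ τ k l))
    pointwise π = subst (λ t → sq t ≤ # 2 * β t + # 4 * (e π + e (π ∙ τ k l))) (ℓ-τ k l π)
      (sq-difference-bound (f π) (f (π ∙ τ k l)) (ℓ π) (ℓ (π ∙ τ k l)))
    e²≤ : e² ≤ ε + ε
    e²≤ = subst (_≤ ε + ε) (sym (E-+ e (λ π → e (π ∙ τ k l)))) (ℚₚ.+-mono-≤ close (E-e (τ k l)))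
    lem₁ = solve 3 (λ m b s → m :* (:# 2 :* b :+ :# 4 :* s) := :# 2 :* (m :* b) :+ :# 4 :* m :* s) refl
    lem₂ = solve 2 (λ m e → :# 4 :* m :* (e :+ e) := :# 8 :* m :* e) refl
    go : Dec (k ≡ l) → ∑ (λ a → ∑ (λ b → sq (D k l a b))) ≤ # 2 * ∑ (λ a → ∑ (λ b → β (D k l a b))) + # 8 * #[ n ]² * ε
    go (yes refl) = subst (_≤ # 2 * ∑ (λ a → ∑ (λ b → β (D k l a b))) + # 8 * #[ n ]² * ε)
      (sym (∑∑-zero (λ a b → cong sq (D-row-diag k a b))))
      (0≤# 2 ⊛ ∑∑-nonneg (λ a b → 0≤β (D k k a b)) ⊕ 0≤# 8 ⊛ 0≤sq (# n) ⊛ 0≤ε)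
    go (no k≢l) = begin
      ∑ (λ a → ∑ (λ b → sq (D k l a b)))
        ≡⟨ E-D² k l ⟨
      M * E (λ π → sq (D k l (app π k) (app π l)))
        ≤⟨ *-monoˡ 0≤M (E-mono pointwise) ⟩
      M * E (λ π → # 2 * β (D k l (app π k) (app π l)) + # 4 * (e π + e (π ∙ τ k l)))
        ≡⟨ cong (M *_) (trans (E-+ _ _) (cong₂ _+_ (E-*ˡ (# 2) _) (E-*ˡ (# 4) _))) ⟩
      M * (# 2 * b + # 4 * e²)
        ≡⟨ lem₁ M b e² ⟩
      # 2 * (M * b) + # 4 * M * e²
        ≤⟨ ℚₚ.+-mono-≤ (ℚₚ.≤-reflexive (cong (# 2 *_) (E-pair (λ a b → β (D k l a b)) (λ a → cong β (D-col-diag k l a)) k≢l)))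
             (*-monoˡ (0≤# 4 ⊛ 0≤M) e²≤) ⟩
      # 2 * ∑ (λ a → ∑ (λ b → β (D k l a b))) + # 4 * M * (ε + ε)
        ≡⟨ cong (_+_ (# 2 * ∑ (λ a → ∑ (λ b → β (D k l a b))))) (lem₂ M ε) ⟩
      # 2 * ∑ (λ a → ∑ (λ b → β (D k l a b))) + # 8 * M * ε
        ≤⟨ by-difference (0≤# 8 ⊛ to0 M≤n² ⊛ 0≤ε) (lem₃ (∑ (λ a → ∑ (λ b → β (D k l a b)))) M #[ n ]² ε) ⟩
      # 2 * ∑ (λ a → ∑ (λ b → β (D k l a b))) + # 8 * #[ n ]² * ε ∎
      where
      lem₃ = solve 4 (λ b m p e → :# 2 :* b :+ :# 8 :* p :* e :- (:# 2 :* b :+ :# 8 :* m :* e) := :# 8 :* (p :- m) :* e) refl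

  module _ (R : Fin n → Bool) where
    open Block R

    E-Q : # n * (# n - 1ℚ) * E Q ≡ ∑⁴ (λ k l a b → r k * r l * sq (D k l a b))
    E-Q = begin
      # n * (# n - 1ℚ) * E Q
        ≡⟨ cong (M *_) (trans (E-∑∑ (λ k l π → r k * r l * sq (Dπ π k l))) (∑∑-cong (λ k l → E-*ˡ (r k * r l) _))) ⟩
      M * ∑ (λ k → ∑ (λ l → r k * r l * E (λ π → sq (Dπ π k l))))
        ≡⟨ trans (sym (∑∑-*ˡ M _)) (∑∑-cong (λ k l → trans (lem M (r k * r l) (E (λ π → sq (Dπ π k l))))
             (trans (cong (r k * r l *_) (E-D² k l)) (sym (∑∑-*ˡ (r k * r l) (λ a b → sq (D k l a b))))))) ⟩
      ∑⁴ (λ k l a b → r k * r l * sq (D k l a b)) ∎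
      where
      open ≡-Reasoning
      M : ℚ
      M = # n * (# n - 1ℚ)
      lem = solve 3 (λ m p e → m :* (p :* e) := p :* (m :* e)) refl

    E-Q-ξ : 0ℚ < N → N * E Q ≡ # 4 * E (λ π → sq (ξ π))
    E-Q-ξ 0<N = trans (cong (N *_) (E-cong (λ π → sym (ℚₚ.*-identityˡ (Q π)))))
      (trans (poincaré-identity 0<N (λ _ → 1ℚ) (λ _ _ → refl)) (cong (# 4 *_) (E-cong (λ π → ℚₚ.*-identityˡ (sq (ξ π))))))

  W : ℚ
  W = ∑⁴ (λ i k a b → sq (D i k a b))

  0≤W : 0ℚ ≤ W
  0≤W = ∑⁴-nonneg (λ i k a b → 0≤sq (D i k a b))

  private
    module All = Block (λ _ → true)

  -- C/n is the mean of ℓ, as `E-centered` shows, and `V` is n² times its variance; the scaling by n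
  -- avoids division.
  C : ℚ
  C = ∑ (λ k → ∑ (λ j → c k j))

  ξ-all : ∀ π → All.ξ π ≡ # n * ℓ π - C
  ξ-all π = cong₂ _-_ (cong₂ _*_ (trans (∑-const n 1ℚ) (ℚₚ.*-identityʳ (# n))) (∑-cong (λ k → ℚₚ.*-identityˡ (c k (app π k)))))
    (∑-cong (λ k → trans (∑-cong (λ l → lem (c k (app π l)))) (∑-permute π (c k))))
    where
    lem = solve 1 (λ p → :# 1 :* :# 1 :* p := p) refl

  N-all : All.N ≡ # n
  N-all = trans (∑-const n 1ℚ) (ℚₚ.*-identityʳ (# n))

  V : ℚ
  V = E (λ π → sq (# n * ℓ π - C))

  -- The Poincaré identity for the block of all rows. It turns bounds on the variance of a nearly
  -- Boolean ℓ into bounds for W, of order n³δ from below and n³ from above.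
  W≡ : W ≡ # 4 * (# n - 1ℚ) * V
  W≡ = begin
    W
      ≡⟨ ∑⁴-cong (λ k l a b → lem₁ (sq (D k l a b))) ⟩
    ∑⁴ (λ k l a b → 1ℚ * 1ℚ * sq (D k l a b))
      ≡⟨ E-Q (λ _ → true) ⟨
    # n * (# n - 1ℚ) * E All.Q
      ≡⟨ lem₂ (# n) (# n - 1ℚ) (E All.Q) ⟩
    (# n - 1ℚ) * (# n * E All.Q)
      ≡⟨ cong (λ t → (# n - 1ℚ) * (t * E All.Q)) N-all ⟨
    (# n - 1ℚ) * (All.N * E All.Q)
      ≡⟨ cong ((# n - 1ℚ) *_) (E-Q-ξ (λ _ → true) (subst (0ℚ <_) (sym N-all) 0<n)) ⟩
    (# n - 1ℚ) * (# 4 * E (λ π → sq (All.ξ π)))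
      ≡⟨ trans (cong (λ t → (# n - 1ℚ) * (# 4 * t)) (E-cong (λ π → cong sq (ξ-all π)))) (lem₃ (# n - 1ℚ) V) ⟩
    # 4 * (# n - 1ℚ) * V ∎
    where
    open ≡-Reasoning
    lem₁ = solve 1 (λ t → t := :# 1 :* :# 1 :* t) refl
    lem₂ = solve 3 (λ a b t → a :* b :* t := b :* (a :* t)) refl
    lem₃ = solve 2 (λ a t → a :* (:# 4 :* t) := :# 4 :* a :* t) refl

  E-centered : E (λ π → # n * ℓ π - C) ≡ 0ℚ
  E-centered = *-cancelˡ-≡ (# 2) (0<#suc 1) (begin
    # 2 * E (λ π → # n * ℓ π - C)
      ≡⟨ trans (cong (# 2 *_) (E-cong (λ π → sym (ξ-all π)))) (sym (E-*ˡ (# 2) All.ξ)) ⟩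
    E (λ π → # 2 * All.ξ π)
      ≡⟨ trans (E-cong (λ π → sym (All.∑∑-D π))) (E-∑∑ (λ k l π → 1ℚ * 1ℚ * All.Dπ π k l)) ⟩
    ∑ (λ k → ∑ (λ l → E (λ π → 1ℚ * 1ℚ * All.Dπ π k l)))
      ≡⟨ ∑∑-cong (λ k l → trans (E-cong (λ π → trans (ℚₚ.*-identityˡ (All.Dπ π k l)) (sym (ℓ-τ k l π))))
           (trans (E-- ℓ (λ π → ℓ (π ∙ τ k l))) (trans (cong (_-_ (E ℓ)) (E-translate ℓ (τ k l))) (ℚₚ.+-inverseʳ (E ℓ))))) ⟩
    ∑ {n} (λ k → ∑ {n} (λ l → 0ℚ))
      ≡⟨ ∑∑-zero (λ _ _ → refl) ⟩
    0ℚ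
      ≡⟨ ℚₚ.*-zeroʳ (# 2) ⟨
    # 2 * 0ℚ ∎)
    where open ≡-Reasoning

  module _ (δ : ℚ) (0<δ : 0ℚ < δ) (δ≤p : δ ≤ E (λ π → toℚ (f π))) (p≤1-δ : E (λ π → toℚ (f π)) ≤ 1ℚ - δ) (8ε≤δ : # 8 * ε ≤ δ) where

    private
      p : ℚ
      p = E (λ π → toℚ (f π))
      0≤δ : 0ℚ ≤ δ
      0≤δ = ℚₚ.<⇒≤ 0<δ

    2δ≤1 : # 2 * δ ≤ 1ℚ
    2δ≤1 = by-difference (to0 (ℚₚ.≤-trans δ≤p p≤1-δ)) (lem δ)
      where
      lem = solve 1 (λ d → :# 1 :- :# 2 :* d := :# 1 :- d :- d) refl

    -- V is at most the second moment n²E(ℓ²) about 0, because C is the mean of nℓ, and ℓ² ≤ 2(f -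
    -- ℓ)² + 2 for Boolean f.
    V≤ : V ≤ # 3 * #[ n ]²
    V≤ = begin
      V
        ≤⟨ by-difference (0≤sq C) (lem₁ V C) ⟩
      V + # 2 * C * 0ℚ + C * C
        ≡⟨ cong₂ (λ u v → V + # 2 * C * u + v) (sym E-centered) (sym (E-const {n} (C * C))) ⟩
      V + # 2 * C * E (λ π → # n * ℓ π - C) + E {n} (λ π → C * C)
        ≡⟨ trans (cong (λ t → V + t + E {n} (λ π → C * C)) (sym (E-*ˡ (# 2 * C) (λ π → # n * ℓ π - C))))
             (trans (cong (_+ E {n} (λ π → C * C)) (sym (E-+ _ _))) (sym (E-+ _ _))) ⟩
      E (λ π → sq (# n * ℓ π - C) + # 2 * C * (# n * ℓ π - C) + C * C)
        ≤⟨ E-mono (λ π → by-difference (0≤sq (# n) ⊛ (0≤sq (toℚ (f π) - ℓ π + toℚ (f π)) ⊕ 0≤# 2 ⊛ to0 (bool²≤1 (f π))))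
             (lem₂ (# n) (ℓ π) C (toℚ (f π)))) ⟩
      E (λ π → #[ n ]² * (# 2 * e π + # 2))
        ≡⟨ trans (E-*ˡ #[ n ]² _) (cong (#[ n ]² *_) (trans (E-+ _ _) (cong₂ _+_ (E-*ˡ (# 2) e) (E-const (# 2))))) ⟩
      #[ n ]² * (# 2 * E e + # 2)
        ≤⟨ by-difference (0≤sq (# n) ⊛ (0≤# 2 ⊛ to0 close ⊕ 0≤sq ½ ⊛ to0 8ε≤δ ⊕ 0≤sq ½ ⊛ (to0 2δ≤1 ⊕ 0≤δ) ⊕ 0≤# 3 ⊛ 0≤sq ½)) (lem₃ (# n) (E e) ε δ) ⟩
      # 3 * #[ n ]² ∎
      where
      open ℚₚ.≤-Reasoning
      bool²≤1 : ∀ b → sq (toℚ b) ≤ 1ℚ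
      bool²≤1 true  = ℚₚ.≤-refl
      bool²≤1 false = 0≤1
      lem₁ = solve 2 (λ v c → v :+ :# 2 :* c :* :# 0 :+ c :² :- v := c :²) refl
      lem₂ = solve 4 (λ n l c x → n :² :* (:# 2 :* ((x :- l) :²) :+ :# 2) :- ((n :* l :- c) :² :+ :# 2 :* c :* (n :* l :- c) :+ c :²) :=
        n :² :* ((x :- l :+ x) :² :+ :# 2 :* (:# 1 :- x :²))) refl
      lem₃ = solve 4 (λ n x e d → :# 3 :* (n :²) :- n :² :* (:# 2 :* x :+ :# 2) :=
        n :² :* (:# 2 :* (e :- x) :+ con ½ :² :* (d :- :# 8 :* e) :+ con ½ :² :* (:# 1 :- :# 2 :* d :+ d) :+ :# 3 :* (con ½ :²))) refl

    -- The second moment of nf about C is at least n²p(1 - p) ≥ n²δ/2 and at most 2n²E(e) + 2V. The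
    -- error term is absorbed by 8ε ≤ δ.
    V≥ : #[ n ]² * δ ≤ # 8 * V
    V≥ = begin
      #[ n ]² * δ
        ≤⟨ by-difference (0≤# 4 ⊛ 0≤sq (# n * p - C) ⊕ 0≤sq (# n) ⊛ (0≤# 4 ⊛ (to0 δ≤p ⊛ to0 p≤1-δ) ⊕ 0≤# 2 ⊛ (0≤δ ⊛ to0 2δ≤1) ⊕ to0 8ε≤δ ⊕ 0≤# 8 ⊛ to0 close))
             (lem₁ (# n) δ p C ε (E e)) ⟩
      # 4 * (#[ n ]² * p - # 2 * # n * C * p + C * C) - # 8 * #[ n ]² * E e
        ≡⟨ cong (λ t → # 4 * t - # 8 * #[ n ]² * E e) expand ⟨
      # 4 * E (λ π → sq (# n * toℚ (f π) - C)) - # 8 * #[ n ]² * E e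
        ≤⟨ from0 (subst (0ℚ ≤_) (lem₂ (E (λ π → sq (# n * toℚ (f π) - C))) (E e) V) (to0 (*-monoˡ (0≤# 4) split))) ⟩
      # 8 * V ∎
      where
      open ℚₚ.≤-Reasoning
      lem₁ = solve 6 (λ n d p c e x → :# 4 :* (n :² :* p :- :# 2 :* n :* c :* p :+ c :²) :- :# 8 :* (n :²) :* x :- n :² :* d :=
        :# 4 :* ((n :* p :- c) :²) :+ n :² :* (:# 4 :* ((p :- d) :* (:# 1 :- d :- p)) :+ :# 2 :* (d :* (:# 1 :- :# 2 :* d)) :+ (d :- :# 8 :* e)
        :+ :# 8 :* (e :- x))) refl
      lem₂ : ∀ s x v → # 4 * (# 2 * (#[ n ]² * x) + # 2 * v) - # 4 * s ≡ # 8 * v - (# 4 * s - # 8 * #[ n ]² * x)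
      lem₂ s x v = lem₂′ #[ n ]² s x v
        where
        lem₂′ = solve 4 (λ m s x v → :# 4 :* (:# 2 :* (m :* x) :+ :# 2 :* v) :- :# 4 :* s := :# 8 :* v :- (:# 4 :* s :- :# 8 :* m :* x)) refl
      expand : E (λ π → sq (# n * toℚ (f π) - C)) ≡ #[ n ]² * p - # 2 * # n * C * p + C * C
      expand = trans (E-cong (λ π → lem₃ (# n) (toℚ (f π)) C))
        (trans (E-+ _ _) (cong₂ _+_ (trans (E-- _ _) (cong₂ _-_ (trans (E-*ˡ #[ n ]² _) (cong (#[ n ]² *_) (E-bool² f))) (E-*ˡ (# 2 * # n * C) _)))
          (E-const (C * C))))
        where
        lem₃ = solve 3 (λ n x c → (n :* x :- c) :² := n :² :* (x :²) :- :# 2 :* n :* c :* x :+ c :²) refl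
      split : E (λ π → sq (# n * toℚ (f π) - C)) ≤ # 2 * (#[ n ]² * E e) + # 2 * V
      split = subst (E (λ π → sq (# n * toℚ (f π) - C)) ≤_)
        (trans (E-+ _ _) (cong₂ _+_ (trans (E-*ˡ (# 2) _) (cong (# 2 *_) (E-*ˡ #[ n ]² e))) (E-*ˡ (# 2) _)))
        (E-mono (λ π → by-difference (0≤sq (# n * (toℚ (f π) - ℓ π) - (# n * ℓ π - C))) (lem₄ (# n) (toℚ (f π)) (ℓ π) C)))
        where
        lem₄ = solve 4 (λ n x l c → :# 2 :* (n :² :* ((x :- l) :²)) :+ :# 2 :* ((n :* l :- c) :²) :- (n :* x :- c) :² :=
          (n :* (x :- l) :- (n :* l :- c)) :²) refl

    W≤ : W ≤ # 12 * (#[ n ]² * # n)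
    W≤ = subst (_≤ # 12 * (#[ n ]² * # n)) (sym W≡)
      (by-difference (0≤# 4 ⊛ 0≤n-1 ⊛ to0 V≤ ⊕ 0≤# 12 ⊛ 0≤sq (# n)) (lem (# n) V))
      where
      lem = solve 2 (λ n v → :# 12 :* (n :² :* n) :- :# 4 :* (n :- :# 1) :* v := :# 4 :* (n :- :# 1) :* (:# 3 :* (n :²) :- v) :+ :# 12 :* (n :²)) refl

    W≥ : #[ n ]² * # n * δ ≤ # 4 * W
    W≥ = subst (λ t → #[ n ]² * # n * δ ≤ # 4 * t) (sym W≡)
      (by-difference (0≤# 2 ⊛ 0≤n-1 ⊛ to0 V≥ ⊕ to0 n≤2n-2 ⊛ (0≤sq (# n) ⊛ 0≤δ)) (lem (# n) V δ))
      where
      lem = solve 3 (λ n v d → :# 4 :* (:# 4 :* (n :- :# 1) :* v) :- n :² :* n :* d :=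
        :# 2 :* (n :- :# 1) :* (:# 8 :* v :- n :² :* d) :+ (:# 2 :* (n :- :# 1) :- n) :* (n :² :* d)) refl

-- Rounding to a dictator

PrNeq≡ : ∀ {n} (F G : Perm n → ℚ) → PrNeq n F G ≡ E (λ π → toℚ (not ⌊ F π ℚ≟ G π ⌋))
PrNeq≡ F G = sym (E≡𝔼 (λ π → toℚ (not ⌊ F π ℚ≟ G π ⌋)))

record NearDictator {n} (f : Perm n → Bool) (ε δ K′ : ℚ) : Set where
  constructor nearDictator
  field
    𝒞          : Fin n → Fin n → Bool
    isDictator : IsDictatorSet 𝒞
    bound      : PrNeq n (λ π → toℚ (f π)) (sumOver 𝒞) * δ ≤ K′ * ε

sumOver≡ : ∀ {n} (𝒞 : Fin n → Fin n → Bool) π → sumOver 𝒞 π ≡ ∑ (λ i → toℚ (𝒞 i (app π i)))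
sumOver≡ {n} 𝒞 π = trans (sym (sum≡sumℚ _ (allFin n))) (∑-cong λ i →
  trans (sym (sum≡sumℚ (λ j → if 𝒞 i j then x i j π else 0ℚ) (allFin n)))
    (trans (∑-cong (λ j → lem (𝒞 i j) (x i j π))) (∑-single (λ j → toℚ (𝒞 i j)) (app π i))))
  where
  lem : ∀ b p → (if b then p else 0ℚ) ≡ p * toℚ b
  lem true  p = sym (ℚₚ.*-identityʳ p)
  lem false p = sym (ℚₚ.*-zeroʳ p)

rowSet : ∀ {n} → Fin n → (Fin n → Bool) → Fin n → Fin n → Bool
rowSet i J k j = ⌊ k ≟ i ⌋ ∧ J j

rowSet-dictator : ∀ {n} (i : Fin n) J → IsDictatorSet (rowSet i J)
rowSet-dictator i J = inj₁ (i , λ k j p → go k (T-∧ˡ ⌊ k ≟ i ⌋ p))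
  where
  go : ∀ k → T ⌊ k ≟ i ⌋ → k ≡ i
  go k p with k ≟ i
  ... | yes eq = eq
  go k () | no _

sumOver-rowSet : ∀ {n} (i : Fin n) J (π : Perm n) → sumOver (rowSet i J) π ≡ toℚ (J (app π i))
sumOver-rowSet {n} i J π = trans (sumOver≡ (rowSet i J) π)
  (trans (∑-cong (λ k → at k (k ≟ i) (i ≟ k))) (∑-single (λ k → toℚ (J (app π k))) i))
  where
  at : ∀ k (d : Dec (k ≡ i)) (d′ : Dec (i ≡ k)) → toℚ (⌊ d ⌋ ∧ J (app π k)) ≡ ⟦ d′ ⟧ * toℚ (J (app π k))
  at k (yes _)   (yes _)   = sym (ℚₚ.*-identityˡ (toℚ (J (app π k))))
  at k (yes p)   (no ¬q)   = contradiction (sym p) ¬q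
  at k (no ¬p)   (yes q)   = contradiction (sym q) ¬p
  at k (no _)    (no _)    = sym (ℚₚ.*-zeroˡ (toℚ (J (app π k))))

module Rounding {n : ℕ} (c : Fin n → Fin n → ℚ) (f : Perm n → Bool) (ε : ℚ)
  (close : E (λ π → sq (toℚ (f π) - Linear.ℓ c π)) ≤ ε) (2<n : # 2 < # n) (i : Fin n) where

  open Energy c f ε close 2<n
  open Block (others i i)

  r≡ne : ∀ t → r t ≡ ne t i
  r≡ne t = trans (others-indicator i i t) (go (t ≟ i))
    where
    go : (d : Dec (t ≡ i)) → (1ℚ - ⟦ d ⟧) * (1ℚ - ⟦ d ⟧) ≡ 1ℚ - ⟦ d ⟧
    go (yes _) = refl
    go (no _)  = refl

  ⟦≟⟧-sym : ∀ (s t : Fin n) → ⟦ s ≟ t ⟧ ≡ ⟦ t ≟ s ⟧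
  ⟦≟⟧-sym s t = ⟦⟧-⇔ (s ≟ t) (t ≟ s) sym sym

  -- N times the conditional mean of ℓ given π(i) = j, where N = n - 1: each row k other than i
  -- averages over the columns other than j.
  g : Fin n → ℚ
  g j = N * c i j + ∑ (λ k → r k * (∑ (c k) - c k j))

  ℓ-split : ∀ π → ℓ π ≡ c i (app π i) + ∑ (λ k → r k * c k (app π k))
  ℓ-split π = begin
    ∑ (λ k → c k (app π k))
      ≡⟨ ∑-cong (λ k → trans (lem ⟦ i ≟ k ⟧ (c k (app π k)))
           (cong (λ t → ⟦ i ≟ k ⟧ * c k (app π k) + t * c k (app π k)) (trans (cong (_-_ 1ℚ) (⟦≟⟧-sym i k)) (sym (r≡ne k))))) ⟩
    ∑ (λ k → ⟦ i ≟ k ⟧ * c k (app π k) + r k * c k (app π k))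
      ≡⟨ sum-+ (λ k → ⟦ i ≟ k ⟧ * c k (app π k)) (λ k → r k * c k (app π k)) (allFin n) ⟩
    ∑ (λ k → ⟦ i ≟ k ⟧ * c k (app π k)) + ∑ (λ k → r k * c k (app π k))
      ≡⟨ cong (_+ ∑ (λ k → r k * c k (app π k))) (∑-single (λ k → c k (app π k)) i) ⟩
    c i (app π i) + ∑ (λ k → r k * c k (app π k)) ∎
    where
    open ≡-Reasoning
    lem = solve 2 (λ p q → q := p :* q :+ (:# 1 :- p) :* q) refl

  average-split : ∀ π → ∑ (λ k → ∑ (λ l → r k * r l * c k (app π l))) ≡ ∑ (λ k → r k * (∑ (c k) - c k (app π i)))
  average-split π = ∑-cong λ k → begin
    ∑ (λ l → r k * r l * c k (app π l))
      ≡⟨ ∑-cong (λ l → trans (cong (λ t → r k * t * c k (app π l)) (trans (r≡ne l) (cong (_-_ 1ℚ) (⟦≟⟧-sym l i)))) (lem (r k) ⟦ i ≟ l ⟧ (c k (app π l)))) ⟩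
    ∑ (λ l → r k * (c k (app π l) - ⟦ i ≟ l ⟧ * c k (app π l)))
      ≡⟨ sum-*ˡ (r k) _ (allFin n) ⟩
    r k * ∑ (λ l → c k (app π l) - ⟦ i ≟ l ⟧ * c k (app π l))
      ≡⟨ cong (r k *_) (trans (sum-- (λ l → c k (app π l)) (λ l → ⟦ i ≟ l ⟧ * c k (app π l)) (allFin n))
           (cong₂ _-_ (∑-permute π (c k)) (∑-single (λ l → c k (app π l)) i))) ⟩
    r k * (∑ (c k) - c k (app π i)) ∎
    where
    open ≡-Reasoning
    lem = solve 3 (λ p q s → p :* (:# 1 :- q) :* s := p :* (s :- q :* s)) refl

  ξ-split : ∀ π → N * ℓ π ≡ ξ π + g (app π i)
  ξ-split π = trans (cong (N *_) (ℓ-split π)) (trans (lem N (c i (app π i)) (∑ (λ k → r k * c k (app π k))) (∑ (λ k → r k * (∑ (c k) - c k (app π i)))))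
    (cong (λ t → N * ∑ (λ k → r k * c k (app π k)) - t + g (app π i)) (sym (average-split π))))
    where
    lem = solve 4 (λ m a s t → m :* (a :+ s) := m :* s :- t :+ (m :* a :+ t)) refl

  J : Fin n → Bool
  J j = ⌊ N ≤? # 2 * g j ⌋

  disagreement : Perm n → ℚ
  disagreement π = toℚ (not ⌊ toℚ (f π) ℚ≟ toℚ (J (app π i)) ⌋)

  -- Rounding g/N at ½ can fail only where |Nf - g| ≥ N/2, and Nf - g = N(f - ℓ) + ξ. The constant
  -- is 8 = 4·2, from squaring ½ and from splitting the sum.
  disagreement≤ : ∀ π → N * N * disagreement π ≤ # 8 * (N * N * e π + sq (ξ π))
  disagreement≤ π = ℚₚ.≤-trans (go (f π) (N ≤? # 2 * γ)) (by-difference (0≤# 4 ⊛ 0≤sq (N * (toℚ (f π) - ℓ π) - ξ π))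
    (trans (cong (λ t → # 8 * (N * N * e π + sq (ξ π)) - # 4 * sq t) eq) (lem N (toℚ (f π) - ℓ π) (ξ π))))
    where
    γ : ℚ
    γ = g (app π i)
    lem = solve 3 (λ m a u → :# 8 :* (m :² :* (a :²) :+ u :²) :- :# 4 :* ((m :* a :+ u) :²) := :# 4 :* ((m :* a :- u) :²)) refl
    eq : N * toℚ (f π) - γ ≡ N * (toℚ (f π) - ℓ π) + ξ π
    eq = trans (lem₂ (N * toℚ (f π)) γ (ξ π)) (trans (cong (λ t → N * toℚ (f π) - t + ξ π) (sym (ξ-split π))) (lem₃ N (toℚ (f π)) (ℓ π) (ξ π)))
      where
      lem₂ = solve 3 (λ a g u → a :- g := a :- (u :+ g) :+ u) refl
      lem₃ = solve 4 (λ m x l u → m :* x :- m :* l :+ u := m :* (x :- l) :+ u) refl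
    agree : ∀ b → N * N * 0ℚ ≤ # 4 * sq (N * toℚ b - γ)
    agree b = subst (_≤ # 4 * sq (N * toℚ b - γ)) (sym (ℚₚ.*-zeroʳ (N * N))) (0≤# 4 ⊛ 0≤sq (N * toℚ b - γ))
    go : ∀ b (d : Dec (N ≤ # 2 * γ)) → N * N * toℚ (not ⌊ toℚ b ℚ≟ toℚ ⌊ d ⌋ ⌋) ≤ # 4 * sq (N * toℚ b - γ)
    go true  (yes _) = agree true
    go false (no _)  = agree false
    go true  (no ¬p) = by-difference (to0 (≰⇒≥ ¬p) ⊛ (to0 (≰⇒≥ ¬p) ⊕ 0≤# 2 ⊛ 0≤N)) (lem₂ N γ)
      where
      lem₂ = solve 2 (λ m g → :# 4 :* ((m :* :# 1 :- g) :²) :- m :² :* :# 1 := (m :- :# 2 :* g) :* (m :- :# 2 :* g :+ :# 2 :* m)) refl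
    go false (yes p) = by-difference (to0 p ⊛ (to0 p ⊕ 0≤# 2 ⊛ 0≤N)) (lem₂ N γ)
      where
      lem₂ = solve 2 (λ m g → :# 4 :* ((m :* :# 0 :- g) :²) :- m :² :* :# 1 := (:# 2 :* g :- m) :* (:# 2 :* g :- m :+ :# 2 :* m)) refl

  -- By the Poincaré identity for the rows other than i, E(ξ²) is the weight avoiding row i divided
  -- by 4n. A weight O(n³ε/δ) therefore gives E(ξ²) = O(n²ε/δ), and the n² is cancelled by the N² of
  -- `disagreement≤`.
  rounded : ∀ {δ} κ → # 4 ≤ # n → 0ℚ ≤ δ → δ ≤ 1ℚ → 0ℚ ≤ κ → ∑⁴ (weight i) * δ ≤ κ * (#[ n ]² * # n) * ε → NearDictator f ε δ (# 8 + # 8 * κ)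
  rounded {δ} κ 4≤n 0≤δ δ≤1 0≤κ light = nearDictator (rowSet i J) (rowSet-dictator i J) (subst (λ t → t * δ ≤ (# 8 + # 8 * κ) * ε) (sym Pr≡) final)
    where
    Pr≡ : PrNeq n (λ π → toℚ (f π)) (sumOver (rowSet i J)) ≡ E disagreement
    Pr≡ = trans (PrNeq≡ _ _) (E-cong (λ π → cong (λ t → toℚ (not ⌊ toℚ (f π) ℚ≟ t ⌋)) (sumOver-rowSet i J π)))
    Ξ A : ℚ
    Ξ = E (λ π → sq (ξ π))
    A = ∑⁴ (weight i)
    n≤2N : # n ≤ # 2 * N
    n≤2N = by-difference (0≤# 2 ⊛ to0 (n-2≤N i i) ⊕ to0 4≤n) (lem (# n) N)
      where
      lem = solve 2 (λ n m → :# 2 :* m :- n := :# 2 :* (m :- (n :- :# 2)) :+ (n :- :# 4)) refl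
    energy : # n * (# n - 1ℚ) * (# 4 * Ξ) ≡ N * A
    energy = begin
      # n * (# n - 1ℚ) * (# 4 * Ξ)      ≡⟨ cong (# n * (# n - 1ℚ) *_) (E-Q-ξ (others i i) (0<N i i)) ⟨
      # n * (# n - 1ℚ) * (N * E Q)      ≡⟨ lem (# n * (# n - 1ℚ)) N (E Q) ⟩
      N * (# n * (# n - 1ℚ) * E Q)      ≡⟨ cong (N *_) (trans (E-Q (others i i)) (∑⁴-cong (λ k l a b → cong₂ (λ p q → p * q * sq (D k l a b)) (r≡ne k) (r≡ne l)))) ⟩
      N * A ∎
      where
      open ≡-Reasoning
      lem = solve 3 (λ a b t → a :* (b :* t) := b :* (a :* t)) refl
    Ξ-bound : Ξ * δ ≤ N * N * κ * ε
    Ξ-bound = *-cancelˡ (# 4 * # n * # n) (0<* (0<* (0<#suc 3) 0<n) 0<n) (begin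
      # 4 * # n * # n * (Ξ * δ)
        ≤⟨ by-difference (to0 n≤2n-2 ⊛ (0≤# n ⊛ (0≤# 4 ⊛ (E-nonneg (λ π → 0≤sq (ξ π)) ⊛ 0≤δ)))) (lem₁ (# n) Ξ δ) ⟩
      # 2 * (# n * (# n - 1ℚ) * (# 4 * Ξ)) * δ
        ≡⟨ trans (cong (λ t → # 2 * t * δ) energy) (lem₂ N A δ) ⟩
      # 2 * N * (A * δ)
        ≤⟨ *-monoˡ (0≤# 2 ⊛ 0≤N) light ⟩
      # 2 * N * (κ * (#[ n ]² * # n) * ε)
        ≤⟨ by-difference (0≤# 2 ⊛ 0≤N ⊛ 0≤κ ⊛ 0≤sq (# n) ⊛ 0≤ε ⊛ to0 n≤2N) (lem₃ (# n) N κ ε) ⟩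
      # 4 * # n * # n * (N * N * κ * ε) ∎)
      where
      open ℚₚ.≤-Reasoning
      lem₁ = solve 3 (λ n x d → :# 2 :* (n :* (n :- :# 1) :* (:# 4 :* x)) :* d :- :# 4 :* n :* n :* (x :* d) :=
        (:# 2 :* (n :- :# 1) :- n) :* (n :* (:# 4 :* (x :* d)))) refl
      lem₂ = solve 3 (λ m a d → :# 2 :* (m :* a) :* d := :# 2 :* m :* (a :* d)) refl
      lem₃ = solve 4 (λ n m k e → :# 4 :* n :* n :* (m :² :* k :* e) :- :# 2 :* m :* (k :* (n :² :* n) :* e) :=
        :# 2 :* m :* k :* (n :²) :* e :* (:# 2 :* m :- n)) refl
    final : E disagreement * δ ≤ (# 8 + # 8 * κ) * ε
    final = *-cancelˡ (N * N) (0<* (0<N i i) (0<N i i)) (begin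
      N * N * (E disagreement * δ)
        ≡⟨ trans (sym (ℚₚ.*-assoc (N * N) (E disagreement) δ)) (cong (_* δ) (sym (E-*ˡ (N * N) disagreement))) ⟩
      E (λ π → N * N * disagreement π) * δ
        ≤⟨ *-mono (E-nonneg (λ π → 0≤N ⊛ 0≤N ⊛ 0≤toℚ (not ⌊ toℚ (f π) ℚ≟ toℚ (J (app π i)) ⌋))) 0≤δ (E-mono disagreement≤) ℚₚ.≤-refl ⟩
      E (λ π → # 8 * (N * N * e π + sq (ξ π))) * δ
        ≡⟨ cong (_* δ) (trans (E-*ˡ (# 8) _) (cong (# 8 *_) (trans (E-+ _ _) (cong (_+ Ξ) (E-*ˡ (N * N) e))))) ⟩
      # 8 * (N * N * E e + Ξ) * δ
        ≤⟨ by-difference (0≤# 8 ⊛ (0≤N ⊛ 0≤N) ⊛ (to0 close ⊛ 0≤δ ⊕ 0≤ε ⊛ to0 δ≤1) ⊕ 0≤# 8 ⊛ to0 Ξ-bound) (lem N (E e) Ξ δ κ ε) ⟩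
      N * N * ((# 8 + # 8 * κ) * ε) ∎)
      where
      open ℚₚ.≤-Reasoning
      0≤toℚ : ∀ b → 0ℚ ≤ toℚ b
      0≤toℚ true  = 0≤1
      0≤toℚ false = ℚₚ.≤-refl
      lem = solve 6 (λ m x y d k e → m :² :* ((:# 8 :+ :# 8 :* k) :* e) :- :# 8 :* (m :² :* x :+ y) :* d :=
        :# 8 :* (m :²) :* ((e :- x) :* d :+ e :* (:# 1 :- d)) :+ :# 8 :* (m :² :* k :* e :- y :* d)) refl

-- Exchanging rows and columns

module Transpose {n : ℕ} (c : Fin n → Fin n → ℚ) (f : Perm n → Bool) where

  cᵀ : Fin n → Fin n → ℚ
  cᵀ i j = c j i

  f⁻¹ : Perm n → Bool
  f⁻¹ π = f (π ⁻¹)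

  ℓᵀ : ∀ π → Linear.ℓ cᵀ π ≡ Linear.ℓ c (π ⁻¹)
  ℓᵀ π = trans (sym (∑-permute (π ⁻¹) (λ i → c (app π i) i))) (∑-cong (λ j → cong (λ t → c t (app (π ⁻¹) j)) (app-⁻¹ʳ π j)))

  Dᵀ : ∀ i k a b → Linear.D cᵀ i k a b ≡ Linear.D c a b i k
  Dᵀ i k a b = lem (c a i) (c b k) (c b i) (c a k)
    where
    lem = solve 4 (λ p q r s → p :+ q :- r :- s := p :+ q :- s :- r) refl

  closeᵀ : E (λ π → sq (toℚ (f⁻¹ π) - Linear.ℓ cᵀ π)) ≡ E (λ π → sq (toℚ (f π) - Linear.ℓ c π))
  closeᵀ = trans (E-cong (λ π → cong (λ t → sq (toℚ (f⁻¹ π) - t)) (ℓᵀ π))) (E-inverse (λ π → sq (toℚ (f π) - Linear.ℓ c π)))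

  untranspose : ∀ {ε δ K′} → NearDictator f⁻¹ ε δ K′ → NearDictator f ε δ K′
  untranspose {ε} {δ} {K′} (nearDictator 𝒞 dictator bound) = nearDictator (λ i j → 𝒞 j i) (flip dictator) (subst (λ t → t * δ ≤ K′ * ε) Pr≡ bound)
    where
    flip : IsDictatorSet 𝒞 → IsDictatorSet (λ i j → 𝒞 j i)
    flip (inj₁ (i₀ , p)) = inj₂ (i₀ , λ i j → p j i)
    flip (inj₂ (j₀ , p)) = inj₁ (j₀ , λ i j → p j i)
    sumOverᵀ : ∀ π → sumOver 𝒞 (π ⁻¹) ≡ sumOver (λ i j → 𝒞 j i) π
    sumOverᵀ π = trans (sumOver≡ 𝒞 (π ⁻¹)) (trans (sym (∑-permute π (λ i → toℚ (𝒞 i (app (π ⁻¹) i)))))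
      (trans (∑-cong (λ i → cong (λ t → toℚ (𝒞 (app π i) t)) (app-⁻¹ˡ π i))) (sym (sumOver≡ (λ i j → 𝒞 j i) π))))
    h : Perm n → ℚ
    h π = toℚ (not ⌊ toℚ (f⁻¹ π) ℚ≟ sumOver 𝒞 π ⌋)
    Pr≡ : PrNeq n (λ π → toℚ (f⁻¹ π)) (sumOver 𝒞) ≡ PrNeq n (λ π → toℚ (f π)) (sumOver (λ i j → 𝒞 j i))
    Pr≡ = trans (PrNeq≡ _ _) (trans (sym (E-inverse h)) (trans
      (E-cong (λ π → cong₂ (λ ρ t → toℚ (not ⌊ toℚ (f ρ) ℚ≟ t ⌋)) (⁻¹-involutive π) (sumOverᵀ π))) (sym (PrNeq≡ _ _))))

-- The sparse case

-- One factor of the inequality ∏(1 - tᵢ) ≥ 1 - ∑tᵢ. Iterated, it is the union bound over the ways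
-- in which two rectangles can share a line.
union-step : ∀ {n} {s u} (a b : Fin n) → 0ℚ ≤ s → 1ℚ - s ≤ u → 1ℚ - (s + ⟦ a ≟ b ⟧) ≤ u * ne a b
union-step {s = s} {u} a b 0≤s h = by-difference (to0 h ⊛ 0≤ne a b ⊕ 0≤s ⊛ 0≤⟦⟧ (a ≟ b)) (lem s u ⟦ a ≟ b ⟧)
  where
  lem = solve 3 (λ s u t → u :* (:# 1 :- t) :- (:# 1 :- (s :+ t)) := (u :- (:# 1 :- s)) :* (:# 1 :- t) :+ s :* t) refl

∑-onceʳ : ∀ {n} (i : Fin n) → ∑ (λ j → ⟦ j ≟ i ⟧) ≡ 1ℚ
∑-onceʳ {n} i = trans (∑-cong (λ j → ⟦⟧-⇔ (j ≟ i) (i ≟ j) sym sym)) (∑-once i)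

∑-constant : ∀ {n k} {F : Fin n → ℚ} → (∀ i → F i ≡ k) → ∑ F ≡ # n * k
∑-constant {n} {k} p = trans (∑-cong p) (∑-const n k)

module _ {n : ℕ} where

  private
    n³ : ℚ
    n³ = # n * (# n * (# n * 1ℚ))

  ∑⁴-once₁ : ∀ {F : Fin n → ℚ} → ∑ F ≡ 1ℚ → ∑⁴ {n} (λ a _ _ _ → F a) ≡ n³
  ∑⁴-once₁ {F} p = trans (∑-cong (λ a → trans (∑-constant {n} (λ _ → ∑-constant {n} (λ _ → ∑-const n (F a)))) (lem (# n) (F a))))
    (trans (sum-*ˡ (# n * (# n * # n)) F (allFin n)) (trans (cong (# n * (# n * # n) *_) p) (lem₂ (# n))))
    where
    lem = solve 2 (λ n f → n :* (n :* (n :* f)) := n :* (n :²) :* f) refl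
    lem₂ = solve 1 (λ n → n :* (n :²) :* :# 1 := n :* (n :* (n :* :# 1))) refl

  ∑⁴-once₂ : ∀ {F : Fin n → ℚ} → ∑ F ≡ 1ℚ → ∑⁴ {n} (λ _ b _ _ → F b) ≡ n³
  ∑⁴-once₂ {F} p = ∑-constant {n} (λ _ → trans (∑-cong (λ b → trans (∑-constant {n} (λ _ → ∑-const n (F b))) (lem (# n) (F b))))
    (trans (sum-*ˡ (# n * # n) F (allFin n)) (trans (cong (# n * # n *_) p) (lem₂ (# n)))))
    where
    lem = solve 2 (λ n f → n :* (n :* f) := n :² :* f) refl
    lem₂ = solve 1 (λ n → n :² :* :# 1 := n :* (n :* :# 1)) refl

  ∑⁴-once₃ : ∀ {F : Fin n → Fin n → Fin n → ℚ} → (∀ a b → ∑ (F a b) ≡ 1ℚ) → ∑⁴ {n} (λ a b c _ → F a b c) ≡ n³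
  ∑⁴-once₃ {F} p = ∑-constant {n} (λ a → ∑-constant {n} (λ b → trans (∑-cong (λ c → ∑-const n (F a b c)))
    (trans (sum-*ˡ (# n) (F a b) (allFin n)) (cong (# n *_) (p a b)))))

  ∑⁴-once₄ : ∀ {F : Fin n → Fin n → Fin n → Fin n → ℚ} → (∀ a b c → ∑ (F a b c) ≡ 1ℚ) → ∑⁴ F ≡ n³
  ∑⁴-once₄ p = ∑-constant {n} (λ a → ∑-constant {n} (λ b → ∑-constant {n} (p a b)))

  ∑⁴-+ : ∀ (F G : Fin n → Fin n → Fin n → Fin n → ℚ) → ∑⁴ (λ a b c d → F a b c d + G a b c d) ≡ ∑⁴ F + ∑⁴ G
  ∑⁴-+ F G = trans (∑∑-cong (λ a b → ∑∑-+ (F a b) (G a b))) (∑∑-+ (λ a b → ∑ (λ c → ∑ (F a b c))) (λ a b → ∑ (λ c → ∑ (G a b c))))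

  ∑⁴-- : ∀ (F G : Fin n → Fin n → Fin n → Fin n → ℚ) → ∑⁴ (λ a b c d → F a b c d - G a b c d) ≡ ∑⁴ F - ∑⁴ G
  ∑⁴-- F G = trans (∑∑-cong (λ a b → ∑∑-- (F a b) (G a b))) (∑∑-- (λ a b → ∑ (λ c → ∑ (F a b c))) (λ a b → ∑ (λ c → ∑ (G a b c))))

  ∑⁴-product : ∀ (F G : Fin n → Fin n → ℚ) → ∑⁴ (λ a b c d → F a b * G c d) ≡ ∑ (λ a → ∑ (F a)) * ∑ (λ c → ∑ (G c))
  ∑⁴-product F G = trans (∑∑-cong (λ a b → ∑∑-*ˡ (F a b) G))
    (trans (∑-cong (λ a → sum-*ʳ (∑ (λ c → ∑ (G c))) (F a) (allFin n))) (sum-*ʳ (∑ (λ c → ∑ (G c))) (λ a → ∑ (F a)) (allFin n)))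

one-of-four : ∀ {P Q R S : Set} (p : Dec P) (q : Dec Q) (r : Dec R) (s : Dec S) → (¬ P → ¬ Q → ¬ R → ¬ S → ⊥) →
              1ℚ ≤ ⟦ p ⟧ + ⟦ q ⟧ + (⟦ r ⟧ + ⟦ s ⟧)
one-of-four (yes _) q r s _ = by-difference (0≤⟦⟧ q ⊕ (0≤⟦⟧ r ⊕ 0≤⟦⟧ s)) (lem ⟦ q ⟧ (⟦ r ⟧ + ⟦ s ⟧))
  where
  lem = solve 2 (λ q t → :# 1 :+ q :+ t :- :# 1 := q :+ t) refl
one-of-four (no _) (yes _) r s _ = by-difference (0≤⟦⟧ r ⊕ 0≤⟦⟧ s) (lem (⟦ r ⟧ + ⟦ s ⟧))
  where
  lem = solve 1 (λ t → :# 0 :+ :# 1 :+ t :- :# 1 := t) refl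
one-of-four (no _) (no _) (yes _) s _ = by-difference (0≤⟦⟧ s) (lem ⟦ s ⟧)
  where
  lem = solve 1 (λ t → :# 0 :+ :# 0 :+ (:# 1 :+ t) :- :# 1 := t) refl
one-of-four (no _)  (no _)  (no _)  (yes _) _ = ℚₚ.≤-refl
one-of-four (no ¬p) (no ¬q) (no ¬r) (no ¬s) h = ⊥-elim (h ¬p ¬q ¬r ¬s)

module Sparse {n : ℕ} (c : Fin n → Fin n → ℚ) (f : Perm n → Bool) (ε : ℚ)
  (close : E (λ π → sq (toℚ (f π) - Linear.ℓ c π)) ≤ ε) (2<n : # 2 < # n)
  (192≤n : # 192 ≤ # n) (tiny : # 65536 * #[ n ]² * ε ≤ 1ℚ) where

  open Energy c f ε close 2<n public

  0≤n² : 0ℚ ≤ #[ n ]²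
  0≤n² = 0≤sq (# n)

  -- The permutations with i ↦ a and k ↦ b have mass 1/(n(n - 1)), so the mean error bounds the
  -- error on this class alone at the cost of a factor n². As n²ε is tiny here, single rectangles
  -- are controlled and not only averages.
  D²≤ : ∀ i k a b → sq (D i k a b) ≤ # 2 * β (D i k a b) + # 8 * #[ n ]² * ε
  D²≤ i k a b = go (i ≟ k) (a ≟ b)
    where
    rhs : ℚ
    rhs = # 2 * β (D i k a b) + # 8 * #[ n ]² * ε
    0≤rhs : 0ℚ ≤ rhs
    0≤rhs = 0≤# 2 ⊛ 0≤β (D i k a b) ⊕ 0≤# 8 ⊛ 0≤n² ⊛ 0≤ε
    go : Dec (i ≡ k) → Dec (a ≡ b) → sq (D i k a b) ≤ rhs
    go (yes refl) _          = subst (λ t → sq t ≤ rhs) (sym (D-row-diag i a b)) 0≤rhs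
    go _          (yes refl) = subst (λ t → sq t ≤ rhs) (sym (D-col-diag i k a)) 0≤rhs
    go (no i≢k)   (no a≢b)   = ℚₚ.≤-trans from-class (by-difference (0≤# 8 ⊛ 0≤# n ⊛ 0≤ε) (lem₂ (# n) (β (D i k a b)) ε))
      where
      M : ℚ
      M = # n * (# n - 1ℚ)
      lem₂ = solve 3 (λ n b e → :# 2 :* b :+ :# 8 :* (n :²) :* e :- (:# 2 :* b :+ :# 8 :* (n :* (n :- :# 1)) :* e) := :# 8 :* n :* e) refl
      class : Fin n → Fin n → ℚ
      class a′ b′ = ⟦ a ≟ a′ ⟧ * ⟦ b ≟ b′ ⟧
      class-diag : ∀ a′ → class a′ a′ ≡ 0ℚ
      class-diag a′ = both (a ≟ a′) (b ≟ a′)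
        where
        both : (d : Dec (a ≡ a′)) (d′ : Dec (b ≡ a′)) → ⟦ d ⟧ * ⟦ d′ ⟧ ≡ 0ℚ
        both (yes p) (yes q) = contradiction (trans p (sym q)) a≢b
        both (yes _) (no _)  = refl
        both (no _)  (yes _) = refl
        both (no _)  (no _)  = refl
      class-mass : M * E (λ π → class (app π i) (app π k)) ≡ 1ℚ
      class-mass = trans (E-pair class class-diag i≢k) (trans (∑∑-product (λ a′ → ⟦ a ≟ a′ ⟧) (λ b′ → ⟦ b ≟ b′ ⟧)) (cong₂ _*_ (∑-once a) (∑-once b)))
      u : ℚ
      u = sq (D i k a b) - # 2 * β (D i k a b)
      pointwise : ∀ π → class (app π i) (app π k) * u ≤ # 4 * (e π + e (π ∙ τ i k))
      pointwise π = at (a ≟ app π i) (b ≟ app π k)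
        where
        0≤rest : 0ℚ ≤ # 4 * (e π + e (π ∙ τ i k))
        0≤rest = 0≤# 4 ⊛ (0≤e π ⊕ 0≤e (π ∙ τ i k))
        bound : sq (ℓ π - ℓ (π ∙ τ i k)) ≤ # 2 * β (ℓ π - ℓ (π ∙ τ i k)) + # 4 * (e π + e (π ∙ τ i k))
        bound = sq-difference-bound (f π) (f (π ∙ τ i k)) (ℓ π) (ℓ (π ∙ τ i k))
        vanish : ∀ p → p ≡ 0ℚ → p * u ≤ # 4 * (e π + e (π ∙ τ i k))
        vanish p eq = subst (_≤ # 4 * (e π + e (π ∙ τ i k))) (sym (trans (cong (_* u) eq) (ℚₚ.*-zeroˡ u))) 0≤rest
        lem₃ = solve 3 (λ d b r → :# 2 :* b :+ r :- d := r :- :# 1 :* :# 1 :* (d :- :# 2 :* b)) refl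
        at : (d : Dec (a ≡ app π i)) (d′ : Dec (b ≡ app π k)) → ⟦ d ⟧ * ⟦ d′ ⟧ * u ≤ # 4 * (e π + e (π ∙ τ i k))
        at (no _)  d′      = vanish (0ℚ * ⟦ d′ ⟧) (ℚₚ.*-zeroˡ ⟦ d′ ⟧)
        at (yes _) (no _)  = vanish (1ℚ * 0ℚ) refl
        at (yes p) (yes q) = from0 (subst (0ℚ ≤_) (lem₃ (sq (D i k a b)) (β (D i k a b)) (# 4 * (e π + e (π ∙ τ i k))))
          (to0 (subst (λ t → sq t ≤ # 2 * β t + # 4 * (e π + e (π ∙ τ i k)))
            (trans (ℓ-τ i k π) (cong₂ (D i k) (sym p) (sym q))) bound)))
      u≤ : u ≤ M * (# 8 * ε)
      u≤ = begin
        u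
          ≡⟨ trans (sym (ℚₚ.*-identityʳ u)) (trans (cong (u *_) (sym class-mass)) (lem₄ u M (E (λ π → class (app π i) (app π k))))) ⟩
        M * (u * E (λ π → class (app π i) (app π k)))
          ≡⟨ cong (M *_) (trans (sym (E-*ˡ u _)) (E-cong (λ π → ℚₚ.*-comm u (class (app π i) (app π k))))) ⟩
        M * E (λ π → class (app π i) (app π k) * u)
          ≤⟨ *-monoˡ (0≤# n ⊛ 0≤n-1) (E-mono pointwise) ⟩
        M * E (λ π → # 4 * (e π + e (π ∙ τ i k)))
          ≡⟨ cong (M *_) (trans (E-*ˡ (# 4) _) (cong (# 4 *_) (E-+ e (λ π → e (π ∙ τ i k))))) ⟩
        M * (# 4 * (E e + E (λ π → e (π ∙ τ i k))))
          ≤⟨ *-monoˡ (0≤# n ⊛ 0≤n-1) (*-monoˡ (0≤# 4) (ℚₚ.+-mono-≤ close (E-e (τ i k)))) ⟩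
        M * (# 4 * (ε + ε))
          ≡⟨ cong (M *_) (lem₅ ε) ⟩
        M * (# 8 * ε) ∎
        where
        open ℚₚ.≤-Reasoning
        lem₄ = solve 3 (λ u m x → u :* (m :* x) := m :* (u :* x)) refl
        lem₅ = solve 1 (λ x → :# 4 :* (x :+ x) := :# 8 :* x) refl
      from-class : sq (D i k a b) ≤ # 2 * β (D i k a b) + # 8 * M * ε
      from-class = from0 (subst (0ℚ ≤_) (lem₆ (sq (D i k a b)) (β (D i k a b)) M ε) (to0 u≤))
        where
        lem₆ = solve 4 (λ d b m e → m :* (:# 8 :* e) :- (d :- :# 2 :* b) := :# 2 :* b :+ :# 8 :* m :* e :- d) refl

  -- A rectangle is the signed sum of the four rectangles obtained by inserting a row m and a column h.
  corner-cover : ∀ k l a b → ¼ ≤ sq (D k l a b) → ∀ m h → 1ℚ ≤ β (D k m a h) + β (D k m b h) + (β (D l m a h) + β (D l m b h))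
  corner-cover k l a b big m h = one-of-four (¼ ≤? sq x₁) (¼ ≤? sq x₂) (¼ ≤? sq x₃) (¼ ≤? sq x₄)
    (λ p₁ p₂ p₃ p₄ → ≤⇒¬< (ℚₚ.≤-trans big (all-small (small x₁ p₁ (D²≤ k m a h)) (small x₂ p₂ (D²≤ k m b h)) (small x₃ p₃ (D²≤ l m a h)) (small x₄ p₄ (D²≤ l m b h))))
      (toWitness {a? = (+ 1 / 16) <? ¼} tt))
    where
    x₁ x₂ x₃ x₄ t : ℚ
    x₁ = D k m a h
    x₂ = D k m b h
    x₃ = D l m a h
    x₄ = D l m b h
    t = #[ n ]² * ε
    small : ∀ y → ¬ (¼ ≤ sq y) → sq y ≤ # 2 * β y + # 8 * #[ n ]² * ε → sq y ≤ # 8 * t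
    small y ¬p h₂ = subst (sq y ≤_) (trans (cong (λ z → # 2 * z + # 8 * #[ n ]² * ε) (⟦⟧-no (¼ ≤? sq y) ¬p)) (lem #[ n ]² ε)) h₂
      where
      lem = solve 2 (λ m e → :# 2 :* :# 0 :+ :# 8 :* m :* e := :# 8 :* (m :* e)) refl
    -- (x₁ - x₂ - x₃ + x₄)² ≤ 4·4·8n²ε = 128n²ε ≤ 1/512, well below 1/16 < ¼.
    all-small : sq x₁ ≤ # 8 * t → sq x₂ ≤ # 8 * t → sq x₃ ≤ # 8 * t → sq x₄ ≤ # 8 * t → sq (D k l a b) ≤ + 1 / 16
    all-small h₁ h₂ h₃ h₄ = subst (λ z → sq z ≤ + 1 / 16) (sym split)
      (by-difference (0≤sq (x₁ + x₂) ⊕ 0≤sq (x₁ + x₃) ⊕ 0≤sq (x₁ - x₄) ⊕ 0≤sq (x₂ - x₃) ⊕ 0≤sq (x₂ + x₄) ⊕ 0≤sq (x₃ + x₄)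
          ⊕ 0≤# 4 ⊛ (to0 h₁ ⊕ to0 h₂ ⊕ to0 h₃ ⊕ to0 h₄) ⊕ ℚₚ.nonNegative⁻¹ (+ 1 / 512) ⊛ to0 tiny ⊕ ℚₚ.nonNegative⁻¹ (+ 31 / 512))
        (lem x₁ x₂ x₃ x₄ #[ n ]² ε))
      where
      lem = solve 6 (λ p q r s m e → con (+ 1 / 16) :- (p :- q :- r :+ s) :² :=
        (p :+ q) :² :+ (p :+ r) :² :+ (p :- s) :² :+ (q :- r) :² :+ (q :+ s) :² :+ (r :+ s) :² :+ :# 4 :* ((:# 8 :* (m :* e) :- p :²) :+ (:# 8
        :* (m :* e) :- q :²) :+ (:# 8 :* (m :* e) :- r :²) :+ (:# 8 :* (m :* e) :- s :²)) :+ con (+ 1 / 512) :* (:# 1 :- :# 65536 :* m :* e)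
        :+ con (+ 31 / 512)) refl
      split : D k l a b ≡ x₁ - x₂ - x₃ + x₄
      split = lem₂ (c k a) (c k b) (c k h) (c l a) (c l b) (c l h) (c m a) (c m b) (c m h)
        where
        lem₂ = solve 9 (λ ka kb kh la lb lh ma mb mh → ka :+ lb :- kb :- la :=
          (ka :+ mh :- kh :- ma) :- (kb :+ mh :- kh :- mb) :- (la :+ mh :- lh :- ma) :+ (lb :+ mh :- lh :- mb)) refl

  corner : Fin n → Fin n → ℚ
  corner i j = ∑ (λ m → ∑ (λ h → β (D i m j h)))

  0≤corner : ∀ i j → 0ℚ ≤ corner i j
  0≤corner i j = ∑∑-nonneg (λ m h → 0≤β (D i m j h))

  -- A quarter of the n² rectangles at the corner (i, j): the share that one of four corners must
  -- have once `corner-cover` is summed over m and h.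
  Heavy : Fin n → Fin n → Set
  Heavy i j = #[ n ]² ≤ # 4 * corner i j

  heavy? : ∀ i j → Dec (Heavy i j)
  heavy? i j = #[ n ]² ≤? # 4 * corner i j

  corners-heavy : ∀ k l a b → ¼ ≤ sq (D k l a b) → ¬ Heavy k a → ¬ Heavy k b → ¬ Heavy l a → ¬ Heavy l b → ⊥
  corners-heavy k l a b big ¬ka ¬kb ¬la ¬lb = ≤⇒¬< total strict
    where
    total : #[ n ]² ≤ corner k a + corner k b + (corner l a + corner l b)
    total = subst₂ _≤_ (trans (∑-constant {n} (λ _ → ∑-const n 1ℚ)) (lem (# n)))
      (trans (∑∑-+ (λ m h → β (D k m a h) + β (D k m b h)) (λ m h → β (D l m a h) + β (D l m b h)))
        (cong₂ _+_ (∑∑-+ (λ m h → β (D k m a h)) (λ m h → β (D k m b h))) (∑∑-+ (λ m h → β (D l m a h)) (λ m h → β (D l m b h)))))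
      (∑∑-mono (corner-cover k l a b big))
      where
      lem = solve 1 (λ n → n :* (n :* :# 1) := n :²) refl
    strict : corner k a + corner k b + (corner l a + corner l b) < #[ n ]²
    strict = ℚₚ.*-cancelˡ-<-nonNeg (# 4) {{nonNegative (0≤# 4)}} (subst₂ _<_ (lem₁ (corner k a) (corner k b) (corner l a) (corner l b)) (lem₂ #[ n ]²)
      (ℚₚ.+-mono-< (ℚₚ.+-mono-< (ℚₚ.≰⇒> ¬ka) (ℚₚ.≰⇒> ¬kb)) (ℚₚ.+-mono-< (ℚₚ.≰⇒> ¬la) (ℚₚ.≰⇒> ¬lb))))
      where
      lem₁ = solve 4 (λ p q r s → :# 4 :* p :+ :# 4 :* q :+ (:# 4 :* r :+ :# 4 :* s) := :# 4 :* (p :+ q :+ (r :+ s))) refl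
      lem₂ = solve 1 (λ m → m :+ m :+ (m :+ m) := :# 4 :* m) refl

  -- Two heavy corners off a common line would give at least n⁴/16 pairs of rectangles with |D| ≥ ½,
  -- one at each corner, nearly all of them disjoint. But `row-inequality` allows only O(n⁶ε)
  -- disjoint pairs, and n²ε is tiny.
  heavy-collinear : ∀ {i j k b} → Heavy i j → Heavy k b → k ≢ i → j ≢ b → ⊥
  heavy-collinear {i} {j} {k} {b} ij kb k≢i j≢b = ≤⇒¬< impossible 0<
    where
    n³ : ℚ
    n³ = # n * (# n * (# n * 1ℚ))
    u v : Fin n → Fin n → ℚ
    u l d = β (D k l b d)
    v m h = β (D i m j h)
    -- The ways in which (k, l; b, d) and (i, m; j, h) can share a line, apart from k = i and b = j,
    -- which are excluded by assumption.
    bad : (l d m h : Fin n) → ℚ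
    bad l d m h = ⟦ l ≟ i ⟧ + ⟦ k ≟ m ⟧ + ⟦ l ≟ m ⟧ + ⟦ j ≟ d ⟧ + ⟦ h ≟ b ⟧ + ⟦ h ≟ d ⟧
    good : (l d m h : Fin n) → ℚ
    good l d m h = ne l i * ne k m * ne l m * ne j d * ne h b * ne h d
    union : ∀ l d m h → 1ℚ - bad l d m h ≤ good l d m h
    union l d m h =
      union-step h d (0≤⟦⟧ (l ≟ i) ⊕ 0≤⟦⟧ (k ≟ m) ⊕ 0≤⟦⟧ (l ≟ m) ⊕ 0≤⟦⟧ (j ≟ d) ⊕ 0≤⟦⟧ (h ≟ b))
      (union-step h b (0≤⟦⟧ (l ≟ i) ⊕ 0≤⟦⟧ (k ≟ m) ⊕ 0≤⟦⟧ (l ≟ m) ⊕ 0≤⟦⟧ (j ≟ d))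
      (union-step j d (0≤⟦⟧ (l ≟ i) ⊕ 0≤⟦⟧ (k ≟ m) ⊕ 0≤⟦⟧ (l ≟ m))
      (union-step l m (0≤⟦⟧ (l ≟ i) ⊕ 0≤⟦⟧ (k ≟ m))
      (union-step k m (0≤⟦⟧ (l ≟ i)) (ℚₚ.≤-refl {ne l i})))))
    ∑⁴-bad : ∑⁴ bad ≡ # 6 * n³
    ∑⁴-bad = trans (∑⁴-+ _ _) (trans (cong₂ _+_ (trans (∑⁴-+ _ _) (cong₂ _+_ (trans (∑⁴-+ _ _) (cong₂ _+_ (trans (∑⁴-+ _ _) (cong₂ _+_
      (trans (∑⁴-+ _ _) (cong₂ _+_ (∑⁴-once₁ (∑-onceʳ i)) (∑⁴-once₃ (λ _ _ → ∑-once k)))) (∑⁴-once₃ (λ l _ → ∑-once l))))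
      (∑⁴-once₂ (∑-once j)))) (∑⁴-once₄ (λ _ _ _ → ∑-onceʳ b)))) (∑⁴-once₄ (λ _ d _ → ∑-onceʳ d))) (lem n³))
      where
      lem = solve 1 (λ t → t :+ t :+ t :+ t :+ t :+ t := :# 6 :* t) refl
    pointwise : ∀ l d m h → u l d * v m h - bad l d m h ≤ # 4 * (weight i k l b d * cross i k l b d m j h)
    pointwise l d m h = ℚₚ.≤-trans
      (by-difference (0≤bad ⊛ to0 uv≤1 ⊕ (0≤β (D k l b d) ⊛ 0≤β (D i m j h)) ⊛ to0 (union l d m h)) (lem₁ (u l d) (v m h) (bad l d m h) (good l d m h)))
      (by-difference (0≤good ⊛ (0≤β (D i m j h) ⊛ to0 (β≤4sq (D k l b d))))
        (trans (cong₂ (λ p q → # 4 * (p * ne l i * sq (D k l b d) * (ne k m * ne l m * (q * ne j d * (ne h b * ne h d)) * v m h)) - good l d m h * (u l d * v m h))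
          (ne-yes k≢i) (ne-yes j≢b)) (lem₂ (ne l i) (ne k m) (ne l m) (ne j d) (ne h b) (ne h d) (sq (D k l b d)) (u l d) (v m h))))
      where
      0≤bad : 0ℚ ≤ bad l d m h
      0≤bad = 0≤⟦⟧ (l ≟ i) ⊕ 0≤⟦⟧ (k ≟ m) ⊕ 0≤⟦⟧ (l ≟ m) ⊕ 0≤⟦⟧ (j ≟ d) ⊕ 0≤⟦⟧ (h ≟ b) ⊕ 0≤⟦⟧ (h ≟ d)
      0≤good : 0ℚ ≤ good l d m h
      0≤good = 0≤ne l i ⊛ 0≤ne k m ⊛ 0≤ne l m ⊛ 0≤ne j d ⊛ 0≤ne h b ⊛ 0≤ne h d
      uv≤1 : u l d * v m h ≤ 1ℚ
      uv≤1 = *-mono (0≤β (D k l b d)) 0≤1 (β≤1 (D k l b d)) (β≤1 (D i m j h))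
      lem₁ = solve 4 (λ u v b g → g :* (u :* v) :- (u :* v :- b) := b :* (:# 1 :- u :* v) :+ u :* v :* (g :- (:# 1 :- b))) refl
      lem₂ = solve 9 (λ li km lm jd hb hd s u v → :# 4 :* (:# 1 :* li :* s :* (km :* lm :* (:# 1 :* jd :* (hb :* hd)) :* v)) :- (li :* km :* lm :* jd :* hb :* hd) :* (u :* v) :=
        (li :* km :* lm :* jd :* hb :* hd) :* (v :* (:# 4 :* s :- u))) refl
    restrict : ∑⁴ (λ l d m h → weight i k l b d * cross i k l b d m j h) ≤ # 432 * (#[ n ]² * #[ n ]² * #[ n ]²) * ε
    restrict = begin
      ∑⁴ (λ l d m h → weight i k l b d * cross i k l b d m j h)
        ≡⟨ ∑∑-cong (λ l d → ∑∑-*ˡ (weight i k l b d) (λ m h → cross i k l b d m j h)) ⟩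
      ∑ (λ l → ∑ (λ d → weight i k l b d * ∑ (λ m → ∑ (λ h → cross i k l b d m j h))))
        ≤⟨ ∑∑-mono (λ l d → *-monoˡ (0≤weight i k l b d) (∑-mono (λ m →
             ∑-Enum.single≤sum (λ a → ∑ (λ h → cross i k l b d m a h)) (λ a → ∑-nonneg (0≤cross i k l b d m a)) j))) ⟩
      ∑ (λ l → ∑ (λ d → weight i k l b d * crossings i k l b d))
        ≤⟨ ∑-mono (λ l → ∑-Enum.single≤sum (λ b → ∑ (λ d → weight i k l b d * crossings i k l b d)) (λ b → ∑-nonneg (0≤wc k l b)) b) ⟩
      ∑ (λ l → ∑ (λ b → ∑ (λ d → weight i k l b d * crossings i k l b d)))
        ≤⟨ ∑-Enum.single≤sum (λ k → ∑ (λ l → ∑ (λ b → ∑ (λ d → weight i k l b d * crossings i k l b d))))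
             (λ k → ∑-nonneg (λ l → ∑∑-nonneg (0≤wc k l))) k ⟩
      ∑⁴ (λ k l b d → weight i k l b d * crossings i k l b d)
        ≤⟨ row-inequality i ⟩
      # 432 * (#[ n ]² * #[ n ]² * #[ n ]²) * ε ∎
      where
      open ℚₚ.≤-Reasoning
      0≤wc : ∀ k l b d → 0ℚ ≤ weight i k l b d * crossings i k l b d
      0≤wc k l b d = 0≤weight i k l b d ⊛ ∑-nonneg (λ m → ∑∑-nonneg (0≤cross i k l b d m))
    count : corner k b * corner i j - # 6 * n³ ≤ # 4 * (# 432 * (#[ n ]² * #[ n ]² * #[ n ]²) * ε)
    count = begin
      corner k b * corner i j - # 6 * n³
        ≡⟨ cong₂ _-_ (∑⁴-product u v) ∑⁴-bad ⟨
      ∑⁴ (λ l d m h → u l d * v m h) - ∑⁴ bad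
        ≡⟨ ∑⁴-- (λ l d m h → u l d * v m h) bad ⟨
      ∑⁴ (λ l d m h → u l d * v m h - bad l d m h)
        ≤⟨ ∑⁴-mono pointwise ⟩
      ∑⁴ (λ l d m h → # 4 * (weight i k l b d * cross i k l b d m j h))
        ≡⟨ ∑⁴-*ˡ (# 4) (λ l d m h → weight i k l b d * cross i k l b d m j h) ⟩
      # 4 * ∑⁴ (λ l d m h → weight i k l b d * cross i k l b d m j h)
        ≤⟨ *-monoˡ (0≤# 4) restrict ⟩
      # 4 * (# 432 * (#[ n ]² * #[ n ]² * #[ n ]²) * ε) ∎
      where open ℚₚ.≤-Reasoning
    n⁴ : ℚ
    n⁴ = #[ n ]² * #[ n ]²
    -- 16(corner·corner) ≥ n⁴ leaves n⁴ ≤ 96n³ + 27648n⁶ε ≤ n⁴/2 + (27/64)n⁴.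
    impossible : n⁴ ≤ 0ℚ
    impossible = *-cancelˡ (+ 5 / 64) (ℚₚ.positive⁻¹ (+ 5 / 64)) (by-difference
      (to0 (*-mono 0≤n² (0≤# 4 ⊛ 0≤corner i j) kb ij) ⊕ 0≤# 16 ⊛ to0 count ⊕ (ℚₚ.nonNegative⁻¹ ½ ⊛ 0≤n² ⊛ 0≤# n) ⊛ to0 192≤n
        ⊕ (ℚₚ.nonNegative⁻¹ (+ 27 / 64) ⊛ (0≤n² ⊛ 0≤n²)) ⊛ to0 tiny)
      (lem (# n) ε (corner k b) (corner i j)))
      where
      lem = solve 4 (λ n e p q → con (+ 5 / 64) :* :# 0 :- con (+ 5 / 64) :* (n :² :* (n :²)) :=
        (:# 4 :* p :* (:# 4 :* q) :- n :² :* (n :²)) :+ :# 16 :* (:# 4 :* (:# 432 :* (n :² :* (n :²) :* (n :²)) :* e) :- (p :* q :- :# 6 :* (n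
        :* (n :* (n :* :# 1))))) :+ con ½ :* (n :²) :* n :* (n :- :# 192) :+ con (+ 27 / 64) :* (n :² :* (n :²)) :* (:# 1 :- :# 65536 :* (n :²)
        :* e)) refl
    0< : 0ℚ < n⁴
    0< = 0<* (0<* 0<n 0<n) (0<* 0<n 0<n)

  BareOutsideRow BareOutsideColumn : Fin n → Set
  BareOutsideRow i = ∀ k l a b → k ≢ i → l ≢ i → β (D k l a b) ≡ 0ℚ
  BareOutsideColumn j = ∀ k l a b → a ≢ j → b ≢ j → β (D k l a b) ≡ 0ℚ

  -- Cells that pairwise share a line all lie on one line: if column j contains a heavy cell besides
  -- (i, j), a heavy cell off column j would have to lie in the rows of both. Without any heavy cell
  -- every row serves, here i₀.
  heavy-line : Fin n → (∃ BareOutsideRow) ⊎ (∃ BareOutsideColumn)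
  heavy-line i₀ = go (any? (λ i → any? (heavy? i)))
    where
    bare : ∀ k l a b → (¬ Heavy k a) × (¬ Heavy k b) × (¬ Heavy l a) × (¬ Heavy l b) → β (D k l a b) ≡ 0ℚ
    bare k l a b (p , q , r , s) = ⟦⟧-no (¼ ≤? sq (D k l a b)) (λ big → corners-heavy k l a b big p q r s)
    go : Dec (∃ λ i → ∃ (Heavy i)) → (∃ BareOutsideRow) ⊎ (∃ BareOutsideColumn)
    go (no none) = inj₁ (i₀ , λ k l a b _ _ → bare k l a b ((λ h → none (k , a , h)) , (λ h → none (k , b , h)) , (λ h → none (l , a , h)) , (λ h → none (l , b , h))))
    go (yes (i , j , ij)) = row (any? (λ k → ¬? (k ≟ i) ×-dec heavy? k j))
      where
      row : Dec (∃ λ k → k ≢ i × Heavy k j) → (∃ BareOutsideRow) ⊎ (∃ BareOutsideColumn)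
      row (no none) = inj₁ (i , λ k l a b k≢i l≢i → bare k l a b (outside k≢i a , outside k≢i b , outside l≢i a , outside l≢i b))
        where
        outside : ∀ {k} → k ≢ i → ∀ a → ¬ Heavy k a
        outside {k} k≢i a h = at (j ≟ a)
          where
          at : Dec (j ≡ a) → ⊥
          at (yes refl) = none (k , k≢i , h)
          at (no j≢a)   = heavy-collinear ij h k≢i j≢a
      row (yes (k′ , k′≢i , k′j)) = inj₂ (j , λ k l a b a≢j b≢j → bare k l a b (outside k a≢j , outside k b≢j , outside l a≢j , outside l b≢j))
        where
        outside : ∀ k {a} → a ≢ j → ¬ Heavy k a
        outside k {a} a≢j h = at (k ≟ i)
          where
          at : Dec (k ≡ i) → ⊥
          at (no k≢i)   = heavy-collinear ij h k≢i (a≢j ∘ sym)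
          at (yes refl) = heavy-collinear k′j h (k′≢i ∘ sym) (a≢j ∘ sym)

  -- No rectangle avoiding row i has |D| ≥ ½, so `D²-total≤` leaves 8n²ε for each pair of rows, 8n⁴ε
  -- in total. The surplus factor n is traded for 1/δ by nδ ≤ 3072, and 24576 = 8·3072.
  bare-row : ∀ {i δ} → BareOutsideRow i → 0ℚ < δ → δ ≤ 1ℚ → # n * δ ≤ # 3072 → NearDictator f ε δ (# 8 + # 8 * # 24576)
  bare-row {i} {δ} bare 0<δ δ≤1 nδ≤ = Rounding.rounded c f ε close 2<n i (# 24576) (ℚₚ.≤-trans (#-mono {4} {192} (ℕₚ.m≤m+n 4 188)) 192≤n) (ℚₚ.<⇒≤ 0<δ) δ≤1 (0≤# 24576) (begin
    ∑⁴ (weight i) * δ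
      ≤⟨ *-mono (∑⁴-nonneg (0≤weight i)) (ℚₚ.<⇒≤ 0<δ) total ℚₚ.≤-refl ⟩
    # 8 * (#[ n ]² * #[ n ]²) * ε * δ
      ≤⟨ by-difference (0≤# 8 ⊛ 0≤n² ⊛ 0≤# n ⊛ 0≤ε ⊛ to0 nδ≤) (lem (# n) ε δ) ⟩
    # 24576 * (#[ n ]² * # n) * ε ∎)
    where
    open ℚₚ.≤-Reasoning
    lem = solve 3 (λ n e d → :# 24576 :* (n :² :* n) :* e :- :# 8 :* (n :² :* (n :²)) :* e :* d :=
      :# 8 :* (n :²) :* n :* e :* (:# 3072 :- n :* d)) refl
    m² : ℚ
    m² = # 8 * #[ n ]² * ε
    0≤m² : 0ℚ ≤ m²
    0≤m² = 0≤# 8 ⊛ 0≤n² ⊛ 0≤ε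
    pair : ∀ k l → ∑ (λ a → ∑ (λ b → weight i k l a b)) ≤ m²
    pair k l = subst (_≤ m²) (sym (∑∑-*ˡ (ne k i * ne l i) (λ a b → sq (D k l a b)))) (at (k ≟ i) (l ≟ i))
      where
      w : ℚ
      w = ∑ (λ a → ∑ (λ b → sq (D k l a b)))
      at : (d : Dec (k ≡ i)) (d′ : Dec (l ≡ i)) → (1ℚ - ⟦ d ⟧) * (1ℚ - ⟦ d′ ⟧) * w ≤ m²
      at (yes _) d′ = subst (_≤ m²) (sym (lem₁ (1ℚ - ⟦ d′ ⟧) w)) 0≤m²
        where
        lem₁ = solve 2 (λ p w → (:# 1 :- :# 1) :* p :* w := :# 0) refl
      at (no _) (yes _) = subst (_≤ m²) (sym (lem₁ w)) 0≤m²
        where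
        lem₁ = solve 1 (λ w → (:# 1 :- :# 0) :* (:# 1 :- :# 1) :* w := :# 0) refl
      at (no k≢i) (no l≢i) = subst (_≤ m²) (sym (ℚₚ.*-identityˡ w)) (subst (w ≤_)
        (trans (cong (λ t → # 2 * t + m²) (∑∑-zero (λ a b → bare k l a b k≢i l≢i)))
          (lem₁ m²)) (D²-total≤ k l))
        where
        lem₁ = solve 1 (λ m → :# 2 :* :# 0 :+ m := m) refl
    total : ∑⁴ (weight i) ≤ # 8 * (#[ n ]² * #[ n ]²) * ε
    total = subst (∑⁴ (weight i) ≤_) (trans (∑-constant {n} (λ _ → ∑-const n m²)) (lem₂ (# n) ε)) (∑∑-mono pair)
      where
      lem₂ = solve 2 (λ n e → n :* (n :* (:# 8 :* (n :²) :* e)) := :# 8 :* (n :² :* (n :²)) :* e) refl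

-- The dense case

masked-≤ : ∀ p q {u v} → (T p → T q → u ≤ v) → toℚ p * toℚ q * u ≤ toℚ p * toℚ q * v
masked-≤ true  true          h = *-monoˡ (0≤1 ⊛ 0≤1) (h tt tt)
masked-≤ true  false {u} {v} _ = ℚₚ.≤-reflexive (masked true false {u} {v} (λ _ ()))
masked-≤ false q     {u} {v} _ = ℚₚ.≤-reflexive (masked false q {u} {v} (λ ()))

E-∑⁴ : ∀ {n} (F : Fin n → Fin n → Fin n → Fin n → Perm n → ℚ) → E (λ π → ∑⁴ (λ a b c d → F a b c d π)) ≡ ∑⁴ (λ a b c d → E (F a b c d))
E-∑⁴ F = trans (E-∑∑ (λ a b π → ∑ (λ c → ∑ (λ d → F a b c d π)))) (∑∑-cong (λ a b → E-∑∑ (F a b)))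

-- Weight across two complementary blocks of rows

module Halves {n : ℕ} (c : Fin n → Fin n → ℚ) (f : Perm n → Bool) (ε : ℚ)
  (close : E (λ π → sq (toℚ (f π) - Linear.ℓ c π)) ≤ ε) (2<n : # 2 < # n) (H : Fin n → Bool)
  (0<N₁ : 0ℚ < ∑ (λ t → toℚ (H t))) (0<N₂ : 0ℚ < ∑ (λ t → toℚ (not (H t)))) where

  open Energy c f ε close 2<n

  private
    R : Fin n → Bool
    R = not ∘ H
    module BH = Block H
    module BR = Block R
    h r : Fin n → ℚ
    h = BH.r
    r = BR.r
    N₁ N₂ : ℚ
    N₁ = BH.N
    N₂ = BR.N

  move-pair : ∀ {k l p q} → k ≢ l → p ≢ q → T (R k) → T (R l) → T (R p) → T (R q) →
              ∃ λ σ → BR.Supported σ × app σ k ≡ p × app σ l ≡ q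
  move-pair {k} {l} {p} {q} k≢l p≢q Rk Rl Rp Rq = τ l′ q ∙ τ k p , BR.supported-∙ (BR.supported-τ Rl′ Rq) (BR.supported-τ Rk Rp) ,
    trans (app-∙ (τ l′ q) (τ k p) k) (trans (cong (app (τ l′ q)) (τ-first k p)) (τ-other l′ q p p≢l′ p≢q)) ,
    trans (app-∙ (τ l′ q) (τ k p) l) (τ-first l′ q)
    where
    l′ : Fin n
    l′ = app (τ k p) l
    Rl′ : T (R l′)
    Rl′ = subst T (sym (BR.supported-stable {τ k p} (BR.supported-τ Rk Rp) l)) Rl
    p≢l′ : p ≢ l′
    p≢l′ eq = k≢l (app-injective (τ k p) (trans (τ-first k p) eq))

  mask : (k l p q : Fin n) → ℚ
  mask k l p q = r k * r l * (r p * r q)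

  0≤mask : ∀ k l p q → 0ℚ ≤ mask k l p q
  0≤mask k l p q = BR.0≤r k ⊛ BR.0≤r l ⊛ (BR.0≤r p ⊛ BR.0≤r q)

  mask≤1 : ∀ k l p q → mask k l p q ≤ 1ℚ
  mask≤1 k l p q = *-mono (BR.0≤r k ⊛ BR.0≤r l) 0≤1 (*-mono (BR.0≤r k) 0≤1 (BR.r≤1 k) (BR.r≤1 l)) (*-mono (BR.0≤r p) 0≤1 (BR.r≤1 p) (BR.r≤1 q))

  -- The weight of the rectangles with rows in R and columns in π(R). It ignores how π acts on H, so
  -- it can serve as a weight when averaging over H. Summing over all p, q in R, in place of p = k
  -- and q = l, keeps it below W for every π while its mean still has the order of the weight on R.
  u : Perm n → ℚ
  u π = ∑⁴ (λ k l p q → mask k l p q * sq (D k l (app π p) (app π q)))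

  0≤u : ∀ π → 0ℚ ≤ u π
  0≤u π = ∑⁴-nonneg (λ k l p q → 0≤mask k l p q ⊛ 0≤sq (D k l (app π p) (app π q)))

  u≤W : ∀ π → u π ≤ W
  u≤W π = ℚₚ.≤-trans
    (∑⁴-mono (λ k l p q → by-difference (to0 (mask≤1 k l p q) ⊛ 0≤sq (D k l (app π p) (app π q))) (lem (mask k l p q) (sq (D k l (app π p) (app π q))))))
    (ℚₚ.≤-reflexive (∑∑-cong (λ k l → trans (∑-permute π (λ a → ∑ (λ q → sq (D k l a (app π q))))) (∑-cong (λ a → ∑-permute π (λ b → sq (D k l a b)))))))
    where
    lem = solve 2 (λ m t → t :- m :* t := (:# 1 :- m) :* t) refl

  u-invariant : ∀ {υ} → BH.Supported υ → ∀ π → u (π ∙ υ) ≡ u π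
  u-invariant {υ} supp π = ∑⁴-cong (λ k l p q → trans (ℚₚ.*-assoc (r k * r l) (r p * r q) _)
    (trans (cong (r k * r l *_) (masked (R p) (R q) (λ Rp Rq → cong₂ (λ a b → sq (D k l a b)) (at p Rp) (at q Rq))))
      (sym (ℚₚ.*-assoc (r k * r l) (r p * r q) _))))
    where
    at : ∀ p → T (R p) → app (π ∙ υ) p ≡ app π p
    at p Rp = trans (app-∙ π υ p) (cong (app π) (supp p Rp))

  module _ {υ : Perm n} (supp : BH.Supported υ) where

    βυ : Perm n → ℚ
    βυ π = β (ℓ π - ℓ (π ∙ υ))

    E-βυ-Q≤ : E (λ π → βυ π * BR.Q π) ≤ # 432 * N₂ * ε
    E-βυ-Q≤ = ℚₚ.≤-trans (E-β-Q≤ R 0<N₂ {υ} supp) (ℚₚ.≤-reflexive (lem N₂ ε))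
      where
      lem = solve 2 (λ m e → :# 4 :* m :* (:# 108 :* e) := :# 432 :* m :* e) refl

    -- The change along υ involves rows of H only, so translating π by a permutation of R that takes
    -- k to p and l to q affects the second factor alone. Degenerate pairs make the left side 0,
    -- whence an inequality.
    move : ∀ {k l p q} → T (R k) → T (R l) → T (R p) → T (R q) →
           E (λ π → βυ π * sq (D k l (app π p) (app π q))) ≤ E (λ π → βυ π * sq (D k l (app π k) (app π l)))
    move {k} {l} {p} {q} Rk Rl Rp Rq = go (k ≟ l) (p ≟ q)
      where
      zero-left : (∀ π → D k l (app π p) (app π q) ≡ 0ℚ) → E (λ π → βυ π * sq (D k l (app π p) (app π q))) ≤ E (λ π → βυ π * sq (D k l (app π k) (app π l)))
      zero-left z = E-mono (λ π → subst (_≤ βυ π * sq (D k l (app π k) (app π l)))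
        (sym (trans (cong (λ t → βυ π * sq t) (z π)) (ℚₚ.*-zeroʳ (βυ π)))) (0≤β (ℓ π - ℓ (π ∙ υ)) ⊛ 0≤sq (D k l (app π k) (app π l))))
      go : Dec (k ≡ l) → Dec (p ≡ q) → E (λ π → βυ π * sq (D k l (app π p) (app π q))) ≤ E (λ π → βυ π * sq (D k l (app π k) (app π l)))
      go (yes refl) _          = zero-left (λ π → D-row-diag k (app π p) (app π q))
      go (no _)     (yes refl) = zero-left (λ π → D-col-diag k l (app π p))
      go (no k≢l)   (no p≢q) with move-pair k≢l p≢q Rk Rl Rp Rq
      ... | σ , suppσ , σk , σl = ℚₚ.≤-reflexive (trans
        (E-cong (λ π → cong₂ _*_ (cong β (sym (difference-invariant R {υ} supp suppσ π)))
          (cong₂ (λ a b → sq (D k l a b)) (sym (trans (app-∙ π σ k) (cong (app π) σk))) (sym (trans (app-∙ π σ l) (cong (app π) σl))))))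
        (E-translate (λ π → βυ π * sq (D k l (app π k) (app π l))) σ))

    E-βυ-u≤ : E (λ π → βυ π * u π) ≤ # 432 * (N₂ * N₂ * N₂) * ε
    E-βυ-u≤ = begin
      E (λ π → βυ π * u π)
        ≡⟨ trans (E-cong (λ π → trans (sym (∑⁴-*ˡ (βυ π) (λ k l p q → mask k l p q * sq (D k l (app π p) (app π q)))))
             (∑⁴-cong (λ k l p q → lem₁ (βυ π) (r k * r l) (r p * r q) (sq (D k l (app π p) (app π q)))))))
             (trans (E-∑⁴ (λ k l p q π → mask k l p q * (βυ π * sq (D k l (app π p) (app π q))))) (∑⁴-cong (λ k l p q → E-*ˡ (mask k l p q) _))) ⟩
      ∑⁴ (λ k l p q → mask k l p q * E (λ π → βυ π * sq (D k l (app π p) (app π q))))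
        ≤⟨ ∑⁴-mono (λ k l p q → subst₂ _≤_ (sym (ℚₚ.*-assoc (r k * r l) (r p * r q) _)) (sym (ℚₚ.*-assoc (r k * r l) (r p * r q) _))
             (masked-≤ (R k) (R l) (λ Rk Rl → masked-≤ (R p) (R q) (move Rk Rl)))) ⟩
      ∑⁴ (λ k l p q → mask k l p q * E (λ π → βυ π * sq (D k l (app π k) (app π l))))
        ≡⟨ trans (∑⁴-cong (λ k l p q → lem₂ (r k * r l) (r p * r q) (E (λ π → βυ π * sq (D k l (app π k) (app π l))))))
             (∑⁴-product (λ k l → r k * r l * E (λ π → βυ π * sq (D k l (app π k) (app π l)))) (λ p q → r p * r q)) ⟩
      ∑ (λ k → ∑ (λ l → r k * r l * E (λ π → βυ π * sq (D k l (app π k) (app π l))))) * ∑ (λ p → ∑ (λ q → r p * r q))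
        ≡⟨ cong₂ _*_ (trans (∑∑-cong (λ k l → trans (sym (E-*ˡ (r k * r l) _)) (E-cong (λ π → lem₃ (r k * r l) (βυ π) (sq (D k l (app π k) (app π l)))))))
             (trans (sym (E-∑∑ (λ k l π → βυ π * (r k * r l * sq (D k l (app π k) (app π l)))))) (E-cong (λ π → ∑∑-*ˡ (βυ π) (λ k l → r k * r l * sq (D k l (app π k) (app π l)))))))
             (∑∑-product r r) ⟩
      E (λ π → βυ π * BR.Q π) * (N₂ * N₂)
        ≤⟨ *-mono (E-nonneg (λ π → 0≤β (ℓ π - ℓ (π ∙ υ)) ⊛ BR.0≤Q π)) (BR.0≤N ⊛ BR.0≤N) E-βυ-Q≤ ℚₚ.≤-refl ⟩
      # 432 * N₂ * ε * (N₂ * N₂)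
        ≡⟨ lem₄ N₂ ε ⟩
      # 432 * (N₂ * N₂ * N₂) * ε ∎
      where
      open ℚₚ.≤-Reasoning
      lem₁ = solve 4 (λ b p q s → b :* (p :* q :* s) := p :* q :* (b :* s)) refl
      lem₂ = solve 3 (λ p q s → p :* q :* s := p :* s :* q) refl
      lem₃ = solve 3 (λ p b s → p :* (b :* s) := b :* (p :* s)) refl
      lem₄ = solve 2 (λ m e → :# 432 :* m :* e :* (m :²) := :# 432 :* (m :² :* m) :* e) refl

    κ : ℚ
    κ = (# 864 * (N₂ * N₂ * N₂) + # 8 * W) * ε

    -- Where |ℓ(π) - ℓ(πυ)| ≥ ½, the weight u is controlled by the first averaging, over R. The rest
    -- of the change of ℓ is paid by the errors, with u replaced by its uniform bound W.
    E-u-sq≤ : E (λ π → u π * sq (ℓ π - ℓ (π ∙ υ))) ≤ κ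
    E-u-sq≤ = begin
      E (λ π → u π * sq (ℓ π - ℓ (π ∙ υ)))
        ≤⟨ E-mono (λ π → *-monoˡ (0≤u π) (sq-difference-bound (f π) (f (π ∙ υ)) (ℓ π) (ℓ (π ∙ υ)))) ⟩
      E (λ π → u π * (# 2 * βυ π + # 4 * (e π + e (π ∙ υ))))
        ≤⟨ E-mono (λ π → by-difference (0≤# 4 ⊛ (0≤e π ⊕ 0≤e (π ∙ υ)) ⊛ to0 (u≤W π)) (lem₁ (u π) W (βυ π) (e π + e (π ∙ υ)))) ⟩
      E (λ π → # 2 * (βυ π * u π) + # 4 * W * (e π + e (π ∙ υ)))
        ≡⟨ trans (E-+ _ _) (cong₂ _+_ (E-*ˡ (# 2) _) (trans (E-*ˡ (# 4 * W) _) (cong (# 4 * W *_) (E-+ e (λ π → e (π ∙ υ)))))) ⟩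
      # 2 * E (λ π → βυ π * u π) + # 4 * W * (E e + E (λ π → e (π ∙ υ)))
        ≤⟨ ℚₚ.+-mono-≤ (*-monoˡ (0≤# 2) E-βυ-u≤) (*-monoˡ (0≤# 4 ⊛ 0≤W) (ℚₚ.+-mono-≤ close (E-e υ))) ⟩
      # 2 * (# 432 * (N₂ * N₂ * N₂) * ε) + # 4 * W * (ε + ε)
        ≡⟨ lem₂ (N₂ * N₂ * N₂) W ε ⟩
      κ ∎
      where
      open ℚₚ.≤-Reasoning
      lem₁ = solve 4 (λ u w b s → :# 2 :* (b :* u) :+ :# 4 :* w :* s :- u :* (:# 2 :* b :+ :# 4 :* s) := :# 4 :* s :* (w :- u)) refl
      lem₂ = solve 3 (λ m w e → :# 2 :* (:# 432 :* m :* e) :+ :# 4 :* w :* (e :+ e) := (:# 864 :* m :+ :# 8 :* w) :* e) refl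

  -- The second averaging, over H, with the weight u controlled by the first.
  E-u-Q≤ : E (λ π → u π * BH.Q π) ≤ # 4 * N₁ * ((# 864 * (N₂ * N₂ * N₂) + # 8 * W) * ε)
  E-u-Q≤ = Smoothing.E-Q≤ c H 0<N₁ u 0≤u u-invariant _ (λ {υ} supp → E-u-sq≤ {υ} supp)

  product-marginal : ∀ {i j p q} k l → T (H i) → T (H j) → T (R p) → T (R q) →
    falling n 4 * E (λ π → sq (D i j (app π i) (app π j)) * sq (D k l (app π p) (app π q))) ≡ ne p q * G i j k l
  product-marginal {i} {j} {p} {q} k l Hi Hj Rp Rq = go (i ≟ j) (p ≟ q)
    where
    F : Perm n → ℚ
    F π = sq (D i j (app π i) (app π j)) * sq (D k l (app π p) (app π q))
    H≢R : ∀ {s t} → T (H s) → T (R t) → s ≢ t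
    H≢R Hs Rs refl = T-not Hs Rs
    vanish : (∀ π → F π ≡ 0ℚ) → falling n 4 * E F ≡ 0ℚ
    vanish z = trans (cong (falling n 4 *_) (trans (E-cong z) (E-const 0ℚ))) (ℚₚ.*-zeroʳ (falling n 4))
    go : Dec (i ≡ j) → Dec (p ≡ q) → falling n 4 * E F ≡ ne p q * G i j k l
    go (yes refl) _ = trans (vanish (λ π → trans (cong (λ t → sq t * sq (D k l (app π p) (app π q))) (D-row-diag i (app π i) (app π i))) (ℚₚ.*-zeroˡ (sq (D k l (app π p) (app π q))))))
      (sym (trans (cong (ne p q *_) (∑⁴-zero (λ a b c d → trans (cong (λ t → χ a b c d * (sq t * sq (D k l c d))) (D-row-diag i a b)) (lem (χ a b c d) (sq (D k l c d)))))) (ℚₚ.*-zeroʳ (ne p q))))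
      where
      lem = solve 2 (λ s t → s :* (:# 0 :* t) := :# 0) refl
    go (no _) (yes refl) = trans (vanish (λ π → trans (cong (λ t → sq (D i j (app π i) (app π j)) * sq t) (D-col-diag k l (app π p))) (ℚₚ.*-zeroʳ (sq (D i j (app π i) (app π j))))))
      (sym (trans (cong (_* G i j k l) (ne-refl p)) (ℚₚ.*-zeroˡ (G i j k l))))
    go (no i≢j) (no p≢q) = trans
      (E-quadruple (λ a b → sq (D i j a b)) (λ c d → sq (D k l c d)) (λ a → cong sq (D-col-diag i j a)) (λ c → cong sq (D-col-diag k l c))
        (distinct₄ i≢j (H≢R Hi Rp) (H≢R Hi Rq) (H≢R Hj Rp) (H≢R Hj Rq) p≢q))
      (sym (trans (cong (_* G i j k l) (ne-yes p≢q)) (ℚₚ.*-identityˡ (G i j k l))))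

  ∑∑-ne : ∑ (λ p → ∑ (λ q → r p * r q * ne p q)) ≡ N₂ * N₂ - N₂
  ∑∑-ne = trans (∑∑-cong (λ p q → lem (r p) (r q) ⟦ p ≟ q ⟧)) (trans (∑∑-- (λ p q → r p * r q) (λ p q → ⟦ p ≟ q ⟧ * (r p * r q)))
    (cong₂ _-_ (∑∑-product r r) (∑-cong (λ p → trans (∑-single (λ q → r p * r q) p) (idem (R p))))))
    where
    lem = solve 3 (λ a b t → a :* b :* (:# 1 :- t) := a :* b :- t :* (a :* b)) refl
    idem : ∀ b → toℚ b * toℚ b ≡ toℚ b
    idem true  = refl
    idem false = refl

  -- Each choice of p ≠ q in R contributes the same sum by `product-marginal`, and N₂² - N₂ counts
  -- these choices.
  halves : (N₂ * N₂ - N₂) * ∑⁴ (λ i j k l → h i * h j * (r k * r l) * G i j k l) ≤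
           falling n 4 * (# 4 * N₁ * ((# 864 * (N₂ * N₂ * N₂) + # 8 * W) * ε))
  halves = subst (_≤ falling n 4 * (# 4 * N₁ * ((# 864 * (N₂ * N₂ * N₂) + # 8 * W) * ε))) eq (*-monoˡ (falling-nonneg n 4) E-u-Q≤)
    where
    open ≡-Reasoning
    lem₂ = solve 3 (λ g p e → g :* (p :* e) := p :* (g :* e)) refl
    base : (i j k l p q : Fin n) → ℚ
    base i j k l p q = h i * h j * (r k * r l * (r p * r q))
    F : (i j k l p q : Fin n) → Perm n → ℚ
    F i j k l p q π = sq (D i j (app π i) (app π j)) * sq (D k l (app π p) (app π q))
    term : ∀ i j k l p q → falling n 4 * E (λ π → base i j k l p q * F i j k l p q π) ≡ r p * r q * ne p q * (h i * h j * (r k * r l) * G i j k l)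
    term i j k l p q = trans (cong (falling n 4 *_) (E-*ˡ (base i j k l p q) (F i j k l p q)))
      (trans (lem₂ (falling n 4) (base i j k l p q) (E (F i j k l p q)))
        (trans (lem₄ (h i * h j) (r k * r l) (r p * r q) (falling n 4 * E (F i j k l p q)))
          (trans (cong (r k * r l *_) (masked (H i) (H j) (λ Hi Hj → masked (R p) (R q) (λ Rp Rq → product-marginal {i} {j} {p} {q} k l Hi Hj Rp Rq))))
            (lem₅ (h i * h j) (r k * r l) (r p * r q) (ne p q) (G i j k l)))))
      where
      lem₄ = solve 4 (λ a b d x → a :* (b :* d) :* x := b :* (a :* (d :* x))) refl
      lem₅ = solve 5 (λ a b d t g → b :* (a :* (d :* (t :* g))) := d :* t :* (a :* b :* g)) refl
    six : (Fin n → Fin n → Fin n → Fin n → Fin n → Fin n → ℚ) → ℚ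
    six Φ = ∑⁴ (λ i j k l → ∑ (λ p → ∑ (λ q → Φ i j k l p q)))
    expand : ∀ π → u π * BH.Q π ≡ six (λ i j k l p q → base i j k l p q * F i j k l p q π)
    expand π = begin
      u π * BH.Q π
        ≡⟨ trans (ℚₚ.*-comm (u π) (BH.Q π)) (sym (trans (∑-cong (λ i → sum-*ʳ (u π) (λ j → h i * h j * sq (BH.Dπ π i j)) (allFin n)))
             (sum-*ʳ (u π) (λ i → ∑ (λ j → h i * h j * sq (BH.Dπ π i j))) (allFin n)))) ⟩
      ∑ (λ i → ∑ (λ j → h i * h j * sq (BH.Dπ π i j) * u π))
        ≡⟨ ∑∑-cong (λ i j → sym (∑⁴-*ˡ (h i * h j * sq (BH.Dπ π i j)) (λ k l p q → mask k l p q * sq (D k l (app π p) (app π q))))) ⟩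
      ∑ (λ i → ∑ (λ j → ∑⁴ (λ k l p q → h i * h j * sq (BH.Dπ π i j) * (mask k l p q * sq (D k l (app π p) (app π q))))))
        ≡⟨ ∑∑-cong (λ i j → ∑⁴-cong (λ k l p q → lem₆ (h i * h j) (sq (BH.Dπ π i j)) (mask k l p q) (sq (D k l (app π p) (app π q))))) ⟩
      six (λ i j k l p q → base i j k l p q * F i j k l p q π) ∎
      where
      lem₆ = solve 4 (λ a s m t → a :* s :* (m :* t) := a :* m :* (s :* t)) refl
    eq : falling n 4 * E (λ π → u π * BH.Q π) ≡ (N₂ * N₂ - N₂) * ∑⁴ (λ i j k l → h i * h j * (r k * r l) * G i j k l)
    eq = begin
      falling n 4 * E (λ π → u π * BH.Q π)
        ≡⟨ cong (falling n 4 *_) (trans (E-cong expand) (trans (E-∑⁴ (λ i j k l π → ∑ (λ p → ∑ (λ q → base i j k l p q * F i j k l p q π))))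
             (∑⁴-cong (λ i j k l → E-∑∑ (λ p q π → base i j k l p q * F i j k l p q π))))) ⟩
      falling n 4 * six (λ i j k l p q → E (λ π → base i j k l p q * F i j k l p q π))
        ≡⟨ trans (sym (∑⁴-*ˡ (falling n 4) _)) (∑⁴-cong (λ i j k l → trans (sym (∑∑-*ˡ (falling n 4) _)) (∑∑-cong (term i j k l)))) ⟩
      six (λ i j k l p q → r p * r q * ne p q * (h i * h j * (r k * r l) * G i j k l))
        ≡⟨ ∑⁴-cong (λ i j k l → trans (∑-cong (λ p → sum-*ʳ (h i * h j * (r k * r l) * G i j k l) (λ q → r p * r q * ne p q) (allFin n)))
             (trans (sum-*ʳ (h i * h j * (r k * r l) * G i j k l) (λ p → ∑ (λ q → r p * r q * ne p q)) (allFin n))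
               (cong (_* (h i * h j * (r k * r l) * G i j k l)) ∑∑-ne))) ⟩
      ∑⁴ (λ i j k l → (N₂ * N₂ - N₂) * (h i * h j * (r k * r l) * G i j k l))
        ≡⟨ ∑⁴-*ˡ (N₂ * N₂ - N₂) (λ i j k l → h i * h j * (r k * r l) * G i j k l) ⟩
      (N₂ * N₂ - N₂) * ∑⁴ (λ i j k l → h i * h j * (r k * r l) * G i j k l) ∎

-- Averaging over random halves of the rows

below : ∀ {n} → ℕ → Fin n → Bool
below m t = ⌊ toℕ t ℕ.<? m ⌋

∑-below : ∀ n m → m ℕ.≤ n → ∑ {n} (λ t → toℚ (below m t)) ≡ # m
∑-below n       zero    _         = trans (∑-cong (λ t → ⟦⟧-no (toℕ t ℕ.<? 0) (λ ()))) (sum-0 (allFin n))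
∑-below (suc n) (suc m) (s≤s m≤n) = trans (∑-suc (λ t → toℚ (below (suc m) t))) (trans (cong₂ _+_ (⟦⟧-yes (0 ℕ.<? suc m) (s≤s z≤n))
  (trans (∑-cong (λ t → ⟦⟧-⇔ (suc (toℕ t) ℕ.<? suc m) (toℕ t ℕ.<? m) (λ { (s≤s p) → p }) s≤s)) (∑-below n m m≤n))) (sym (#-suc m)))

∑-not : ∀ {n} (H : Fin n → Bool) → ∑ (λ t → toℚ (not (H t))) ≡ # n - ∑ (λ t → toℚ (H t))
∑-not {n} H = trans (∑-cong (λ t → at (H t))) (trans (sum-- (λ _ → 1ℚ) (λ t → toℚ (H t)) (allFin n))
  (cong (_- ∑ (λ t → toℚ (H t))) (trans (∑-const n 1ℚ) (ℚₚ.*-identityʳ (# n)))))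
  where
  at : ∀ b → toℚ (not b) ≡ 1ℚ - toℚ b
  at true  = refl
  at false = refl

toℚ-idem : ∀ b → toℚ b * toℚ b ≡ toℚ b
toℚ-idem true  = refl
toℚ-idem false = refl

∑∑-distinct : ∀ {n} (H : Fin n → Bool) → let N = ∑ (λ t → toℚ (H t)) in
  ∑ (λ a → ∑ (λ b → ne a b * (toℚ (H a) * toℚ (H b)))) ≡ N * N - N
∑∑-distinct {n} H = trans (∑∑-cong (λ a b → lem ⟦ a ≟ b ⟧ (toℚ (H a) * toℚ (H b)))) (trans (∑∑-- (λ a b → toℚ (H a) * toℚ (H b)) (λ a b → ⟦ a ≟ b ⟧ * (toℚ (H a) * toℚ (H b))))
  (cong₂ _-_ (∑∑-product (λ t → toℚ (H t)) (λ t → toℚ (H t))) (∑-cong (λ a → trans (∑-single (λ b → toℚ (H a) * toℚ (H b)) a) (toℚ-idem (H a))))))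
  where
  lem = solve 2 (λ t s → (:# 1 :- t) :* s := s :- t :* s) refl

module RandomHalves {n : ℕ} (H : Fin n → Bool) where

  private
    R : Fin n → Bool
    R = not ∘ H
    h r : Fin n → ℚ
    h t = toℚ (H t)
    r t = toℚ (R t)

  P₁ P₂ : ℚ
  P₁ = ∑ h * ∑ h - ∑ h
  P₂ = ∑ r * ∑ r - ∑ r

  split : (i j k l : Fin n) → Perm n → ℚ
  split i j k l ρ = h (app ρ i) * h (app ρ j) * (r (app ρ k) * r (app ρ l))

  -- The summand vanishes unless a, b lie in H and c, d outside, where χ is 1. The disjointness
  -- constraint therefore drops out and the sum factors.
  E-split : ∀ i j k l → Distinct (i ∷ j ∷ k ∷ l ∷ []) → falling n 4 * E (split i j k l) ≡ P₁ * P₂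
  E-split i j k l d₄ = begin
    falling n 4 * E (split i j k l)
      ≡⟨ cong (falling n 4 *_) (E-cong (λ ρ → cong₂ _*_ (at h ρ zero (suc zero) (λ ())) (at r ρ (suc (suc zero)) (suc (suc (suc zero))) (λ ())))) ⟩
    falling n 4 * E (λ ρ → B (app ρ i) (app ρ j) * C (app ρ k) (app ρ l))
      ≡⟨ E-quadruple B C (diag h) (diag r) d₄ ⟩
    ∑⁴ (λ a b c d → χ a b c d * (B a b * C c d))
      ≡⟨ ∑⁴-cong disjoint ⟩
    ∑⁴ (λ a b c d → B a b * C c d)
      ≡⟨ trans (∑⁴-product B C) (cong₂ _*_ (∑∑-distinct H) (∑∑-distinct R)) ⟩
    P₁ * P₂ ∎
    where
    open ≡-Reasoning
    -- On images of distinct rows `ne` is 1; it is inserted to give the vanishing diagonals that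
    -- `E-quadruple` asks for.
    B C : Fin n → Fin n → ℚ
    B a b = ne a b * (h a * h b)
    C a b = ne a b * (r a * r b)
    diag : ∀ (φ : Fin n → ℚ) a → ne a a * (φ a * φ a) ≡ 0ℚ
    diag φ a = trans (cong (_* (φ a * φ a)) (ne-refl a)) (ℚₚ.*-zeroˡ (φ a * φ a))
    rows : Vec (Fin n) 4
    rows = i ∷ j ∷ k ∷ l ∷ []
    at : ∀ (φ : Fin n → ℚ) ρ s t → s ≢ t → φ (app ρ (lookup rows s)) * φ (app ρ (lookup rows t)) ≡
         ne (app ρ (lookup rows s)) (app ρ (lookup rows t)) * (φ (app ρ (lookup rows s)) * φ (app ρ (lookup rows t)))
    at φ ρ s t s≢t = sym (trans (cong (_* (φ (app ρ (lookup rows s)) * φ (app ρ (lookup rows t))))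
      (ne-yes (λ eq → s≢t (distinct⇒injective rows d₄ (app-injective ρ eq))))) (ℚₚ.*-identityˡ _))
    H≢R : ∀ {s t} → T (H s) → T (R t) → s ≢ t
    H≢R Hs Rs refl = T-not Hs Rs
    disjoint : ∀ a b c d → χ a b c d * (B a b * C c d) ≡ B a b * C c d
    disjoint a b c d = trans (lem₁ (χ a b c d) (ne a b) (h a * h b) (ne c d) (r c * r d))
      (trans (masked (H a) (H b) (λ Ha Hb → masked (R c) (R d) (λ Rc Rd → cong (_* (ne a b * ne c d)) (χ-yes (H≢R Ha Rc) (H≢R Ha Rd) (H≢R Hb Rc) (H≢R Hb Rd)))))
        (lem₂ (ne a b) (h a * h b) (ne c d) (r c * r d)))
      where
      lem₁ = solve 5 (λ x s p t q → x :* (s :* p :* (t :* q)) := p :* (q :* (x :* (s :* t)))) refl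
      lem₂ = solve 4 (λ s p t q → p :* (q :* (:# 1 :* (s :* t))) := s :* p :* (t :* q)) refl

  E-split≥ : ∀ i j k l → ⟦ (i ∷ j ∷ k ∷ l ∷ []) distinct⟧ * (P₁ * P₂) ≤ falling n 4 * E (split i j k l)
  E-split≥ i j k l = go (T? (distinct (i ∷ j ∷ k ∷ l ∷ [])))
    where
    0≤ι : ∀ b → 0ℚ ≤ toℚ b
    0≤ι true  = 0≤1
    0≤ι false = ℚₚ.≤-refl
    go : (d : Dec (Distinct (i ∷ j ∷ k ∷ l ∷ []))) → ⟦ d ⟧ * (P₁ * P₂) ≤ falling n 4 * E (split i j k l)
    go (yes d₄) = ℚₚ.≤-reflexive (trans (ℚₚ.*-identityˡ (P₁ * P₂)) (sym (E-split i j k l d₄)))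
    go (no _)   = subst (_≤ falling n 4 * E (split i j k l)) (sym (ℚₚ.*-zeroˡ (P₁ * P₂)))
      (falling-nonneg n 4 ⊛ E-nonneg (λ ρ → 0≤ι (H (app ρ i)) ⊛ 0≤ι (H (app ρ j)) ⊛ (0≤ι (R (app ρ k)) ⊛ 0≤ι (R (app ρ l)))))

module DisjointPairs {n : ℕ} (c : Fin n → Fin n → ℚ) (f : Perm n → Bool) (ε : ℚ)
  (close : E (λ π → sq (toℚ (f π) - Linear.ℓ c π)) ≤ ε) (6≤n : # 6 ≤ # n) (m : ℕ) (m≤n : m ℕ.≤ n)
  (2m≤n : # 2 * # m ≤ # n) (n≤2m+1 : # n ≤ # 2 * # m + 1ℚ) where

  2<n : # 2 < # n
  2<n = ℚₚ.<-≤-trans (toWitness {a? = # 2 <? # 6} tt) 6≤n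

  open Energy c f ε close 2<n public

  private
    H : Fin n → Bool
    H = below m

  open RandomHalves H

  private
    N₁ N₂ : ℚ
    N₁ = # m
    N₂ = # n - # m

  P₁≡ : P₁ ≡ N₁ * N₁ - N₁
  P₁≡ = cong (λ t → t * t - t) (∑-below n m m≤n)

  P₂≡ : P₂ ≡ N₂ * N₂ - N₂
  P₂≡ = cong (λ t → t * t - t) (trans (∑-not H) (cong (_-_ (# n)) (∑-below n m m≤n)))

  -- N(N - 1) ≥ (n - 1)(n - 3)/4, which is at least n²/16 for n ≥ 6. It serves both halves, the
  -- smaller of which may have only (n - 1)/2 rows.
  half≥ : ∀ N → # n ≤ # 2 * N + 1ℚ → #[ n ]² ≤ # 16 * (N * N - N)
  half≥ N n≤ = by-difference (0≤# 4 ⊛ to0 n≤ ⊛ (to0 n≤ ⊕ 0≤# 2 ⊛ (to0 6≤n ⊕ 0≤# 4)) ⊕ (0≤# 3 ⊛ to0 6≤n ⊛ 0≤# n ⊕ 0≤# 2 ⊛ 0≤# n ⊕ 0≤# 12)) (lem (# n) N)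
    where
    lem = solve 2 (λ n m → :# 16 :* (m :² :- m) :- n :² :=
      :# 4 :* (:# 2 :* m :+ :# 1 :- n) :* (:# 2 :* m :+ :# 1 :- n :+ :# 2 :* (n :- :# 6 :+ :# 4)) :+ (:# 3 :* (n :- :# 6) :* n :+ :# 2 :* n
      :+ :# 12)) refl

  P₁≥ : #[ n ]² ≤ # 16 * P₁
  P₁≥ = subst (λ t → #[ n ]² ≤ # 16 * t) (sym P₁≡) (half≥ N₁ n≤2m+1)

  P₂≥ : #[ n ]² ≤ # 16 * P₂
  P₂≥ = subst (λ t → #[ n ]² ≤ # 16 * t) (sym P₂≡) (half≥ N₂ (by-difference (to0 2m≤n ⊕ 0≤1) (lem (# n) (# m))))
    where
    lem = solve 2 (λ n m → :# 2 :* (n :- m) :+ :# 1 :- n := n :- :# 2 :* m :+ :# 1) refl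

  0<N₁ : 0ℚ < N₁
  0<N₁ = ℚₚ.*-cancelˡ-<-nonNeg (# 2) {{nonNegative (0≤# 2)}} (subst (_< # 2 * N₁) (sym (ℚₚ.*-zeroʳ (# 2)))
    (ℚₚ.<-≤-trans (0<#suc 4) (by-difference (to0 n≤2m+1 ⊕ to0 6≤n) (lem (# n) N₁))))
    where
    lem = solve 2 (λ n m → :# 2 :* m :- :# 5 := :# 2 :* m :+ :# 1 :- n :+ (n :- :# 6)) refl

  0<N₂ : 0ℚ < N₂
  0<N₂ = ℚₚ.<-≤-trans 0<N₁ (by-difference (to0 2m≤n) (lem (# n) (# m)))
    where
    lem = solve 2 (λ n m → n :- m :- m := n :- :# 2 :* m) refl

  bound : ℚ
  bound = # 4 * N₁ * ((# 864 * (N₂ * N₂ * N₂) + # 8 * W) * ε)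

  -- As ρ varies, `H ∘ app ρ` is a uniformly random set of rows of the fixed size m.
  halves-at : ∀ ρ → P₂ * ∑⁴ (λ i j k l → split i j k l ρ * G i j k l) ≤ falling n 4 * bound
  halves-at ρ = subst (λ q → q * ∑⁴ (λ i j k l → split i j k l ρ * G i j k l) ≤ falling n 4 * bound) (sym P₂≡)
    (subst₂ (λ s t → (t * t - t) * ∑⁴ (λ i j k l → split i j k l ρ * G i j k l) ≤ falling n 4 * (# 4 * s * ((# 864 * (t * t * t) + # 8 * W) * ε)))
      n₁ n₂ (Halves.halves c f ε close 2<n (H ∘ app ρ) (subst (0ℚ <_) (sym n₁) 0<N₁) (subst (0ℚ <_) (sym n₂) 0<N₂)))
    where
    n₁ : ∑ (λ t → toℚ (H (app ρ t))) ≡ N₁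
    n₁ = trans (∑-permute ρ (λ t → toℚ (H t))) (∑-below n m m≤n)
    n₂ : ∑ (λ t → toℚ (not (H (app ρ t)))) ≡ N₂
    n₂ = trans (∑-not (H ∘ app ρ)) (cong (_-_ (# n)) n₁)

  distinctPairs : ℚ
  distinctPairs = ∑⁴ (λ i j k l → ⟦ (i ∷ j ∷ k ∷ l ∷ []) distinct⟧ * G i j k l)

  0≤G : ∀ i j k l → 0ℚ ≤ G i j k l
  0≤G i j k l = ∑⁴-nonneg (λ a b c d → 0≤χ a b c d ⊛ (0≤sq (D i j a b) ⊛ 0≤sq (D k l c d)))

  0≤16P : ∀ {P} → #[ n ]² ≤ # 16 * P → 0ℚ ≤ P
  0≤16P {P} le = *-cancelˡ (# 16) (0<#suc 15) (subst (_≤ # 16 * P) (sym (ℚₚ.*-zeroʳ (# 16))) (ℚₚ.≤-trans (0≤sq (# n)) le))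

  0≤P₂ : 0ℚ ≤ P₂
  0≤P₂ = 0≤16P {P₂} P₂≥

  averaged : P₂ * (P₁ * P₂ * distinctPairs) ≤ falling n 4 * (falling n 4 * bound)
  averaged = begin
    P₂ * (P₁ * P₂ * distinctPairs)
      ≡⟨ cong (P₂ *_) (trans (sym (∑⁴-*ˡ (P₁ * P₂) _)) (∑⁴-cong (λ i j k l → lem₁ (P₁ * P₂) ⟦ (i ∷ j ∷ k ∷ l ∷ []) distinct⟧ (G i j k l)))) ⟩
    P₂ * ∑⁴ (λ i j k l → ⟦ (i ∷ j ∷ k ∷ l ∷ []) distinct⟧ * (P₁ * P₂) * G i j k l)
      ≤⟨ *-monoˡ {P₂} 0≤P₂ (∑⁴-mono (λ i j k l → by-difference (to0 (E-split≥ i j k l) ⊛ 0≤G i j k l)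
           (lem₂ (falling n 4 * E (split i j k l)) (⟦ (i ∷ j ∷ k ∷ l ∷ []) distinct⟧ * (P₁ * P₂)) (G i j k l)))) ⟩
    P₂ * ∑⁴ (λ i j k l → falling n 4 * E (split i j k l) * G i j k l)
      ≡⟨ cong (P₂ *_) (∑⁴-cong (λ i j k l → trans (lem₃ (falling n 4) (E (split i j k l)) (G i j k l))
           (cong (falling n 4 *_) (trans (sym (E-*ˡ (G i j k l) (split i j k l))) (E-cong (λ ρ → ℚₚ.*-comm (G i j k l) (split i j k l ρ))))))) ⟩
    P₂ * ∑⁴ (λ i j k l → falling n 4 * E (λ ρ → split i j k l ρ * G i j k l))
      ≡⟨ trans (cong (P₂ *_) (trans (∑⁴-*ˡ (falling n 4) _) (cong (falling n 4 *_) (sym (E-∑⁴ (λ i j k l ρ → split i j k l ρ * G i j k l))))))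
           (trans (lem₄ P₂ (falling n 4) _) (cong (falling n 4 *_) (sym (E-*ˡ P₂ _)))) ⟩
    falling n 4 * E (λ ρ → P₂ * ∑⁴ (λ i j k l → split i j k l ρ * G i j k l))
      ≤⟨ *-monoˡ (falling-nonneg n 4) (subst (E (λ ρ → P₂ * ∑⁴ (λ i j k l → split i j k l ρ * G i j k l)) ≤_) (E-const (falling n 4 * bound)) (E-mono halves-at)) ⟩
    falling n 4 * (falling n 4 * bound) ∎
    where
    open ℚₚ.≤-Reasoning
    lem₁ = solve 3 (λ p d g → p :* (d :* g) := d :* p :* g) refl
    lem₂ = solve 3 (λ a b g → a :* g :- b :* g := (a :- b) :* g) refl
    lem₃ = solve 3 (λ a b g → a :* b :* g := a :* (g :* b)) refl
    lem₄ = solve 3 (λ p q s → p :* (q :* s) := q :* (p :* s)) refl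

  -- The constant is 4096·3840: 4096 = 16³ for the three factors `P₁`, `P₂`, `P₂`, each at least
  -- n²/16, and 3840 = 4(864 + 8·12) for `bound`. The two factors `falling n 4`, at most n⁴ each,
  -- come from the marginals of π and of ρ.
  distinctPairs≤ : W ≤ # 12 * (#[ n ]² * # n) → distinctPairs ≤ # 15728640 * (#[ n ]² * #[ n ]² * #[ n ]²) * ε
  distinctPairs≤ W≤ = *-cancelˡ n⁶ 0<n⁶ (begin
    n⁶ * distinctPairs
      ≤⟨ *-mono (0≤n² ⊛ 0≤n² ⊛ 0≤n²) 0≤S (*-mono (0≤n² ⊛ 0≤n²) (0≤# 16 ⊛ 0≤P₂) (*-mono 0≤n² (0≤# 16 ⊛ 0≤P₂) P₁≥ P₂≥) P₂≥) ℚₚ.≤-refl ⟩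
    # 16 * P₁ * (# 16 * P₂) * (# 16 * P₂) * distinctPairs
      ≡⟨ lem₁ P₁ P₂ distinctPairs ⟩
    # 4096 * (P₂ * (P₁ * P₂ * distinctPairs))
      ≤⟨ *-monoˡ (0≤# 4096) averaged ⟩
    # 4096 * (falling n 4 * (falling n 4 * bound))
      ≤⟨ *-monoˡ (0≤# 4096) (*-mono (falling-nonneg n 4) (0≤n² ⊛ 0≤n² ⊛ 0≤b) (falling4≤ n) (*-mono (falling-nonneg n 4) 0≤b (falling4≤ n) bound≤)) ⟩
    # 4096 * (#[ n ]² * #[ n ]² * (#[ n ]² * #[ n ]² * (# 3840 * (#[ n ]² * #[ n ]²) * ε)))
      ≡⟨ lem₂ #[ n ]² ε ⟩
    n⁶ * (# 15728640 * n⁶ * ε) ∎)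
    where
    open ℚₚ.≤-Reasoning
    n⁶ : ℚ
    n⁶ = #[ n ]² * #[ n ]² * #[ n ]²
    0<n⁶ : 0ℚ < n⁶
    0<n⁶ = 0<* (0<* (0<* 0<n 0<n) (0<* 0<n 0<n)) (0<* 0<n 0<n)
    0≤n² : 0ℚ ≤ #[ n ]²
    0≤n² = 0≤sq (# n)
    0≤S : 0ℚ ≤ distinctPairs
    0≤S = ∑⁴-nonneg (λ i j k l → 0≤⟦⟧ (T? (distinct (i ∷ j ∷ k ∷ l ∷ []))) ⊛ 0≤G i j k l)
    0≤b : 0ℚ ≤ # 3840 * (#[ n ]² * #[ n ]²) * ε
    0≤b = 0≤# 3840 ⊛ (0≤n² ⊛ 0≤n²) ⊛ 0≤ε
    N₁≤n : N₁ ≤ # n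
    N₁≤n = #-mono m≤n
    N₂≤n : N₂ ≤ # n
    N₂≤n = by-difference (0≤# m) (lem (# n) (# m))
      where
      lem = solve 2 (λ n m → n :- (n :- m) := m) refl
    0≤N₂ : 0ℚ ≤ N₂
    0≤N₂ = ℚₚ.<⇒≤ 0<N₂
    N₂³≤ : N₂ * N₂ * N₂ ≤ #[ n ]² * # n
    N₂³≤ = *-mono (0≤N₂ ⊛ 0≤N₂) (0≤# n) (*-mono 0≤N₂ (0≤# n) N₂≤n N₂≤n) N₂≤n
    bound≤ : bound ≤ # 3840 * (#[ n ]² * #[ n ]²) * ε
    bound≤ = begin
      bound
        ≤⟨ *-mono (0≤# 4 ⊛ 0≤# m) ((0≤# 864 ⊛ (0≤n² ⊛ 0≤# n) ⊕ 0≤# 8 ⊛ (0≤# 12 ⊛ (0≤n² ⊛ 0≤# n))) ⊛ 0≤ε) (*-monoˡ (0≤# 4) N₁≤n)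
             (*-mono (0≤# 864 ⊛ (0≤N₂ ⊛ 0≤N₂ ⊛ 0≤N₂) ⊕ 0≤# 8 ⊛ 0≤W) 0≤ε (ℚₚ.+-mono-≤ (*-monoˡ (0≤# 864) N₂³≤) (*-monoˡ (0≤# 8) W≤)) ℚₚ.≤-refl) ⟩
      # 4 * # n * ((# 864 * (#[ n ]² * # n) + # 8 * (# 12 * (#[ n ]² * # n))) * ε)
        ≡⟨ lem (# n) ε ⟩
      # 3840 * (#[ n ]² * #[ n ]²) * ε ∎
      where
      lem = solve 2 (λ n e → :# 4 :* n :* ((:# 864 :* (n :² :* n) :+ :# 8 :* (:# 12 :* (n :² :* n))) :* e) := :# 3840 :* (n :² :* (n :²)) :* e) refl
    lem₁ = solve 3 (λ p q s → :# 16 :* p :* (:# 16 :* q) :* (:# 16 :* q) :* s := :# 4096 :* (q :* (p :* q :* s))) refl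
    lem₂ = solve 2 (λ s e → :# 4096 :* (s :² :* (s :² :* (:# 3840 :* (s :²) :* e))) := s :² :* s :* (:# 15728640 :* (s :² :* s) :* e)) refl

  -- Pairs of rectangles with equal rows have weight zero, so distinctness only matters through χ.
  disjointPairs : ∑⁴ (λ i j k l → χ i j k l * G i j k l) ≡ distinctPairs
  disjointPairs = ∑⁴-cong (λ i j k l → begin
    χ i j k l * G i j k l
      ≡⟨ cong (χ i j k l *_) (G-ne i j k l) ⟩
    χ i j k l * (ne i j * ne k l * G i j k l)
      ≡⟨ sym (ℚₚ.*-assoc (χ i j k l) (ne i j * ne k l) (G i j k l)) ⟩
    χ i j k l * (ne i j * ne k l) * G i j k l
      ≡⟨ cong (_* G i j k l) (sym (quadruple-indicator ne ne ne-refl ne-refl i j k l)) ⟩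
    ⟦ (i ∷ j ∷ k ∷ l ∷ []) distinct⟧ * (ne i j * ne k l) * G i j k l
      ≡⟨ trans (ℚₚ.*-assoc ⟦ (i ∷ j ∷ k ∷ l ∷ []) distinct⟧ (ne i j * ne k l) (G i j k l)) (cong (⟦ (i ∷ j ∷ k ∷ l ∷ []) distinct⟧ *_) (sym (G-ne i j k l))) ⟩
    ⟦ (i ∷ j ∷ k ∷ l ∷ []) distinct⟧ * G i j k l ∎)
    where
    open ≡-Reasoning
    G-zero : ∀ i j k l → (∀ a b c d → χ a b c d * (sq (D i j a b) * sq (D k l c d)) ≡ 0ℚ) → G i j k l ≡ 0ℚ
    G-zero i j k l z = ∑⁴-zero z
    lem₁ = solve 2 (λ x s → x :* (:# 0 :* s) := :# 0) refl
    lem₂ = solve 2 (λ x s → x :* (s :* :# 0) := :# 0) refl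
    collapse : ∀ {g} p → g ≡ 0ℚ → g ≡ p * g
    collapse p refl = sym (ℚₚ.*-zeroʳ p)
    G-ne : ∀ i j k l → G i j k l ≡ ne i j * ne k l * G i j k l
    G-ne i j k l = go (i ≟ j) (k ≟ l)
      where
      go : Dec (i ≡ j) → Dec (k ≡ l) → G i j k l ≡ ne i j * ne k l * G i j k l
      go (yes refl) _ = collapse (ne i i * ne k l) (G-zero i i k l (λ a b c d →
        trans (cong (λ t → χ a b c d * (sq t * sq (D k l c d))) (D-row-diag i a b)) (lem₁ (χ a b c d) (sq (D k l c d)))))
      go (no _) (yes refl) = collapse (ne i j * ne k k) (G-zero i j k k (λ a b c d →
        trans (cong (λ t → χ a b c d * (sq (D i j a b) * sq t)) (D-row-diag k c d)) (lem₂ (χ a b c d) (sq (D i j a b)))))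
      go (no i≢j) (no k≢l) = sym (trans (cong₂ (λ p q → p * q * G i j k l) (ne-yes i≢j) (ne-yes k≢l)) (ℚₚ.*-identityˡ (G i j k l)))

-- Lines carrying a constant fraction of the weight

module HeavyLine {n : ℕ} (c : Fin n → Fin n → ℚ) where

  open Linear c

  w : (k l a b : Fin n) → ℚ
  w k l a b = sq (D k l a b)

  0≤w : ∀ k l a b → 0ℚ ≤ w k l a b
  0≤w k l a b = 0≤sq (D k l a b)

  rowWeight colWeight : Fin n → ℚ
  rowWeight i = ∑ (λ l → ∑ (λ c → ∑ (λ d → w i l c d)))
  colWeight a = ∑ (λ k → ∑ (λ l → ∑ (λ d → w k l a d)))

  total : ℚ
  total = ∑⁴ w

  0≤total : 0ℚ ≤ total
  0≤total = ∑⁴-nonneg 0≤w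

  ∑³ : (Fin n → Fin n → Fin n → ℚ) → ℚ
  ∑³ F = ∑ (λ a → ∑ (λ b → ∑ (λ c → F a b c)))

  ∑³-*ˡ : ∀ k (F : Fin n → Fin n → Fin n → ℚ) → ∑³ (λ a b c → k * F a b c) ≡ k * ∑³ F
  ∑³-*ˡ k F = trans (∑-cong (λ a → ∑∑-*ˡ k (F a))) (sum-*ˡ k _ (allFin n))

  meets₁ : ∀ i → ∑⁴ (λ k l c d → ⟦ i ≟ k ⟧ * w k l c d) ≡ rowWeight i
  meets₁ i = trans (∑-cong (λ k → ∑³-*ˡ ⟦ i ≟ k ⟧ (w k))) (∑-single (λ k → ∑³ (w k)) i)

  meets₂ : ∀ i → ∑⁴ (λ k l c d → ⟦ i ≟ l ⟧ * w k l c d) ≡ rowWeight i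
  meets₂ i = ∑-cong (λ k → trans (∑-cong (λ l → ∑∑-*ˡ ⟦ i ≟ l ⟧ (w k l)))
    (trans (∑-single (λ l → ∑ (λ c → ∑ (w k l c))) i) (∑∑-cong (λ c d → trans (cong sq (D-row-swap i k c d)) (sq-neg (D i k c d))))))

  meets₃ : ∀ a → ∑⁴ (λ k l c d → ⟦ a ≟ c ⟧ * w k l c d) ≡ colWeight a
  meets₃ a = ∑∑-cong (λ k l → trans (∑-cong (λ c → sum-*ˡ ⟦ a ≟ c ⟧ (w k l c) (allFin n))) (∑-single (λ c → ∑ (w k l c)) a))

  meets₄ : ∀ a → ∑⁴ (λ k l c d → ⟦ a ≟ d ⟧ * w k l c d) ≡ colWeight a
  meets₄ a = ∑∑-cong (λ k l → ∑-cong (λ c → trans (∑-single (λ d → w k l c d) a)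
    (trans (cong sq (D-col-swap k l a c)) (sq-neg (D k l a c)))))

  apart : (i j a b k l c d : Fin n) → ℚ
  apart i j a b k l c d = ne i k * ne i l * ne j k * ne j l * ne a c * ne a d * ne b c * ne b d

  apart≡ : ∀ i j a b k l c d → apart i j a b k l c d ≡ χ i j k l * χ a b c d
  apart≡ i j a b k l c d = lem (ne i k) (ne i l) (ne j k) (ne j l) (ne a c) (ne a d) (ne b c) (ne b d)
    where
    lem = solve 8 (λ p q r s t u v x → p :* q :* r :* s :* t :* u :* v :* x := p :* q :* (r :* s) :* (t :* u :* (v :* x))) refl

  met : (i j a b k l c d : Fin n) → ℚ
  met i j a b k l c d = ⟦ i ≟ k ⟧ + ⟦ i ≟ l ⟧ + ⟦ j ≟ k ⟧ + ⟦ j ≟ l ⟧ + ⟦ a ≟ c ⟧ + ⟦ a ≟ d ⟧ + ⟦ b ≟ c ⟧ + ⟦ b ≟ d ⟧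

  union : ∀ i j a b k l c d → 1ℚ - met i j a b k l c d ≤ apart i j a b k l c d
  union i j a b k l c d =
    union-step b d (z ⊕ p₂ ⊕ p₃ ⊕ p₄ ⊕ p₅ ⊕ p₆ ⊕ p₇)
    (union-step b c (z ⊕ p₂ ⊕ p₃ ⊕ p₄ ⊕ p₅ ⊕ p₆)
    (union-step a d (z ⊕ p₂ ⊕ p₃ ⊕ p₄ ⊕ p₅)
    (union-step a c (z ⊕ p₂ ⊕ p₃ ⊕ p₄)
    (union-step j l (z ⊕ p₂ ⊕ p₃)
    (union-step j k (z ⊕ p₂)
    (union-step i l z (ℚₚ.≤-refl {ne i k})))))))
    where
    z  = 0≤⟦⟧ (i ≟ k)
    p₂ = 0≤⟦⟧ (i ≟ l)
    p₃ = 0≤⟦⟧ (j ≟ k)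
    p₄ = 0≤⟦⟧ (j ≟ l)
    p₅ = 0≤⟦⟧ (a ≟ c)
    p₆ = 0≤⟦⟧ (a ≟ d)
    p₇ = 0≤⟦⟧ (b ≟ c)

  ∑⁴-met : ∀ i j a b → ∑⁴ (λ k l c d → met i j a b k l c d * w k l c d) ≡
           rowWeight i + rowWeight i + rowWeight j + rowWeight j + colWeight a + colWeight a + colWeight b + colWeight b
  ∑⁴-met i j a b = trans (∑⁴-cong (λ k l c d → lem ⟦ i ≟ k ⟧ ⟦ i ≟ l ⟧ ⟦ j ≟ k ⟧ ⟦ j ≟ l ⟧ ⟦ a ≟ c ⟧ ⟦ a ≟ d ⟧ ⟦ b ≟ c ⟧ ⟦ b ≟ d ⟧ (w k l c d)))
    (add (add (add (add (add (add (add (meets₁ i) (meets₂ i)) (meets₁ j)) (meets₂ j)) (meets₃ a)) (meets₄ a)) (meets₃ b)) (meets₄ b))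
    where
    add : ∀ {F H : Fin n → Fin n → Fin n → Fin n → ℚ} {s t} → ∑⁴ F ≡ s → ∑⁴ H ≡ t → ∑⁴ (λ k l c d → F k l c d + H k l c d) ≡ s + t
    add {F} {H} p q = trans (∑⁴-+ F H) (cong₂ _+_ p q)
    lem = solve 9 (λ p q r s t u v x y → (p :+ q :+ r :+ s :+ t :+ u :+ v :+ x) :* y :=
      p :* y :+ q :* y :+ r :* y :+ s :* y :+ t :* y :+ u :* y :+ v :* y :+ x :* y) refl

  module _ (rows : ∀ i → # 16 * rowWeight i ≤ total) (cols : ∀ a → # 16 * colWeight a ≤ total) where

    -- A rectangle has four lines, and another rectangle can meet each of them in two ways. If every
    -- line carries at most a sixteenth of the total, the union bound loses at most 8/16 of it.
    apart-weight : ∀ i j a b → total ≤ # 2 * ∑⁴ (λ k l c d → χ i j k l * χ a b c d * w k l c d)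
    apart-weight i j a b = begin
      total
        ≤⟨ by-difference (quarter ⊛ (to0 (rows i) ⊕ to0 (rows j) ⊕ to0 (cols a) ⊕ to0 (cols b))) (lem total (rowWeight i) (rowWeight j) (colWeight a) (colWeight b)) ⟩
      # 2 * (total - (rowWeight i + rowWeight i + rowWeight j + rowWeight j + colWeight a + colWeight a + colWeight b + colWeight b))
        ≡⟨ cong (# 2 *_) (trans (∑⁴-- w (λ k l c d → met i j a b k l c d * w k l c d)) (cong (_-_ total) (∑⁴-met i j a b))) ⟨
      # 2 * ∑⁴ (λ k l c d → w k l c d - met i j a b k l c d * w k l c d)
        ≤⟨ *-monoˡ (0≤# 2) (∑⁴-mono (λ k l c d → by-difference (to0 (union i j a b k l c d) ⊛ 0≤w k l c d)
             (trans (cong (λ t → t * w k l c d - (w k l c d - met i j a b k l c d * w k l c d)) (sym (apart≡ i j a b k l c d)))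
               (lem₂ (apart i j a b k l c d) (met i j a b k l c d) (w k l c d))))) ⟩
      # 2 * ∑⁴ (λ k l c d → χ i j k l * χ a b c d * w k l c d) ∎
      where
      open ℚₚ.≤-Reasoning
      quarter : 0ℚ ≤ + 1 / 4
      quarter = ℚₚ.nonNegative⁻¹ (+ 1 / 4)
      lem = solve 5 (λ t p q r s → :# 2 :* (t :- (p :+ p :+ q :+ q :+ r :+ r :+ s :+ s)) :- t :=
        con (+ 1 / 4) :* ((t :- :# 16 :* p) :+ (t :- :# 16 :* q) :+ (t :- :# 16 :* r) :+ (t :- :# 16 :* s))) refl
      lem₂ = solve 3 (λ u m x → u :* x :- (x :- m :* x) := (u :- (:# 1 :- m)) :* x) refl

    total²≤ : total * total ≤ # 2 * ∑⁴ (λ i j k l → χ i j k l * G i j k l)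
    total²≤ = begin
      total * total
        ≡⟨ ∑⁴-*ˡ total w ⟨
      ∑⁴ (λ i j a b → total * w i j a b)
        ≤⟨ ∑⁴-mono (λ i j a b → subst (_≤ # 2 * (w i j a b * inner i j a b)) (ℚₚ.*-comm (w i j a b) total)
             (ℚₚ.≤-trans (*-monoˡ (0≤w i j a b) (apart-weight i j a b)) (ℚₚ.≤-reflexive (lem₁ (w i j a b) (inner i j a b))))) ⟩
      ∑⁴ (λ i j a b → # 2 * (w i j a b * inner i j a b))
        ≡⟨ ∑⁴-*ˡ (# 2) (λ i j a b → w i j a b * inner i j a b) ⟩
      # 2 * ∑⁴ (λ i j a b → w i j a b * inner i j a b)
        ≡⟨ cong (# 2 *_) (∑∑-cong reorder) ⟩
      # 2 * ∑⁴ (λ i j k l → χ i j k l * G i j k l) ∎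
      where
      open ℚₚ.≤-Reasoning
      inner : (i j a b : Fin n) → ℚ
      inner i j a b = ∑⁴ (λ k l c d → χ i j k l * χ a b c d * w k l c d)
      lem₁ = solve 2 (λ x t → x :* (:# 2 :* t) := :# 2 :* (x :* t)) refl
      lem₂ = solve 4 (λ x p q y → x :* (p :* q :* y) := p :* (q :* (x :* y))) refl
      reorder : ∀ i j → ∑ (λ a → ∑ (λ b → w i j a b * inner i j a b)) ≡ ∑ (λ k → ∑ (λ l → χ i j k l * G i j k l))
      reorder i j = trans (∑∑-cong (λ a b → trans (sym (∑⁴-*ˡ (w i j a b) (λ k l c d → χ i j k l * χ a b c d * w k l c d)))
            (∑⁴-cong (λ k l c d → lem₂ (w i j a b) (χ i j k l) (χ a b c d) (w k l c d)))))
        (trans (∑∑-∑∑-swap (λ a b k l → ∑ (λ c → ∑ (λ d → χ i j k l * (χ a b c d * (w i j a b * w k l c d))))))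
          (∑∑-cong (λ k l → ∑⁴-*ˡ (χ i j k l) (λ a b c d → χ a b c d * (w i j a b * w k l c d)))))

-- From a heavy row to a light complement

module Dense {n : ℕ} (c : Fin n → Fin n → ℚ) (f : Perm n → Bool) (ε : ℚ)
  (close : E (λ π → sq (toℚ (f π) - Linear.ℓ c π)) ≤ ε) (2<n : # 2 < # n) (6≤n : # 6 ≤ # n)
  (δ : ℚ) (0<δ : 0ℚ < δ) (δ≤1 : δ ≤ 1ℚ) (small : # 1000000000 * ε ≤ δ * δ) (3072≤nδ : # 3072 ≤ # n * δ) where

  open Energy c f ε close 2<n
  open HeavyLine c

  private
    0≤δ : 0ℚ ≤ δ
    0≤δ = ℚₚ.<⇒≤ 0<δ
    0≤n² : 0ℚ ≤ #[ n ]²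
    0≤n² = 0≤sq (# n)

  bigAt : Fin n → ℚ
  bigAt i = ∑ (λ m → ∑ (λ a → ∑ (λ b → β (D i m a b))))

  rowWeight≤ : ∀ i → rowWeight i ≤ # 2 * bigAt i + # 8 * (#[ n ]² * # n) * ε
  rowWeight≤ i = subst (rowWeight i ≤_) (trans (sum-+ _ _ (allFin n)) (cong₂ _+_ (sum-*ˡ (# 2) _ (allFin n)) (trans (∑-const n (# 8 * #[ n ]² * ε)) (lem (# n) ε))))
    (∑-mono (D²-total≤ i))
    where
    lem = solve 2 (λ n e → n :* (:# 8 :* (n :²) :* e) := :# 8 :* (n :² :* n) :* e) refl

  1024ε≤δ : # 1024 * ε ≤ δ
  1024ε≤δ = ℚₚ.≤-trans (by-difference (0≤# 999998976 ⊛ 0≤ε) (lem ε)) (ℚₚ.≤-trans small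
    (ℚₚ.≤-trans (*-monoˡ 0≤δ δ≤1) (ℚₚ.≤-reflexive (ℚₚ.*-identityʳ δ))))
    where
    lem = solve 1 (λ e → :# 1000000000 :* e :- :# 1024 :* e := :# 999998976 :* e) refl

  -- A fixed rectangle (k, l; c, d) spoils at most 6n² of the rectangles (i, m; a, b): those where m
  -- is k or l, or where a or b is c or d.
  crossings≥ : ∀ i k l c d → bigAt i - # 6 * #[ n ]² ≤ crossings i k l c d
  crossings≥ i k l c d = begin
    bigAt i - # 6 * #[ n ]²
      ≡⟨ cong (_-_ (bigAt i)) ∑³-bad ⟨
    bigAt i - ∑³ bad
      ≡⟨ trans (∑-cong (λ m → ∑∑-- (λ a b → β (D i m a b)) (bad m))) (sum-- _ _ (allFin n)) ⟨
    ∑³ (λ m a b → β (D i m a b) - bad m a b)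
      ≤⟨ ∑-mono (λ m → ∑∑-mono (pointwise m)) ⟩
    crossings i k l c d ∎
    where
    open ℚₚ.≤-Reasoning
    bad good : (m a b : Fin n) → ℚ
    bad m a b = ⟦ k ≟ m ⟧ + ⟦ l ≟ m ⟧ + ⟦ a ≟ c ⟧ + ⟦ a ≟ d ⟧ + ⟦ b ≟ c ⟧ + ⟦ b ≟ d ⟧
    good m a b = ne k m * ne l m * ne a c * ne a d * ne b c * ne b d
    0≤bad : ∀ m a b → 0ℚ ≤ bad m a b
    0≤bad m a b = 0≤⟦⟧ (k ≟ m) ⊕ 0≤⟦⟧ (l ≟ m) ⊕ 0≤⟦⟧ (a ≟ c) ⊕ 0≤⟦⟧ (a ≟ d) ⊕ 0≤⟦⟧ (b ≟ c) ⊕ 0≤⟦⟧ (b ≟ d)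
    good≥ : ∀ m a b → 1ℚ - bad m a b ≤ good m a b
    good≥ m a b =
      union-step b d (0≤⟦⟧ (k ≟ m) ⊕ 0≤⟦⟧ (l ≟ m) ⊕ 0≤⟦⟧ (a ≟ c) ⊕ 0≤⟦⟧ (a ≟ d) ⊕ 0≤⟦⟧ (b ≟ c))
      (union-step b c (0≤⟦⟧ (k ≟ m) ⊕ 0≤⟦⟧ (l ≟ m) ⊕ 0≤⟦⟧ (a ≟ c) ⊕ 0≤⟦⟧ (a ≟ d))
      (union-step a d (0≤⟦⟧ (k ≟ m) ⊕ 0≤⟦⟧ (l ≟ m) ⊕ 0≤⟦⟧ (a ≟ c))
      (union-step a c (0≤⟦⟧ (k ≟ m) ⊕ 0≤⟦⟧ (l ≟ m))
      (union-step l m (0≤⟦⟧ (k ≟ m)) (ℚₚ.≤-refl {ne k m})))))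
    pointwise : ∀ m a b → β (D i m a b) - bad m a b ≤ cross i k l c d m a b
    pointwise m a b = by-difference (0≤bad m a b ⊛ to0 (β≤1 (D i m a b)) ⊕ to0 (good≥ m a b) ⊛ 0≤β (D i m a b))
      (lem (ne k m) (ne l m) (ne a c) (ne a d) (ne b c) (ne b d) (bad m a b) (β (D i m a b)))
      where
      lem = solve 8 (λ p q r s t u x y → p :* q :* (r :* s :* (t :* u)) :* y :- (y :- x) :=
        x :* (:# 1 :- y) :+ (p :* q :* r :* s :* t :* u :- (:# 1 :- x)) :* y) refl
    ∑³-+ : ∀ (F H : Fin n → Fin n → Fin n → ℚ) {s t} → ∑³ F ≡ s → ∑³ H ≡ t → ∑³ (λ a b c → F a b c + H a b c) ≡ s + t
    ∑³-+ F H p q = trans (trans (∑-cong (λ a → ∑∑-+ (F a) (H a))) (sum-+ _ _ (allFin n))) (cong₂ _+_ p q)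
    n² : ℚ
    n² = # n * (# n * 1ℚ)
    once₁ : ∀ t → ∑³ (λ m _ _ → ⟦ t ≟ m ⟧) ≡ n²
    once₁ t = trans (∑-cong (λ m → trans (∑-constant {n} (λ _ → ∑-const n ⟦ t ≟ m ⟧)) (lem (# n) ⟦ t ≟ m ⟧)))
      (trans (∑-single (λ _ → # n * # n) t) (lem₂ (# n)))
      where
      lem = solve 2 (λ n x → n :* (n :* x) := x :* (n :²)) refl
      lem₂ = solve 1 (λ n → n :² := n :* (n :* :# 1)) refl
    once₂ : ∀ t → ∑³ (λ _ a _ → ⟦ a ≟ t ⟧) ≡ n²
    once₂ t = ∑-constant {n} (λ _ → trans (∑-cong (λ a → ∑-const n ⟦ a ≟ t ⟧)) (trans (sum-*ˡ (# n) _ (allFin n)) (cong (# n *_) (∑-onceʳ t))))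
    once₃ : ∀ t → ∑³ (λ _ _ b → ⟦ b ≟ t ⟧) ≡ n²
    once₃ t = ∑-constant {n} (λ _ → ∑-constant {n} (λ _ → ∑-onceʳ t))
    ∑³-bad : ∑³ bad ≡ # 6 * #[ n ]²
    ∑³-bad = trans (∑³-+ _ _ (∑³-+ _ _ (∑³-+ _ _ (∑³-+ _ _ (∑³-+ _ _ (once₁ k) (once₁ l)) (once₂ c)) (once₂ d)) (once₃ c)) (once₃ d)) (lem (# n))
      where
      lem = solve 1 (λ n → n :* (n :* :# 1) :+ n :* (n :* :# 1) :+ n :* (n :* :# 1) :+ n :* (n :* :# 1) :+ n :* (n :* :# 1) :+ n :* (n :* :# 1) :=
        :# 6 :* (n :²)) refl

  -- The hypothesis forces B = `bigAt i` ≥ n³δ/256, since the remaining weight on row i is O(n³ε).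
  -- As nδ ≥ 3072 = 256·12, this is at least 12n², so B - 6n² ≥ B/2, and `row-inequality` gives
  -- A·n³δ ≤ 512·432n⁶ε = 221184n⁶ε.
  heavy-row : ∀ i → #[ n ]² * # n * δ ≤ # 64 * rowWeight i → NearDictator f ε δ (# 8 + # 8 * # 221184)
  heavy-row i heavy = Rounding.rounded c f ε close 2<n i (# 221184) (ℚₚ.≤-trans (#-mono {4} {6} (ℕₚ.m≤m+n 4 2)) 6≤n) 0≤δ δ≤1 (0≤# 221184) light
    where
    A B n³ : ℚ
    A = ∑⁴ (weight i)
    B = bigAt i
    n³ = #[ n ]² * # n
    0<n³ : 0ℚ < n³
    0<n³ = 0<* (0<* 0<n 0<n) 0<n
    B≥ : n³ * δ ≤ # 256 * B
    B≥ = by-difference (0≤# 2 ⊛ to0 heavy ⊕ 0≤# 128 ⊛ to0 (rowWeight≤ i) ⊕ 0≤n² ⊛ 0≤# n ⊛ to0 1024ε≤δ) (lem (# n) δ ε B (rowWeight i))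
      where
      lem = solve 5 (λ n d e b r → :# 256 :* b :- n :² :* n :* d :=
        :# 2 :* (:# 64 :* r :- n :² :* n :* d) :+ :# 128 :* (:# 2 :* b :+ :# 8 :* (n :² :* n) :* e :- r) :+ n :² :* n :* (d :- :# 1024 :* e)) refl
    12n²≤B : # 12 * #[ n ]² ≤ B
    12n²≤B = *-cancelˡ (# 256) (0<#suc 255) (by-difference (to0 B≥ ⊕ 0≤n² ⊛ to0 3072≤nδ) (lem (# n) δ B))
      where
      lem = solve 3 (λ n d b → :# 256 :* b :- :# 256 :* (:# 12 :* (n :²)) := (:# 256 :* b :- n :² :* n :* d) :+ n :² :* (n :* d :- :# 3072)) refl
    0≤A : 0ℚ ≤ A
    0≤A = ∑⁴-nonneg (0≤weight i)
    AB≤ : A * (B - # 6 * #[ n ]²) ≤ # 432 * (#[ n ]² * #[ n ]² * #[ n ]²) * ε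
    AB≤ = begin
      A * (B - # 6 * #[ n ]²)
        ≡⟨ trans (ℚₚ.*-comm A (B - # 6 * #[ n ]²)) (sym (∑⁴-*ˡ (B - # 6 * #[ n ]²) (weight i))) ⟩
      ∑⁴ (λ k l c d → (B - # 6 * #[ n ]²) * weight i k l c d)
        ≤⟨ ∑⁴-mono (λ k l c d → subst (_≤ weight i k l c d * crossings i k l c d) (ℚₚ.*-comm (weight i k l c d) (B - # 6 * #[ n ]²))
             (*-monoˡ (0≤weight i k l c d) (crossings≥ i k l c d))) ⟩
      ∑⁴ (λ k l c d → weight i k l c d * crossings i k l c d)
        ≤⟨ row-inequality i ⟩
      # 432 * (#[ n ]² * #[ n ]² * #[ n ]²) * ε ∎
      where open ℚₚ.≤-Reasoning
    light : A * δ ≤ # 221184 * n³ * ε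
    light = *-cancelˡ n³ 0<n³ (by-difference (0≤A ⊛ to0 B≥ ⊕ 0≤# 256 ⊛ 0≤A ⊛ to0 12n²≤B ⊕ 0≤# 512 ⊛ to0 AB≤) (lem (# n) δ ε A B))
      where
      lem = solve 5 (λ n d e a b → n :² :* n :* (:# 221184 :* (n :² :* n) :* e) :- n :² :* n :* (a :* d) :=
        a :* (:# 256 :* b :- n :² :* n :* d) :+ :# 256 :* a :* (b :- :# 12 :* (n :²)) :+ :# 512 :* (:# 432 :* (n :² :* (n :²) :* (n :²)) :* e
        :- a :* (b :- :# 6 :* (n :²)))) refl

module DenseLine {n : ℕ} (c : Fin n → Fin n → ℚ) (f : Perm n → Bool) (ε : ℚ)
  (close : E (λ π → sq (toℚ (f π) - Linear.ℓ c π)) ≤ ε) (6≤n : # 6 ≤ # n)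
  (δ : ℚ) (0<δ : 0ℚ < δ) (small : # 1000000000 * ε ≤ δ * δ)
  (W≤ : ∑⁴ (λ i k a b → sq (Linear.D c i k a b)) ≤ # 12 * (#[ n ]² * # n))
  (W≥ : #[ n ]² * # n * δ ≤ # 4 * ∑⁴ (λ i k a b → sq (Linear.D c i k a b))) where

  open HeavyLine c

  private
    m : ℕ
    m = n ℕ./ 2
    n≡ : n ≡ n ℕ.% 2 ℕ.+ m ℕ.* 2
    n≡ = ℕ-DivMod.m≡m%n+[m/n]*n n 2
    2m≤n : # 2 * # m ≤ # n
    2m≤n = subst (_≤ # n) (trans (#-* m 2) (ℚₚ.*-comm (# m) (# 2))) (#-mono (subst (m ℕ.* 2 ℕ.≤_) (sym n≡) (ℕₚ.m≤n+m (m ℕ.* 2) (n ℕ.% 2))))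
    n≤2m+1 : # n ≤ # 2 * # m + 1ℚ
    n≤2m+1 = subst (# n ≤_) (trans (#-+ 1 (m ℕ.* 2)) (trans (cong (_+_ 1ℚ) (trans (#-* m 2) (ℚₚ.*-comm (# m) (# 2)))) (ℚₚ.+-comm 1ℚ (# 2 * # m))))
      (#-mono (subst (ℕ._≤ 1 ℕ.+ m ℕ.* 2) (sym n≡) (ℕₚ.+-monoˡ-≤ (m ℕ.* 2) (ℕ.s≤s⁻¹ (ℕ-DivMod.m%n<n n 2)))))

  module DP = DisjointPairs c f ε close 6≤n m (ℕ-DivMod.m/n≤m n 2) 2m≤n n≤2m+1

  line : (∃ λ i → #[ n ]² * # n * δ ≤ # 64 * rowWeight i) ⊎ (∃ λ a → #[ n ]² * # n * δ ≤ # 64 * colWeight a)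
  line = go (any? (λ i → total ≤? # 16 * rowWeight i)) (any? (λ a → total ≤? # 16 * colWeight a))
    where
    scale : ∀ t → total ≤ # 16 * t → #[ n ]² * # n * δ ≤ # 64 * t
    scale t le = ℚₚ.≤-trans W≥ (ℚₚ.≤-trans (*-monoˡ (0≤# 4) le) (ℚₚ.≤-reflexive (lem t)))
      where
      lem = solve 1 (λ t → :# 4 :* (:# 16 :* t) := :# 64 :* t) refl
    contra : (∀ i → # 16 * rowWeight i ≤ total) → (∀ a → # 16 * colWeight a ≤ total) → ⊥
    contra rows cols = ≤⇒¬< (*-cancelˡ n⁶ 0<n⁶ final) 0<δ²
      where
      n³ n⁶ : ℚ
      n³ = #[ n ]² * # n
      n⁶ = #[ n ]² * #[ n ]² * #[ n ]²
      0<n⁶ : 0ℚ < n⁶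
      0<n⁶ = 0<* (0<* (0<* DP.0<n DP.0<n) (0<* DP.0<n DP.0<n)) (0<* DP.0<n DP.0<n)
      0<δ² : 0ℚ < δ * δ
      0<δ² = 0<* 0<δ 0<δ
      0≤δ : 0ℚ ≤ δ
      0≤δ = ℚₚ.<⇒≤ 0<δ
      W²≤ : total * total ≤ # 2 * (# 15728640 * n⁶ * ε)
      W²≤ = ℚₚ.≤-trans (total²≤ rows cols) (*-monoˡ (0≤# 2) (subst (_≤ # 15728640 * n⁶ * ε) (sym DP.disjointPairs) (DP.distinctPairs≤ W≤)))
      W²≥ : n³ * δ * (n³ * δ) ≤ # 4 * total * (# 4 * total)
      W²≥ = *-mono (0≤sq (# n) ⊛ 0≤# n ⊛ 0≤δ) (0≤# 4 ⊛ 0≤total) W≥ W≥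
      -- n⁶δ² ≤ 16W² ≤ 503316480 n⁶ε, while 10⁹ε ≤ δ².
      final : n⁶ * (δ * δ) ≤ n⁶ * 0ℚ
      final = *-cancelˡ (# 496683520) (0<#suc 496683519) (by-difference
        (0≤# 1000000000 ⊛ to0 W²≥ ⊕ 0≤# 16000000000 ⊛ to0 W²≤ ⊕ 0≤# 503316480 ⊛ (ℚₚ.<⇒≤ 0<n⁶ ⊛ to0 small))
        (lem (# n) δ ε total))
        where
        lem = solve 4 (λ n d e t → :# 496683520 :* (n :² :* (n :²) :* (n :²) :* :# 0) :- :# 496683520 :* (n :² :* (n :²) :* (n :²) :* (d :²)) :=
          :# 1000000000 :* (:# 4 :* t :* (:# 4 :* t) :- n :² :* n :* d :* (n :² :* n :* d)) :+ :# 16000000000 :* (:# 2 :* (:# 15728640 :* (n :²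
          :* (n :²) :* (n :²)) :* e) :- t :²) :+ :# 503316480 :* (n :² :* (n :²) :* (n :²) :* (d :² :- :# 1000000000 :* e))) refl
    go : Dec (∃ λ i → total ≤ # 16 * rowWeight i) → Dec (∃ λ a → total ≤ # 16 * colWeight a) → _
    go (yes (i , le)) _              = inj₁ (i , scale (rowWeight i) le)
    go (no _)         (yes (a , le)) = inj₂ (a , scale (colWeight a) le)
    go (no ¬r)        (no ¬c)        = ⊥-elim (contra (λ i → ≰⇒≥ (λ le → ¬r (i , le))) (λ a → ≰⇒≥ (λ le → ¬c (a , le))))

-- Few rows

-- Comparing the failure probability with 0 decides the question, because by `pointwise≤E` a
-- nonnegative function of mean 0 vanishes everywhere.
allPerms? : ∀ {n} {P : Perm n → Set} → (∀ π → Dec (P π)) → Dec (∀ π → P π)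
allPerms? {n} {P} P? = go (E failure ≤? 0ℚ)
  where
  failure : Perm n → ℚ
  failure π = 1ℚ - ⟦ P? π ⟧
  go : Dec (E failure ≤ 0ℚ) → Dec (∀ π → P π)
  go (no ¬h) = no (λ p → ¬h (ℚₚ.≤-reflexive (trans (E-cong (λ π → cong (_-_ 1ℚ) (⟦⟧-yes (P? π) (p π)))) (E-const 0ℚ))))
  go (yes h) = yes (λ π → at π (P? π) (ℚₚ.≤-trans (pointwise≤E failure (λ ρ → to0 (⟦⟧≤1 (P? ρ))) π)
      (subst (# (n !) * E failure ≤_) (ℚₚ.*-zeroʳ (# (n !))) (*-monoˡ (0≤# (n !)) h))))
    where
    at : ∀ π (d : Dec (P π)) → 1ℚ - ⟦ d ⟧ ≤ 0ℚ → P π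
    at π (yes p) _ = p
    at π (no _)  le = ⊥-elim (≤⇒¬< le (0<#suc 0))

Within : ℚ → ℚ → Set
Within b y = (- b ≤ y) × (y ≤ b)

within-+ : ∀ {b b′ y y′} → Within b y → Within b′ y′ → Within (b + b′) (y + y′)
within-+ {b} {b′} {y} {y′} (p , q) (p′ , q′) = subst (_≤ y + y′) (sym (ℚₚ.neg-distrib-+ b b′)) (ℚₚ.+-mono-≤ p p′) , ℚₚ.+-mono-≤ q q′

within-neg : ∀ {b y} → Within b y → Within b (- y)
within-neg {b} {y} (p , q) = ℚₚ.neg-antimono-≤ q , subst (- y ≤_) (lem b) (ℚₚ.neg-antimono-≤ p)
  where
  lem = solve 1 (λ b → :- (:- b) := b) refl

within-weaken : ∀ {b b′ y} → b ≤ b′ → Within b y → Within b′ y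
within-weaken b≤b′ (p , q) = ℚₚ.≤-trans (ℚₚ.neg-antimono-≤ b≤b′) p , ℚₚ.≤-trans q b≤b′

within-∑ : ∀ {n b} {F : Fin n → ℚ} → (∀ k → Within b (F k)) → Within (# n * b) (∑ F)
within-∑ {n} {b} {F} h = subst (_≤ ∑ F) (trans (∑-const n (- b)) (lem (# n) b)) (∑-mono (proj₁ ∘ h)) ,
  subst (∑ F ≤_) (∑-const n b) (∑-mono (proj₂ ∘ h))
  where
  lem = solve 2 (λ m b → m :* (:- b) := :- (m :* b)) refl

τ-comm : ∀ {n} (i k : Fin n) → τ i k ≡ τ k i
τ-comm {n} i k = perm-ext {π = τ i k} {τ k i} at
  where
  at : ∀ t → app (τ i k) t ≡ app (τ k i) t
  at t with t ≟ i | t ≟ k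
  ... | yes refl | _        = trans (τ-first t k) (sym (τ-second k t))
  ... | no _     | yes refl = trans (τ-second i t) (sym (τ-first t i))
  ... | no p     | no q     = trans (τ-other i k t p q) (sym (τ-other k i t q p))

module Exact {n : ℕ} (c : Fin n → Fin n → ℚ) (f : Perm n → Bool) (i₀ : Fin n) (n≤192 : # n ≤ # 192)
  (near : ∀ π → Within (+ 1 / 1000) (toℚ (f π) - Linear.ℓ c π)) where

  open Linear c

  -- Small enough for errors collected over all rows: 4θ + 2nθ ≤ 0.388 < ½ for n ≤ 192, as
  -- `insensitive⇒constant` needs.
  θ : ℚ
  θ = + 1 / 1000

  F : Perm n → ℚ
  F π = toℚ (f π)

  square-near : ∀ π σ υ → Apart σ υ → Within (θ + θ + θ + θ) (F π + F (π ∙ σ ∙ υ) - F (π ∙ σ) - F (π ∙ υ))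
  square-near π σ υ apart = subst (Within (θ + θ + θ + θ)) (trans (cong (λ t → F π - ℓ π + (F (π ∙ σ ∙ υ) - t) + - (F (π ∙ σ) - ℓ (π ∙ σ)) + - (F (π ∙ υ) - ℓ (π ∙ υ))) (ℓ-apart π σ υ apart))
      (lem (F π) (F (π ∙ σ ∙ υ)) (F (π ∙ σ)) (F (π ∙ υ)) (ℓ π) (ℓ (π ∙ σ)) (ℓ (π ∙ υ))))
    (within-+ (within-+ (within-+ (near π) (near (π ∙ σ ∙ υ))) (within-neg (near (π ∙ σ)))) (within-neg (near (π ∙ υ))))
    where
    lem = solve 7 (λ p q r s l l₁ l₂ → p :- l :+ (q :- (l₁ :+ l₂ :- l)) :+ :- (r :- l₁) :+ :- (s :- l₂) := p :+ q :- r :- s) refl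

  Sensitive : Perm n → Fin n → Fin n → Set
  Sensitive π i k = f (π ∙ τ i k) ≡ not (f π)

  -- If both transpositions change f at π, the mixed difference of f over the square is at least 1
  -- in absolute value, while that of ℓ is 0 and the errors contribute at most 4θ.
  no-disjoint : ∀ π i k l m → i ≢ l → i ≢ m → k ≢ l → k ≢ m → Sensitive π i k → Sensitive π l m → ⊥
  no-disjoint π i k l m i≢l i≢m k≢l k≢m s s′ = go (f π) (f (π ∙ τ i k ∙ τ l m)) _ _ s s′ (square-near π (τ i k) (τ l m) apart)
    where
    apart : Apart (τ i k) (τ l m)
    apart t = at (t ≟ i) (t ≟ k)
      where
      at : Dec (t ≡ i) → Dec (t ≡ k) → app (τ i k) t ≡ t ⊎ app (τ l m) t ≡ t
      at (yes refl) _          = inj₂ (τ-other l m t i≢l i≢m)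
      at _          (yes refl) = inj₂ (τ-other l m t k≢l k≢m)
      at (no p)     (no q)     = inj₁ (τ-other i k t p q)
    go : ∀ b x y z → y ≡ not b → z ≡ not b → Within (θ + θ + θ + θ) (toℚ b + toℚ x - toℚ y - toℚ z) → ⊥
    go true  true  _ _ refl refl (_ , h) = ≤⇒¬< h (toWitness {a? = (θ + θ + θ + θ) <? (1ℚ + 1ℚ - 0ℚ - 0ℚ)} tt)
    go true  false _ _ refl refl (_ , h) = ≤⇒¬< h (toWitness {a? = (θ + θ + θ + θ) <? (1ℚ + 0ℚ - 0ℚ - 0ℚ)} tt)
    go false true  _ _ refl refl (h , _) = ≤⇒¬< h (toWitness {a? = (0ℚ + 1ℚ - 1ℚ - 1ℚ) <? - (θ + θ + θ + θ)} tt)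
    go false false _ _ refl refl (h , _) = ≤⇒¬< h (toWitness {a? = (0ℚ + 0ℚ - 1ℚ - 1ℚ) <? - (θ + θ + θ + θ)} tt)

  -- On a coset of the symmetric group of three rows, the signed sum of ℓ vanishes.
  signed-near : ∀ π i k l → i ≢ k → i ≢ l → k ≢ l →
    Within (θ + θ + θ + θ + θ + θ) (F π + F (π ∙ τ i k ∙ τ i l) + F (π ∙ τ i l ∙ τ i k) - F (π ∙ τ i k) - F (π ∙ τ i l) - F (π ∙ τ k l))
  signed-near π i k l i≢k i≢l k≢l = subst (Within (θ + θ + θ + θ + θ + θ))
    (trans (cong₂ (λ s t → F π - ℓ π + (F (π ∙ τ i k ∙ τ i l) - s) + (F (π ∙ τ i l ∙ τ i k) - t) + - (F (π ∙ τ i k) - ℓ (π ∙ τ i k)) + - (F (π ∙ τ i l) - ℓ (π ∙ τ i l)) + - (F (π ∙ τ k l) - ℓ (π ∙ τ k l))) eq₁ eq₂)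
      (trans (cong (λ t → F π - ℓ π + (F (π ∙ τ i k ∙ τ i l) - (ℓ (π ∙ τ i k) - D i l πk πl)) + (F (π ∙ τ i l ∙ τ i k) - (ℓ (π ∙ τ i l) - D i k πl πk)) + - (F (π ∙ τ i k) - ℓ (π ∙ τ i k)) + - (F (π ∙ τ i l) - ℓ (π ∙ τ i l)) + - (F (π ∙ τ k l) - t)) eq₃)
      (lem (F π) (F (π ∙ τ i k ∙ τ i l)) (F (π ∙ τ i l ∙ τ i k)) (F (π ∙ τ i k)) (F (π ∙ τ i l)) (F (π ∙ τ k l)) (ℓ π) (ℓ (π ∙ τ i k)) (ℓ (π ∙ τ i l))
        (c i πk) (c i πl) (c k πk) (c k πl) (c l πk) (c l πl))))
    (within-+ (within-+ (within-+ (within-+ (within-+ (near π) (near (π ∙ τ i k ∙ τ i l))) (near (π ∙ τ i l ∙ τ i k))) (within-neg (near (π ∙ τ i k)))) (within-neg (near (π ∙ τ i l)))) (within-neg (near (π ∙ τ k l))))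
    where
    πk πl : Fin n
    πk = app π k
    πl = app π l
    lem₀ = solve 2 (λ a b → b := a :- (a :- b)) refl
    eq₁ : ℓ (π ∙ τ i k ∙ τ i l) ≡ ℓ (π ∙ τ i k) - D i l πk πl
    eq₁ = trans (lem₀ (ℓ (π ∙ τ i k)) (ℓ (π ∙ τ i k ∙ τ i l))) (cong (_-_ (ℓ (π ∙ τ i k))) (trans (ℓ-τ i l (π ∙ τ i k))
      (cong₂ (D i l) (trans (app-∙ π (τ i k) i) (cong (app π) (τ-first i k))) (trans (app-∙ π (τ i k) l) (cong (app π) (τ-other i k l (i≢l ∘ sym) (k≢l ∘ sym)))))))
    eq₂ : ℓ (π ∙ τ i l ∙ τ i k) ≡ ℓ (π ∙ τ i l) - D i k πl πk
    eq₂ = trans (lem₀ (ℓ (π ∙ τ i l)) (ℓ (π ∙ τ i l ∙ τ i k))) (cong (_-_ (ℓ (π ∙ τ i l))) (trans (ℓ-τ i k (π ∙ τ i l))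
      (cong₂ (D i k) (trans (app-∙ π (τ i l) i) (cong (app π) (τ-first i l))) (trans (app-∙ π (τ i l) k) (cong (app π) (τ-other i l k (i≢k ∘ sym) k≢l))))))
    eq₃ : ℓ (π ∙ τ k l) ≡ ℓ π - D k l πk πl
    eq₃ = trans (lem₀ (ℓ π) (ℓ (π ∙ τ k l))) (cong (_-_ (ℓ π)) (ℓ-τ k l π))
    lem = solve 15 (λ p q r s t u l l₁ l₂ ik il kk kl lk ll → p :- l :+ (q :- (l₁ :- (ik :+ ll :- il :- lk))) :+ (r :- (l₂ :- (il :+ kk :- ik :- kl))) :+ :- (s :- l₁) :+ :- (t :- l₂) :+ :- (u :- (l :- (kk :+ ll :- kl :- lk))) :=
      p :+ q :+ r :- s :- t :- u) refl

  -- With f flipped at the three odd elements of the coset, the signed sum of f is at least 1 in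
  -- absolute value, whatever f does at the two 3-cycles. The errors allow only 6θ.
  no-triangle : ∀ π i k l → i ≢ k → i ≢ l → k ≢ l → Sensitive π i k → Sensitive π i l → Sensitive π k l → ⊥
  no-triangle π i k l i≢k i≢l k≢l s t u = go (f π) (f (π ∙ τ i k ∙ τ i l)) (f (π ∙ τ i l ∙ τ i k)) _ _ _ s t u (signed-near π i k l i≢k i≢l k≢l)
    where
    six : ℚ
    six = θ + θ + θ + θ + θ + θ
    go : ∀ b x y s t u → s ≡ not b → t ≡ not b → u ≡ not b → Within six (toℚ b + toℚ x + toℚ y - toℚ s - toℚ t - toℚ u) → ⊥
    go true  true  true  _ _ _ refl refl refl (_ , h) = ≤⇒¬< h (toWitness {a? = six <? (1ℚ + 1ℚ + 1ℚ - 0ℚ - 0ℚ - 0ℚ)} tt)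
    go true  true  false _ _ _ refl refl refl (_ , h) = ≤⇒¬< h (toWitness {a? = six <? (1ℚ + 1ℚ + 0ℚ - 0ℚ - 0ℚ - 0ℚ)} tt)
    go true  false true  _ _ _ refl refl refl (_ , h) = ≤⇒¬< h (toWitness {a? = six <? (1ℚ + 0ℚ + 1ℚ - 0ℚ - 0ℚ - 0ℚ)} tt)
    go true  false false _ _ _ refl refl refl (_ , h) = ≤⇒¬< h (toWitness {a? = six <? (1ℚ + 0ℚ + 0ℚ - 0ℚ - 0ℚ - 0ℚ)} tt)
    go false true  true  _ _ _ refl refl refl (h , _) = ≤⇒¬< h (toWitness {a? = (0ℚ + 1ℚ + 1ℚ - 1ℚ - 1ℚ - 1ℚ) <? - six} tt)
    go false true  false _ _ _ refl refl refl (h , _) = ≤⇒¬< h (toWitness {a? = (0ℚ + 1ℚ + 0ℚ - 1ℚ - 1ℚ - 1ℚ) <? - six} tt)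
    go false false true  _ _ _ refl refl refl (h , _) = ≤⇒¬< h (toWitness {a? = (0ℚ + 0ℚ + 1ℚ - 1ℚ - 1ℚ - 1ℚ) <? - six} tt)
    go false false false _ _ _ refl refl refl (h , _) = ≤⇒¬< h (toWitness {a? = (0ℚ + 0ℚ + 0ℚ - 1ℚ - 1ℚ - 1ℚ) <? - six} tt)

  Insensitive : Perm n → Fin n → Set
  Insensitive π i = ∀ k l → k ≢ i → l ≢ i → f (π ∙ τ k l) ≡ f π

  -- ℓ(πσ) + ℓ(πσ⁻¹) - 2ℓ(π) is a sum of values of rectangles which all vanish up to θ, while f is extremal at π.
  insensitive⇒constant : ∀ {π i} → Insensitive π i → ∀ {π′} → app π′ i ≡ app π i → f π′ ≡ f π
  insensitive⇒constant {π} {i} ins {π′} agree = subst (λ ρ → f ρ ≡ f π) πσ≡π′ (go (f π) (f (π ∙ σ)) (f (π ∙ σ ⁻¹)) bound)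
    where
    σ : Perm n
    σ = π ⁻¹ ∙ π′
    πσ≡π′ : π ∙ σ ≡ π′
    πσ≡π′ = perm-ext {π = π ∙ σ} {π′} (λ t → trans (app-∙ π σ t) (trans (cong (app π) (app-∙ (π ⁻¹) π′ t)) (app-⁻¹ʳ π (app π′ t))))
    σi≡i : app σ i ≡ i
    σi≡i = app-injective π (trans (sym (app-∙ π σ i)) (trans (cong (λ ρ → app ρ i) πσ≡π′) agree))
    d : Fin n → ℚ
    d k = D k (app σ k) (app π k) (app π (app σ k))
    -- Row k of πσ has column π(σ k), and row σ k of πσ⁻¹ has column π(k). Pairing them, by
    -- reindexing the second sum along σ, completes the rectangle on the rows k and σ k.
    second-difference : ℓ (π ∙ σ) + ℓ (π ∙ σ ⁻¹) - (ℓ π + ℓ π) ≡ - ∑ d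
    second-difference = begin
      ℓ (π ∙ σ) + ℓ (π ∙ σ ⁻¹) - (ℓ π + ℓ π)
        ≡⟨ cong₂ (λ s t → ℓ (π ∙ σ) + s - (ℓ π + t)) (∑-permute σ (λ k → c k (app (π ∙ σ ⁻¹) k))) (∑-permute σ (λ k → c k (app π k))) ⟨
      ℓ (π ∙ σ) + ∑ (λ k → c (app σ k) (app (π ∙ σ ⁻¹) (app σ k))) - (ℓ π + ∑ (λ k → c (app σ k) (app π (app σ k))))
        ≡⟨ cong₂ _-_ (sum-+ _ _ (allFin n)) (sum-+ _ _ (allFin n)) ⟨
      ∑ (λ k → c k (app (π ∙ σ) k) + c (app σ k) (app (π ∙ σ ⁻¹) (app σ k))) - ∑ (λ k → c k (app π k) + c (app σ k) (app π (app σ k)))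
        ≡⟨ sum-- _ _ (allFin n) ⟨
      ∑ (λ k → c k (app (π ∙ σ) k) + c (app σ k) (app (π ∙ σ ⁻¹) (app σ k)) - (c k (app π k) + c (app σ k) (app π (app σ k))))
        ≡⟨ ∑-cong (λ k → trans
             (cong₂ (λ s t → c k s + c (app σ k) t - (c k (app π k) + c (app σ k) (app π (app σ k)))) (app-∙ π σ k)
               (trans (app-∙ π (σ ⁻¹) (app σ k)) (cong (app π) (app-⁻¹ˡ σ k))))
             (lem (c k (app π k)) (c k (app π (app σ k))) (c (app σ k) (app π k)) (c (app σ k) (app π (app σ k))))) ⟩
      ∑ (λ k → - 1ℚ * d k)
        ≡⟨ trans (sum-*ˡ (- 1ℚ) d (allFin n)) (lem₂ (∑ d)) ⟩
      - ∑ d ∎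
      where
      open ≡-Reasoning
      lem = solve 4 (λ p q r s → q :+ r :- (p :+ s) := :- :# 1 :* (p :+ s :- q :- r)) refl
      lem₂ = solve 1 (λ s → :- :# 1 :* s := :- s) refl
    d-small : ∀ k → Within (θ + θ) (d k)
    d-small k = at (k ≟ i)
      where
      lem = solve 3 (λ x l l′ → :- (x :- l) :+ (x :- l′) := l :- l′) refl
      at : Dec (k ≡ i) → Within (θ + θ) (d k)
      at (yes refl) = subst (Within (θ + θ)) (sym (trans (cong (λ t → D k t (app π k) (app π (app σ k))) σi≡i) (D-row-diag k (app π k) (app π (app σ k)))))
        (toWitness {a? = - (θ + θ) ≤? 0ℚ} tt , toWitness {a? = 0ℚ ≤? (θ + θ)} tt)
      at (no k≢i) = subst (Within (θ + θ)) (trans (lem (F π) (ℓ π) (ℓ (π ∙ τ k (app σ k)))) (ℓ-τ k (app σ k) π))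
        (within-+ (within-neg (near π)) (subst (λ b → Within θ (toℚ b - ℓ (π ∙ τ k (app σ k))))
          (ins k (app σ k) k≢i (λ eq → k≢i (app-injective σ (trans eq (sym σi≡i))))) (near (π ∙ τ k (app σ k)))))
    bound : Within ½ (F (π ∙ σ) + F (π ∙ σ ⁻¹) - (F π + F π))
    bound = within-weaken (by-difference (0≤# 2 ⊛ (0≤θ ⊛ to0 n≤192) ⊕ 0≤rest) (lem₂ (# n)))
      (subst (Within (θ + θ + (θ + θ) + # n * (θ + θ))) (trans (cong (λ t → F (π ∙ σ) - ℓ (π ∙ σ) + (F (π ∙ σ ⁻¹) - ℓ (π ∙ σ ⁻¹)) + (- (F π - ℓ π) + - (F π - ℓ π)) + t) (sym second-difference))
          (lem (F π) (F (π ∙ σ)) (F (π ∙ σ ⁻¹)) (ℓ π) (ℓ (π ∙ σ)) (ℓ (π ∙ σ ⁻¹))))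
        (within-+ (within-+ (within-+ (near (π ∙ σ)) (near (π ∙ σ ⁻¹))) (within-+ (within-neg (near π)) (within-neg (near π)))) (within-neg (within-∑ d-small))))
      where
      0≤θ : 0ℚ ≤ θ
      0≤θ = ℚₚ.nonNegative⁻¹ θ
      0≤rest : 0ℚ ≤ + 112 / 1000
      0≤rest = ℚₚ.nonNegative⁻¹ (+ 112 / 1000)
      lem = solve 6 (λ x y z l l₁ l₂ → y :- l₁ :+ (z :- l₂) :+ (:- (x :- l) :+ :- (x :- l)) :+ (l₁ :+ l₂ :- (l :+ l)) := y :+ z :- (x :+ x)) refl
      lem₂ = solve 1 (λ n → con ½ :- (con (+ 1 / 1000) :+ con (+ 1 / 1000) :+ (con (+ 1 / 1000) :+ con (+ 1 / 1000)) :+ n :* (con (+ 1 / 1000) :+ con (+ 1 / 1000))) :=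
        :# 2 :* (con (+ 1 / 1000) :* (:# 192 :- n)) :+ con (+ 112 / 1000)) refl
    go : ∀ b x y → Within ½ (toℚ x + toℚ y - (toℚ b + toℚ b)) → x ≡ b
    go true  true  _     _       = refl
    go false false _     _       = refl
    go true  false true  (h , _) = ⊥-elim (≤⇒¬< h (toWitness {a? = (0ℚ + 1ℚ - (1ℚ + 1ℚ)) <? - ½} tt))
    go true  false false (h , _) = ⊥-elim (≤⇒¬< h (toWitness {a? = (0ℚ + 0ℚ - (1ℚ + 1ℚ)) <? - ½} tt))
    go false true  true  (_ , h) = ⊥-elim (≤⇒¬< h (toWitness {a? = ½ <? (1ℚ + 1ℚ - (0ℚ + 0ℚ))} tt))
    go false true  false (_ , h) = ⊥-elim (≤⇒¬< h (toWitness {a? = ½ <? (1ℚ + 0ℚ - (0ℚ + 0ℚ))} tt))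

  sensitive? : ∀ π i k → Dec (Sensitive π i k)
  sensitive? π i k = f (π ∙ τ i k) Boolₚ.≟ not (f π)

  insensitive-pair : ∀ {π i k} → ¬ Sensitive π i k → f (π ∙ τ i k) ≡ f π
  insensitive-pair {π} {i} {k} ¬s = go (f (π ∙ τ i k)) (f π) ¬s
    where
    go : ∀ x y → ¬ (x ≡ not y) → x ≡ y
    go true  true  _ = refl
    go false false _ = refl
    go true  false h = contradiction refl h
    go false true  h = contradiction refl h

  sensitive-≢ : ∀ {π i k} → Sensitive π i k → i ≢ k
  sensitive-≢ {π} {i} s refl = not-fixed (f π) (trans (sym (cong f (perm-ext {π = π ∙ τ i i} {π} (λ t → trans (app-∙ π (τ i i) t) (cong (app π) (τ-self i t)))))) s)
    where
    not-fixed : ∀ b → b ≡ not b → ⊥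
    not-fixed true  ()
    not-fixed false ()

  sensitive-sym : ∀ {π i k} → Sensitive π i k → Sensitive π k i
  sensitive-sym {π} {i} {k} s = trans (cong (λ σ → f (π ∙ σ)) (τ-comm k i)) s

  SensitiveAvoiding : Perm n → Fin n → Set
  SensitiveAvoiding π i = ∃ λ k → ∃ λ l → k ≢ i × l ≢ i × Sensitive π k l

  avoiding? : ∀ π i → Dec (SensitiveAvoiding π i)
  avoiding? π i = any? (λ k → any? (λ l → ¬? (k ≟ i) ×-dec (¬? (l ≟ i) ×-dec sensitive? π k l)))

  none-avoiding : ∀ {π i} → ¬ SensitiveAvoiding π i → Insensitive π i
  none-avoiding ¬s k l k≢i l≢i = insensitive-pair (λ s → ¬s (k , l , k≢i , l≢i , s))

  -- Sensitive transpositions pairwise intersect and contain no triangle, so they form a star.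
  star : ∀ π → ∃ (Insensitive π)
  star π = go (any? (λ i → any? (λ k → sensitive? π i k)))
    where
    meet : ∀ {i k l m} → Sensitive π i k → Sensitive π l m → l ≢ i → m ≢ i → ∃ λ t → t ≢ i × Sensitive π k t
    meet {i} {k} {l} {m} s s′ l≢i m≢i = at (k ≟ l) (k ≟ m)
      where
      at : Dec (k ≡ l) → Dec (k ≡ m) → ∃ λ t → t ≢ i × Sensitive π k t
      at (yes refl) _          = m , m≢i , s′
      at _          (yes refl) = l , l≢i , sensitive-sym {π} {l} {m} s′
      at (no p)     (no q)     = ⊥-elim (no-disjoint π i k l m (l≢i ∘ sym) (m≢i ∘ sym) p q s s′)
    go : Dec (∃ λ i → ∃ λ k → Sensitive π i k) → ∃ (Insensitive π)
    go (no none) = i₀ , λ k l _ _ → insensitive-pair (λ s → none (k , l , s))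
    go (yes (i , k , ik)) = go₂ (avoiding? π i) (avoiding? π k)
      where
      i≢k : i ≢ k
      i≢k = sensitive-≢ {π} {i} {k} ik
      go₂ : Dec (SensitiveAvoiding π i) → Dec (SensitiveAvoiding π k) → ∃ (Insensitive π)
      go₂ (no none) _         = i , none-avoiding none
      go₂ (yes _)   (no none) = k , none-avoiding none
      go₂ (yes (p , q , p≢i , q≢i , s)) (yes (p′ , q′ , p′≢k , q′≢k , s′)) =
        triangle (meet {i} {k} {p} {q} ik s p≢i q≢i) (meet {k} {i} {p′} {q′} (sensitive-sym {π} {i} {k} ik) s′ p′≢k q′≢k)
        where
        triangle : (∃ λ l → l ≢ i × Sensitive π k l) → (∃ λ m → m ≢ k × Sensitive π i m) → ∃ (Insensitive π)
        triangle (l , l≢i , kl) (m , m≢k , im) = last (l ≟ m)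
          where
          last : Dec (l ≡ m) → ∃ (Insensitive π)
          last (yes refl) = ⊥-elim (no-triangle π i k l i≢k (l≢i ∘ sym) (m≢k ∘ sym) ik im kl)
          last (no l≢m)   = ⊥-elim (no-disjoint π k l i m (i≢k ∘ sym) (m≢k ∘ sym) l≢i l≢m kl im)

  -- Cells that determine f, and the exact dictator

  Cert : Bool → Fin n → Fin n → Set
  Cert b i a = ∀ π → app π i ≡ a → f π ≡ b

  cert? : ∀ b i a → Dec (Cert b i a)
  cert? b i a = allPerms? (λ π → (app π i ≟ a) →-dec (f π Boolₚ.≟ b))

  certificate : ∀ π → ∃ λ i → Cert (f π) i (app π i)
  certificate π = proj₁ (star π) , λ π′ → insensitive⇒constant (proj₂ (star π)) {π′}

  through : ∀ {i k a b} → i ≢ k → a ≢ b → Σ (Perm n) λ π → app π i ≡ a × app π k ≡ b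
  through {i} {k} {a} {b} i≢k a≢b = proj₁ found , proj₂ found zero , proj₂ found (suc zero)
    where
    found : Σ (Perm n) λ σ → ∀ t → app σ (lookup (i ∷ k ∷ []) t) ≡ lookup (a ∷ b ∷ []) t
    found = transitive (i ∷ k ∷ []) (a ∷ b ∷ []) (distinct₂ i≢k) (distinct₂ a≢b)

  true≢false : true ≢ false
  true≢false ()

  -- Two cells in different rows and different columns lie on a common permutation, where f would
  -- take both values.
  collinear : ∀ {i k a b} → Cert true i a → Cert false k b → i ≢ k → a ≡ b
  collinear {i} {k} {a} {b} p q i≢k = go (a ≟ b)
    where
    go : Dec (a ≡ b) → a ≡ b
    go (yes eq)  = eq
    go (no a≢b)  = ⊥-elim (true≢false (trans (sym (p (proj₁ π) (proj₁ (proj₂ π)))) (q (proj₁ π) (proj₂ (proj₂ π)))))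
      where
      π : Σ (Perm n) λ π → app π i ≡ a × app π k ≡ b
      π = through i≢k a≢b

  IsRow IsColumn : Set
  IsRow    = Σ (Fin n) λ i → Σ (Fin n → Bool) λ J → ∀ π → f π ≡ J (app π i)
  IsColumn = Σ (Fin n) λ j → Σ (Fin n → Bool) λ J → ∀ π → f π ≡ J (app (π ⁻¹) j)

  not-cert : ∀ {i a} π → (f π ≡ false → Cert false i a) → (Cert false i a → f π ≡ false) → f π ≡ not ⌊ cert? false i a ⌋
  not-cert {i} {a} π to from = go (f π) refl (cert? false i a)
    where
    go : ∀ b → f π ≡ b → (d : Dec (Cert false i a)) → f π ≡ not ⌊ d ⌋
    go true  eq (yes p) = from p
    go true  eq (no _)  = eq
    go false eq (yes _) = eq
    go false eq (no ¬p) = contradiction (to eq) ¬p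

  from-certificate : ∀ π {b} → f π ≡ b → ∃ λ i → Cert b i (app π i)
  from-certificate π refl = certificate π

  is-point : ∀ {i j} → Cert true i j → (∀ π → f π ≡ true → app π i ≡ j) → IsRow
  is-point {i} {j} ij only = i , (λ a → ⌊ a ≟ j ⌋) , λ π → go π (f π) refl (app π i ≟ j)
    where
    go : ∀ π b → f π ≡ b → (d : Dec (app π i ≡ j)) → f π ≡ ⌊ d ⌋
    go π b     eq (yes p) = ij π p
    go π false eq (no _)  = eq
    go π true  eq (no ¬p) = contradiction (only π eq) ¬p

  -- Every permutation passes through a cell forcing its value, and by `collinear` each cell forcing
  -- true shares a line with each cell forcing false. Given a true cell (i, j), if all false cells
  -- lie in row i, or all in column j, then f is read off that line. Otherwise there are false cells
  -- (k, j) and (i, l), which confine the true cells to (i, j) and (k, l).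
  dictator : IsRow ⊎ IsColumn
  dictator = go₁ (any? (λ i → any? (λ j → cert? true i j)))
    where
    go₁ : Dec (∃ λ i → ∃ λ j → Cert true i j) → IsRow ⊎ IsColumn
    go₁ (no none) = inj₁ (i₀ , (λ _ → false) , λ π → always-false π (f π) refl)
      where
      always-false : ∀ π b → f π ≡ b → f π ≡ false
      always-false π false eq = eq
      always-false π true  eq = contradiction (proj₁ (from-certificate π eq) , app π (proj₁ (from-certificate π eq)) , proj₂ (from-certificate π eq)) none
    go₁ (yes (i , j , ij)) = go₂ (any? (λ k → any? (λ l → ¬? (k ≟ i) ×-dec cert? false k l)))
      where
      go₂ : Dec (∃ λ k → ∃ λ l → k ≢ i × Cert false k l) → IsRow ⊎ IsColumn
      go₂ (no none) = inj₁ (i , (λ a → not ⌊ cert? false i a ⌋) , λ π → not-cert π (in-row π) (λ p → p π refl))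
        where
        in-row : ∀ π → f π ≡ false → Cert false i (app π i)
        in-row π eq = at (from-certificate π eq)
          where
          at : (∃ λ k → Cert false k (app π k)) → Cert false i (app π i)
          at (k , p) = case (k ≟ i)
            where
            case : Dec (k ≡ i) → Cert false i (app π i)
            case (yes k≡i) = subst (λ t → Cert false t (app π t)) k≡i p
            case (no k≢i)  = contradiction (k , app π k , k≢i , p) none
      go₂ (yes (k , l′ , k≢i , kl′)) = go₃ (any? (λ p → any? (λ l → ¬? (l ≟ j) ×-dec cert? false p l)))
        where
        kj : Cert false k j
        kj = subst (Cert false k) (sym (collinear ij kl′ (k≢i ∘ sym))) kl′
        go₃ : Dec (∃ λ p → ∃ λ l → l ≢ j × Cert false p l) → IsRow ⊎ IsColumn
        go₃ (no none) = inj₂ (j , (λ a → not ⌊ cert? false a j ⌋) , λ π → not-cert π (in-column π) (λ p → p π (app-⁻¹ʳ π j)))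
          where
          in-column : ∀ π → f π ≡ false → Cert false (app (π ⁻¹) j) j
          in-column π eq = at (from-certificate π eq)
            where
            at : (∃ λ p → Cert false p (app π p)) → Cert false (app (π ⁻¹) j) j
            at (p , q) = case (app π p ≟ j)
              where
              case : Dec (app π p ≡ j) → Cert false (app (π ⁻¹) j) j
              case (no ≢j)  = contradiction (p , app π p , ≢j , q) none
              case (yes ≡j) = subst₂ (Cert false) (trans (sym (app-⁻¹ˡ π p)) (cong (app (π ⁻¹)) ≡j)) ≡j q
        go₃ (yes (p , l , l≢j , pl)) = go₄ (cert? true k l)
          where
          il : Cert false i l
          il = at (p ≟ i)
            where
            at : Dec (p ≡ i) → Cert false i l
            at (yes eq) = subst (λ t → Cert false t l) eq pl
            at (no p≢i) = contradiction (sym (collinear ij pl (p≢i ∘ sym))) l≢j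
          -- A certificate for true shares a line with both (i, l) and (k, j).
          corners : ∀ {q a} → Cert true q a → (q ≡ i × a ≡ j) ⊎ (q ≡ k × a ≡ l)
          corners {q} {a} qa = at (q ≟ i) (q ≟ k)
            where
            at : Dec (q ≡ i) → Dec (q ≡ k) → (q ≡ i × a ≡ j) ⊎ (q ≡ k × a ≡ l)
            at (yes q≡i) (yes q≡k) = contradiction (trans (sym q≡k) q≡i) k≢i
            at (yes q≡i) (no q≢k)  = inj₁ (q≡i , collinear qa kj q≢k)
            at (no q≢i)  (yes q≡k) = inj₂ (q≡k , collinear qa il q≢i)
            at (no q≢i)  (no q≢k)  = contradiction (trans (sym (collinear qa il q≢i)) (collinear qa kj q≢k)) l≢j
          go₄ : Dec (Cert true k l) → IsRow ⊎ IsColumn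
          go₄ (no ¬kl) = inj₁ (is-point ij only)
            where
            only : ∀ π → f π ≡ true → app π i ≡ j
            only π eq = at (from-certificate π eq)
              where
              at : (∃ λ q → Cert true q (app π q)) → app π i ≡ j
              at (q , r) = case (corners r)
                where
                case : (q ≡ i × app π q ≡ j) ⊎ (q ≡ k × app π q ≡ l) → app π i ≡ j
                case (inj₁ (q≡i , eq′)) = trans (cong (app π) (sym q≡i)) eq′
                case (inj₂ (q≡k , eq′)) = contradiction (subst₂ (Cert true) q≡k eq′ r) ¬kl
          go₄ (yes kl) = go₅ (any? (λ m → ¬? (m ≟ i) ×-dec ¬? (m ≟ k)))
            where
            go₅ : Dec (∃ λ m → m ≢ i × m ≢ k) → IsRow ⊎ IsColumn
            -- There are only the rows i and k, so a permutation through (k, l) also passes through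
            -- (i, j).
            go₅ (no none) = inj₁ (is-point ij only)
              where
              only : ∀ π → f π ≡ true → app π i ≡ j
              only π eq = at (from-certificate π eq)
                where
                back : app π (app (π ⁻¹) j) ≡ j
                back = app-⁻¹ʳ π j
                at : (∃ λ q → Cert true q (app π q)) → app π i ≡ j
                at (q , r) = case (corners r) (app (π ⁻¹) j ≟ i) (app (π ⁻¹) j ≟ k)
                  where
                  case : (q ≡ i × app π q ≡ j) ⊎ (q ≡ k × app π q ≡ l) → Dec (app (π ⁻¹) j ≡ i) → Dec (app (π ⁻¹) j ≡ k) → app π i ≡ j
                  case (inj₁ (q≡i , eq′)) _        _        = trans (cong (app π) (sym q≡i)) eq′
                  case (inj₂ _)           (yes ≡i) _        = trans (cong (app π) (sym ≡i)) back
                  case (inj₂ (q≡k , eq′)) (no _)   (yes ≡k) = contradiction (trans (sym eq′) (trans (cong (app π) (trans q≡k (sym ≡k))) back)) l≢j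
                  case (inj₂ _)           (no ≢i)  (no ≢k)  = contradiction (app (π ⁻¹) j , ≢i , ≢k) none
            -- Take π through (i, j) and (k, l). The four cells fix all six values of f on its coset
            -- for the rows i, k, m: true at π, π ∙ τ i m and π ∙ τ k m, false at the other three.
            -- The signed sum is then 1 - 1 - 1 = -1, which is too far from 0.
            go₅ (yes (m , m≢i , m≢k)) = absurd (through {i} {k} {j} {l} (k≢i ∘ sym) (l≢j ∘ sym))
              where
              parity : ∀ a b c d e g → a ≡ true → b ≡ false → c ≡ false → d ≡ false → e ≡ true → g ≡ true →
                Within (θ + θ + θ + θ + θ + θ) (toℚ a + toℚ b + toℚ c - toℚ d - toℚ e - toℚ g) → ⊥
              parity _ _ _ _ _ _ refl refl refl refl refl refl (h , _) =
                ≤⇒¬< h (toWitness {a? = (1ℚ + 0ℚ + 0ℚ - 0ℚ - 1ℚ - 1ℚ) <? - (θ + θ + θ + θ + θ + θ)} tt)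
              absurd : (Σ (Perm n) λ π → app π i ≡ j × app π k ≡ l) → IsRow ⊎ IsColumn
              absurd (π , πi , πk) = ⊥-elim (parity _ _ _ _ _ _ (ij π πi)
                (kj (π ∙ τ i k ∙ τ i m) (trans (app-∙ (π ∙ τ i k) (τ i m) k) (trans (cong (app (π ∙ τ i k)) (τ-other i m k k≢i (m≢k ∘ sym)))
                  (trans (app-∙ π (τ i k) k) (trans (cong (app π) (τ-second i k)) πi)))))
                (il (π ∙ τ i m ∙ τ i k) (trans (app-∙ (π ∙ τ i m) (τ i k) i) (trans (cong (app (π ∙ τ i m)) (τ-first i k))
                  (trans (app-∙ π (τ i m) k) (trans (cong (app π) (τ-other i m k k≢i (m≢k ∘ sym))) πk)))))
                (il (π ∙ τ i k) (trans (app-∙ π (τ i k) i) (trans (cong (app π) (τ-first i k)) πk)))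
                (kl (π ∙ τ i m) (trans (app-∙ π (τ i m) k) (trans (cong (app π) (τ-other i m k k≢i (m≢k ∘ sym))) πk)))
                (ij (π ∙ τ k m) (trans (app-∙ π (τ k m) i) (trans (cong (app π) (τ-other k m i (k≢i ∘ sym) (m≢i ∘ sym))) πi)))
                (signed-near π i k m (k≢i ∘ sym) (m≢i ∘ sym) (m≢k ∘ sym)))

exact-row : ∀ {n} (f : Perm n → Bool) {ε δ K′} i J → (∀ π → f π ≡ J (app π i)) → 0ℚ ≤ K′ * ε → NearDictator f ε δ K′
exact-row {n} f {ε} {δ} {K′} i J eq 0≤ = nearDictator (rowSet i J) (rowSet-dictator i J)
  (subst (_≤ K′ * ε) (sym (trans (cong (_* δ) Pr≡0) (ℚₚ.*-zeroˡ δ))) 0≤)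
  where
  agree : ∀ p q → p ≡ q → toℚ (not ⌊ p ℚ≟ q ⌋) ≡ 0ℚ
  agree p q p≡q with p ℚ≟ q
  ... | yes _  = refl
  ... | no p≢q = contradiction p≡q p≢q
  Pr≡0 : PrNeq n (λ π → toℚ (f π)) (sumOver (rowSet i J)) ≡ 0ℚ
  Pr≡0 = trans (PrNeq≡ _ _) (trans (E-cong (λ π → agree (toℚ (f π)) (sumOver (rowSet i J) π)
    (trans (cong toℚ (eq π)) (sym (sumOver-rowSet i J π))))) (E-const 0ℚ))

NearDictator-weaken : ∀ {n} {f : Perm n → Bool} {ε δ a b} → 0ℚ ≤ ε → a ≤ b → NearDictator f ε δ a → NearDictator f ε δ b
NearDictator-weaken {ε = ε} {a = a} {b} 0≤ε a≤b (nearDictator 𝒞 d h) = nearDictator 𝒞 d (ℚₚ.≤-trans h (by-difference (to0 a≤b ⊛ 0≤ε) (lem a b ε)))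
  where
  lem = solve 3 (λ a b e → b :* e :- a :* e := (b :- a) :* e) refl

sq≤⇒≤ : ∀ {θ y} → 0ℚ < θ → sq y ≤ sq θ → y ≤ θ
sq≤⇒≤ {θ} {y} 0<θ h with y ≤? θ
... | yes p = p
... | no ¬p = ⊥-elim (≤⇒¬< h (ℚₚ.≤-<-trans (*-monoˡ (ℚₚ.<⇒≤ 0<θ) (≰⇒≥ ¬p)) (ℚₚ.*-monoˡ-<-pos y {{positive (ℚₚ.<-trans 0<θ (ℚₚ.≰⇒> ¬p))}} (ℚₚ.≰⇒> ¬p))))

sq≤⇒within : ∀ {θ y} → 0ℚ < θ → sq y ≤ sq θ → Within θ y
sq≤⇒within {θ} {y} 0<θ h = subst (- θ ≤_) (lem y) (ℚₚ.neg-antimono-≤ (sq≤⇒≤ 0<θ (subst (_≤ sq θ) (sym (sq-neg y)) h))) , sq≤⇒≤ 0<θ h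
  where
  lem = solve 1 (λ b → :- (:- b) := b) refl

!-mono : ∀ {m n} → m ℕ.≤ n → m ! ℕ.≤ n !
!-mono {m} {n} m≤n = go (ℕₚ.≤⇒≤′ m≤n)
  where
  go : ∀ {n} → m ℕ.≤′ n → m ! ℕ.≤ n !
  go ℕ.≤′-refl              = ℕₚ.≤-refl
  go (ℕ.≤′-step {n} m≤′n) = ℕₚ.≤-trans (go m≤′n) (ℕₚ.m≤m+n (n !) (n ℕ.* n !))

-- Abstract so that 192! is never evaluated.
abstract
  192! : ℕ
  192! = 192 !

  !≤192! : ∀ {n} → n ℕ.≤ 192 → n ! ℕ.≤ 192!
  !≤192! = !-mono

  1≤192! : 1 ℕ.≤ 192!
  1≤192! = !-mono {0} {192} z≤n

-- The three regimes put together

module Cases {n : ℕ} (i₀ : Fin n) (ε δ : ℚ) (0≤ε : 0ℚ ≤ ε) (0<δ : 0ℚ < δ)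
  (small : # 192! * # 1000000 * (# 192! * # 1000000) * ε ≤ δ * δ)
  (f : Perm n → Bool) (c : Fin n → Fin n → ℚ)
  (close : E (λ π → sq (toℚ (f π) - Linear.ℓ c π)) ≤ ε)
  (δ≤p : δ ≤ E (λ π → toℚ (f π))) (p≤1-δ : E (λ π → toℚ (f π)) ≤ 1ℚ - δ) where

  K′ : ℚ
  K′ = # 8 + # 8 * # 221184

  private
    open Transpose c f
    0≤δ : 0ℚ ≤ δ
    0≤δ = ℚₚ.<⇒≤ 0<δ
    1≤F : 1ℚ ≤ # 192!
    1≤F = #-mono 1≤192!
    0≤F : 0ℚ ≤ # 192!
    0≤F = 0≤# 192!
    δ≤1 : δ ≤ 1ℚ
    δ≤1 = by-difference (to0 (ℚₚ.≤-trans δ≤p p≤1-δ) ⊕ 0≤δ) (lem δ)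
      where
      lem = solve 1 (λ d → :# 1 :- d := :# 1 :- d :- d :+ d) refl
    δ²≤1 : δ * δ ≤ 1ℚ
    δ²≤1 = *-mono 0≤δ 0≤1 δ≤1 δ≤1
    closeᵗ : E (λ π → sq (toℚ (f⁻¹ π) - Linear.ℓ cᵀ π)) ≤ ε
    closeᵗ = subst (_≤ ε) (sym closeᵀ) close
    tera : # 1000000000000 * ε ≤ δ * δ
    tera = ℚₚ.≤-trans (by-difference (0≤# 1000000000000 ⊛ (to0 1≤F ⊛ (0≤F ⊕ 0≤1)) ⊛ 0≤ε) (lem (# 192!) ε)) small
      where
      lem = solve 2 (λ a e → a :* :# 1000000 :* (a :* :# 1000000) :* e :- :# 1000000000000 :* e :=
        :# 1000000000000 :* ((a :- :# 1) :* (a :+ :# 1)) :* e) refl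
    giga : # 1000000000 * ε ≤ δ * δ
    giga = ℚₚ.≤-trans (by-difference (0≤# 999000000000 ⊛ 0≤ε) (lem ε)) tera
      where
      lem = solve 1 (λ e → :# 1000000000000 :* e :- :# 1000000000 :* e := :# 999000000000 :* e) refl
    8ε≤δ : # 8 * ε ≤ δ
    8ε≤δ = ℚₚ.≤-trans (by-difference (0≤# 999999992 ⊛ 0≤ε) (lem ε)) (ℚₚ.≤-trans giga
      (subst (δ * δ ≤_) (ℚₚ.*-identityʳ δ) (*-monoˡ 0≤δ δ≤1)))
      where
      lem = solve 1 (λ e → :# 1000000000 :* e :- :# 8 :* e := :# 999999992 :* e) refl
    0≤K′ε : 0ℚ ≤ K′ * ε
    0≤K′ε = (0≤# 8 ⊕ 0≤# 8 ⊛ 0≤# 221184) ⊛ 0≤ε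

  few-rows : n ℕ.≤ 192 → NearDictator f ε δ K′
  few-rows n≤192 = go (Exact.dictator c f i₀ (#-mono n≤192) near)
    where
    near : ∀ π → Within (+ 1 / 1000) (toℚ (f π) - Linear.ℓ c π)
    -- The pointwise error is at most n!·ε ≤ 192!·ε, and (192!·10⁶)²ε ≤ δ² ≤ 1 makes this at most
    -- (1/1000)².
    near π = sq≤⇒within (ℚₚ.positive⁻¹ (+ 1 / 1000)) (ℚₚ.≤-trans
      (pointwise≤E (λ π → sq (toℚ (f π) - Linear.ℓ c π)) (λ π → 0≤sq (toℚ (f π) - Linear.ℓ c π)) π)
      (ℚₚ.≤-trans (*-mono (0≤# (n !)) 0≤ε (#-mono (!≤192! n≤192)) close)
        (*-cancelˡ (# 1000000000000) (0<#suc 999999999999) (by-difference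
          (0≤# 1000000000000 ⊛ (to0 1≤F ⊛ 0≤F) ⊛ 0≤ε ⊕ to0 small ⊕ to0 δ²≤1 ⊕ 0≤# 999999) (lem (# 192!) ε (δ * δ))))))
      where
      lem = solve 3 (λ a e d → :# 1000000000000 :* (con (+ 1 / 1000) :* (con (+ 1 / 1000))) :- :# 1000000000000 :* (a :* e) :=
        :# 1000000000000 :* ((a :- :# 1) :* a) :* e :+ (d :- a :* :# 1000000 :* (a :* :# 1000000) :* e) :+ (:# 1 :- d) :+ :# 999999) refl
    go : Exact.IsRow c f i₀ (#-mono n≤192) near ⊎ Exact.IsColumn c f i₀ (#-mono n≤192) near → NearDictator f ε δ K′
    go (inj₁ (i , J , eq)) = exact-row f i J eq 0≤K′ε
    go (inj₂ (j , J , eq)) = untranspose (exact-row f⁻¹ j J (λ π → trans (eq (π ⁻¹)) (cong (λ ρ → J (app ρ j)) (⁻¹-involutive π))) 0≤K′ε)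

  module _ (192≤n : # 192 ≤ # n) where

    private
      2<n : # 2 < # n
      2<n = ℚₚ.<-≤-trans (toWitness {a? = # 2 <? # 192} tt) 192≤n
      6≤n : # 6 ≤ # n
      6≤n = ℚₚ.≤-trans (#-mono {6} {192} (ℕₚ.m≤m+n 6 186)) 192≤n

    sparse : # n * δ ≤ # 3072 → NearDictator f ε δ K′
    sparse nδ≤ = NearDictator-weaken 0≤ε (by-difference (0≤# 1572864) refl) (go (S.heavy-line i₀))
      where
      -- From 10¹²ε ≤ δ² follows 65536n²ε ≤ 65536(nδ)²/10¹² ≤ 65536·3072²/10¹² < 1.
      tiny : # 65536 * #[ n ]² * ε ≤ 1ℚ
      tiny = *-cancelˡ (# 1000000000000) (0<#suc 999999999999) (by-difference
        (0≤# 65536 ⊛ 0≤sq (# n) ⊛ to0 tera ⊕ 0≤# 65536 ⊛ to0 (*-mono (0≤# n ⊛ 0≤δ) (0≤# 3072) nδ≤ nδ≤) ⊕ 0≤# 381524709376) (lem (# n) δ ε))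
        where
        lem = solve 3 (λ n d e → :# 1000000000000 :* :# 1 :- :# 1000000000000 :* (:# 65536 :* (n :²) :* e) :=
          :# 65536 :* (n :²) :* (d :² :- :# 1000000000000 :* e) :+ :# 65536 :* (:# 3072 :* :# 3072 :- n :* d :* (n :* d)) :+ :# 381524709376) refl
      module S = Sparse c f ε close 2<n 192≤n tiny
      module Sᵀ = Sparse cᵀ f⁻¹ ε closeᵗ 2<n 192≤n tiny
      go : (∃ S.BareOutsideRow) ⊎ (∃ S.BareOutsideColumn) → NearDictator f ε δ (# 8 + # 8 * # 24576)
      go (inj₁ (i , bare)) = S.bare-row bare 0<δ δ≤1 nδ≤
      go (inj₂ (j , bare)) = untranspose (Sᵀ.bare-row {j} (λ k l a b k≢j l≢j → trans (cong β (Dᵀ k l a b)) (bare a b k l k≢j l≢j)) 0<δ δ≤1 nδ≤)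

    dense : # 3072 ≤ # n * δ → NearDictator f ε δ K′
    dense ≤nδ = go DL.line
      where
      module En = Energy c f ε close 2<n
      module DL = DenseLine c f ε close 6≤n δ 0<δ giga (En.W≤ δ 0<δ δ≤p p≤1-δ 8ε≤δ) (En.W≥ δ 0<δ δ≤p p≤1-δ 8ε≤δ)
      open HeavyLine
      colWeightᵀ : ∀ j → rowWeight cᵀ j ≡ colWeight c j
      colWeightᵀ j = trans (∑-cong (λ m → ∑∑-cong (λ a b → cong sq (Dᵀ j m a b))))
        (trans (∑∑-swap (λ m a → ∑ (λ b → w c a b j m))) (∑-cong (λ a → ∑∑-swap (λ m b → w c a b j m))))
      go : _ ⊎ _ → NearDictator f ε δ K′
      go (inj₁ (i , heavy)) = Dense.heavy-row c f ε close 2<n 6≤n δ 0<δ δ≤1 giga ≤nδ i heavy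
      go (inj₂ (j , heavy)) = untranspose (Dense.heavy-row cᵀ f⁻¹ ε closeᵗ 2<n 6≤n δ 0<δ δ≤1 giga ≤nδ j
        (subst (λ t → #[ n ]² * # n * δ ≤ # 64 * t) (sym (colWeightᵀ j)) heavy))

    many-rows : NearDictator f ε δ K′
    many-rows = Sum.[ sparse , dense ]′ (ℚₚ.≤-total (# n * δ) (# 3072))

  near-dictator : NearDictator f ε δ K′
  near-dictator = Sum.[ few-rows , (λ 192≤n → many-rows (#-mono 192≤n)) ]′ (ℕₚ.≤-total n 192)

theorem1p5 : Σ ℚ λ K → Σ ℚ λ K′ → (0ℚ < K) × (0ℚ < K′) ×
    ((n : ℕ) → n ≥ℕ 1 → (ε δ : ℚ) → 0ℚ ≤ ε → 0ℚ < δ →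
    K * K * ε ≤ δ * δ →
    (f : Perm n → Bool) →
    (Σ (Fin n → Fin n → ℚ) λ c →
    𝔼 n (λ π → (toℚ (f π) - linear c π) * (toℚ (f π) - linear c π)) ≤ ε) →
    δ ≤ 𝔼 n (λ π → toℚ (f π)) →
    𝔼 n (λ π → toℚ (f π)) ≤ 1ℚ - δ →
    Σ (Fin n → Fin n → Bool) λ 𝒞 →
    IsDictatorSet 𝒞 × (PrNeq n (λ π → toℚ (f π)) (sumOver 𝒞) * δ ≤ K′ * ε))
-- The factor 192! of K comes from the regime n ≤ 192; K′ comes from the dense one, where
-- `Rounding.rounded` is applied with κ = 221184.
theorem1p5 = # 192! * # 1000000 , # 8 + # 8 * # 221184 ,
  0<* (ℚₚ.<-≤-trans (0<#suc 0) (#-mono 1≤192!)) (0<#suc 999999) , ℚₚ.positive⁻¹ (# 8 + # 8 * # 221184) , main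
  where
  main : (n : ℕ) → n ≥ℕ 1 → (ε δ : ℚ) → 0ℚ ≤ ε → 0ℚ < δ → # 192! * # 1000000 * (# 192! * # 1000000) * ε ≤ δ * δ →
    (f : Perm n → Bool) → (Σ (Fin n → Fin n → ℚ) λ c → 𝔼 n (λ π → (toℚ (f π) - linear c π) * (toℚ (f π) - linear c π)) ≤ ε) →
    δ ≤ 𝔼 n (λ π → toℚ (f π)) → 𝔼 n (λ π → toℚ (f π)) ≤ 1ℚ - δ →
    Σ (Fin n → Fin n → Bool) λ 𝒞 → IsDictatorSet 𝒞 × (PrNeq n (λ π → toℚ (f π)) (sumOver 𝒞) * δ ≤ (# 8 + # 8 * # 221184) * ε)
  -- n ≥ 1 supplies the row `zero`, the default line when nothing singles out another.
  main (suc n) _ ε δ 0≤ε 0<δ small f (c , close) δ≤p p≤1-δ = NearDictator.𝒞 d , NearDictator.isDictator d , NearDictator.bound d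
    where
    d : NearDictator f ε δ (# 8 + # 8 * # 221184)
    d = Cases.near-dictator zero ε δ 0≤ε 0<δ small f c
      (subst (_≤ ε) (trans (sym (E≡𝔼 _)) (E-cong (λ π → cong (λ t → sq (toℚ (f π) - t)) (Linear.linear≡ℓ c π)))) close)
      (subst (δ ≤_) (sym (E≡𝔼 (λ π → toℚ (f π)))) δ≤p) (subst (_≤ 1ℚ - δ) (sym (E≡𝔼 (λ π → toℚ (f π)))) p≤1-δ)
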